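{- For every $n\ge 2$ the genus distribution of ${\cal S}_{11}^n$ is unimodal, and its peak $p_{11}(n)$ is $$p_{11}(n)=\begin{cases}\Big[\dfrac{n}{2}\Big]+1, & 2\le n\le 5,\\[2mm] \Big[\dfrac{n+1}{3}\Big]+2, & 6\le n\le 16,\\[2mm] \Big[\dfrac{n+2}{3}\Big]+2, & n\ge 17.\end{cases}$$
   Context: $[x]$ denotes the largest integer not exceeding $x$. A surface is represented by a cyclic word in which every occurring letter $x$ appears exactly once as $x$ and exactly once as $x^-$; it is the closed orientable surface obtained from a polygon with boundary labelled by the word by identifying each side $x$ with the side $x^-$ (orientation reversed), and its genus is the genus of that surface. Let $a,b,c,a_1,a_2,\dots$ be distinct letters. For $n\ge 1$ and subsets $K,T\subseteq\{1,\dots,n\}$ put: $R_1^n$ = product of the letters $a_k$, $k\in K$, in decreasing order of index; $R_2^n$ = product of the $a_k$, $k\notin K$, in increasing order of index; $R_3^n$ = product of the $a_t^-$, $t\in T$, in decreasing order of index; $R_4^n$ = product of the $a_t^-$, $t\notin T$, in increasing order of index. The set of ladder surfaces considered is ${\cal S}_{11}^n=\{R_1^naR_2^na^-bR_3^nb^-cR_4^nc^-\}$, where $(K,T)$ runs over all $4^n$ pairs of subsets and surfaces are counted with multiplicity (one for each pair). The genus distribution of ${\cal S}_{11}^n$ is the sequence $(g_{i_{11}}(n))_i$, where $g_{i_{11}}(n)$ is the number of surfaces of genus $i$ in ${\cal S}_{11}^n$ and $i$ runs from the minimum to the maximum genus. A finite sequence of nonnegative numbers $\{a_i\}_{i=q}^n$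 is unimodal if $a_q\le\cdots\le a_{l-1}<a_l=\cdots=a_m>a_{m+1}\ge\cdots\ge a_n$ for some $q\le l\le m\le n$; if $l=m$, then $m$ is called the peak (indices are genera). -}

module Defs where

open import Data.Bool using (Bool; true; false; not; if_then_else_)
import Data.Bool.Properties as Bool
open import Data.Fin using (Fin; toℕ)
open import Data.Fin.Subset using (Subset; inside; outside; ∁)
open import Data.Fin.Subset.Properties using (_∈?_)
open import Data.List using (List; []; _∷_; [_]; _++_; map; filter; foldr; concat; length; reverse; allFin; zip; cartesianProduct; partition)
open import Data.List.Membership.Propositional using (_∈_)
import Data.List.Membership.DecPropositional as DecMembership
open import Data.Nat using (ℕ; zero; suc; _+_; _∸_; _≤_; _<_; _≤ᵇ_; _/_; _≟_)
open import Data.Product using (_×_; _,_; ∃₂)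
open import Data.Product.Properties using (≡-dec)
import Data.Vec as Vec
open import Relation.Binary using (DecidableEquality)
open import Relation.Binary.PropositionalEquality using (_≡_; refl; cong)
open import Relation.Nullary using (yes; no)
open import Relation.Nullary.Decidable using (map′; _⊎-dec_)

------------------------------------------------------------------------
-- Surfaces given by cyclic words

data Letter : Set where
  a b c : Letter
  a[_]  : ℕ → Letter

infix 4 _≟ᴸ_

_≟ᴸ_ : DecidableEquality Letter
a      ≟ᴸ a      = yes refl
a      ≟ᴸ b      = no λ ()
a      ≟ᴸ c      = no λ ()
a      ≟ᴸ a[ _ ] = no λ ()
b      ≟ᴸ a      = no λ ()
b      ≟ᴸ b      = yes refl
b      ≟ᴸ c      = no λ ()
b      ≟ᴸ a[ _ ] = no λ ()
c      ≟ᴸ a      = no λ ()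
c      ≟ᴸ b      = no λ ()
c      ≟ᴸ c      = yes refl
c      ≟ᴸ a[ _ ] = no λ ()
a[ _ ] ≟ᴸ a      = no λ ()
a[ _ ] ≟ᴸ b      = no λ ()
a[ _ ] ≟ᴸ c      = no λ ()
a[ i ] ≟ᴸ a[ j ] = map′ (cong a[_]) (λ { refl → refl }) (i ≟ j)

-- A side of the polygon: (x , true) is the letter x, (x , false) is x⁻.

Side : Set
Side = Letter × Bool

infix 8 _⁺ _⁻

_⁺ _⁻ : Letter → Side
x ⁺ = x , true
x ⁻ = x , false

inverse : Side → Side
inverse (x , e) = x , not e

_≟ˢ_ : DecidableEquality Side
_≟ˢ_ = ≡-dec _≟ᴸ_ Bool._≟_

open DecMembership _≟ˢ_ using () renaming (_∈?_ to _∈ˢ?_)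

-- The cyclic word read off the boundary of the polygon, cut open at some place.

Word : Set
Word = List Side

-- Each corner of the polygon is named by the side starting there.  If t is
-- the cyclic successor of s, then the end point of s is the corner t, while
-- gluing s to s⁻ with reversed orientation glues the end point of s to the
-- starting point of s⁻.  So the identifications of corners are exactly the
-- pairs (s⁻ , t) for t the cyclic successor of s.

successors : Word → List (Side × Side)
successors []      = []
successors (s ∷ w) = zip (s ∷ w) (w ++ [ s ])

cornerGluings : Word → List (Side × Side)
cornerGluings w = map (λ (s , t) → inverse s , t) (successors w)

-- A partition of the set of corners, given as the list of its blocks;
-- merge unites the block of s with the block of t.

Partition : Set
Partition = List (List Side)

merge : Side × Side → Partition → Partition
merge (s , t) P =
  let hit , rest = partition (λ B → (s ∈ˢ? B) ⊎-dec (t ∈ˢ? B)) P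
  in concat hit ∷ rest

-- The vertices of the surface: the classes of corners under the
-- equivalence relation generated by the gluings.

vertices : Word → Partition
vertices w = foldr merge (map [_] w) (cornerGluings w)

-- The surface has one face, length w / 2 edges, and Euler characteristic
-- 2 - 2 g = V - E + 1.  For words in which every occurring x appears once as x
-- and once as x⁻ neither the subtraction nor the division truncates.

genus : Word → ℕ
genus w = (1 + length w / 2 ∸ length (vertices w)) / 2

_ : genus (a ⁺ ∷ b ⁺ ∷ b ⁻ ∷ a ⁻ ∷ []) ≡ 0
_ = refl

_ : genus (a ⁺ ∷ b ⁺ ∷ a ⁻ ∷ b ⁻ ∷ []) ≡ 1
_ = refl

------------------------------------------------------------------------
-- The ladder surfaces

-- The subset K of {1,…,n} is a Subset n, with k : Fin n standing for 1 + toℕ k.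

increasing decreasing : ∀ {n} → Subset n → List Letter
increasing {n} K = map (λ k → a[ suc (toℕ k) ]) (filter (_∈? K) (allFin n))
decreasing K     = reverse (increasing K)

R₁ R₂ R₃ R₄ : ∀ {n} → Subset n → Word
R₁ K = map _⁺ (decreasing K)
R₂ K = map _⁺ (increasing (∁ K))
R₃ T = map _⁻ (decreasing T)
R₄ T = map _⁻ (increasing (∁ T))

ladder : ∀ {n} → Subset n → Subset n → Word
ladder K T =
  R₁ K ++ a ⁺ ∷ R₂ K ++ a ⁻ ∷ b ⁺ ∷ R₃ T ++ b ⁻ ∷ c ⁺ ∷ R₄ T ++ c ⁻ ∷ []

allSubsets : ∀ n → List (Subset n)
allSubsets zero    = [ Vec.[] ]
allSubsets (suc n) =
  map (inside Vec.∷_) (allSubsets n) ++ map (outside Vec.∷_) (allSubsets n)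

-- The multiset 𝒮₁₁ⁿ, with one entry for each pair (K , T).

𝒮₁₁ : ℕ → List Word
𝒮₁₁ n = map (λ (K , T) → ladder K T) (cartesianProduct (allSubsets n) (allSubsets n))

g₁₁ : ℕ → ℕ → ℕ
g₁₁ n i = length (filter (λ w → genus w ≟ i) (𝒮₁₁ n))

------------------------------------------------------------------------
-- Unimodality

record IsMinimumGenus (S : List Word) (q : ℕ) : Set where
  field
    attained : q ∈ map genus S
    minimal  : ∀ i → i ∈ map genus S → q ≤ i

record IsMaximumGenus (S : List Word) (r : ℕ) : Set where
  field
    attained : r ∈ map genus S
    maximal  : ∀ i → i ∈ map genus S → i ≤ r

-- f q ≤ ⋯ ≤ f (l - 1) < f l = ⋯ = f m > f (m + 1) ≥ ⋯ ≥ f r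

record Shape (f : ℕ → ℕ) (q r l m : ℕ) : Set where
  field
    q≤l      : q ≤ l
    l≤m      : l ≤ m
    m≤r      : m ≤ r
    ascent   : ∀ i → q ≤ i → suc i < l → f i ≤ f (suc i)
    rise     : ∀ i → q ≤ i → suc i ≡ l → f i < f (suc i)
    plateau  : ∀ i → l ≤ i → i < m → f i ≡ f (suc i)
    fall     : m < r → f (suc m) < f m
    descent  : ∀ i → m < i → i < r → f (suc i) ≤ f i

Unimodal : (f : ℕ → ℕ) (q r : ℕ) → Set
Unimodal f q r = ∃₂ λ l m → Shape f q r l m

IsPeak : (f : ℕ → ℕ) (q r p : ℕ) → Set
IsPeak f q r p = Shape f q r p p

p₁₁ : ℕ → ℕ
p₁₁ n =
  if n ≤ᵇ 5 then n / 2 + 1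
  else if n ≤ᵇ 16 then (n + 1) / 3 + 2
  else (n + 2) / 3 + 2

{-# OPTIONS --safe #-}

-- Adding the letters a₁, a₂, … one at a time, the vertices of the surface evolve like the
-- states of a finite automaton: all that matters is how the corners at the four places
-- where a next letter can go are linked.  Summing over all pairs (K , T) gives a linear
-- system in the generating polynomials of the states, which is solved explicitly.  With
-- the Lucas numbers L n k = n/(n-k) C(n-k,k) and b k = 8ᵏ L n k, the number of surfaces of
-- genus k + 2 is
--   2ⁿ⁺ᵏ L n k + b (k + 1) - b k
-- up to corrections at k = 0 and near k = n/2.  The ratio of consecutive values of the
-- first term is at least 1 exactly for 3 k + 1 ≤ n, with equality at n = 3 k + 1, where
-- the second difference of b decides.  This locates the peak for n ≥ 20; smaller n are
-- computed.

module Submission where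

-- An inserted letter adds one edge, so the number of vertices plus twice the genus grows by exactly
-- one at each step. The genus is therefore a sum of increments, each determined by the current
-- state and the two choices for the letter. The states are the 24 permutations of the four gaps,
-- which collapse to 13 classes. The change of `p₁₁` at n = 17 comes from the ties n = 3 k + 1.
-- There the second difference b (k + 2) - 2 b (k + 1) + b k is negative for n = 7, 10, 13, 16 and
-- positive from n = 19 on, so the peak moves up by one. The argument for large n uses the cruder b
-- (k + 2) ≥ 2 b (k + 1), which at a tie is false for n = 19 and true from n = 22 on. Beyond the tie
-- the first term loses the fraction (3 k - n + 1) / (k + 1) or more. Since it carries the factor 2
-- ^ (n - 2 k), this outweighs the b terms, which are bounded by a fixed multiple of b k. The
-- remaining corrections are powers of 4 and are compared with 8 ^ k ≤ b k.

open import Defs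

-- Counting the classes computed by successive merging

module Components where

  open import Data.List using (List; []; _∷_; [_]; map; filter; foldr; concat; length; head)
  open import Data.List.Membership.Propositional using (_∈_)
  open import Data.List.Membership.Propositional.Properties
  open import Data.List.Membership.Propositional.Properties.WithK using (unique∧set⇒bag)
  open import Data.List.Properties using (length-map; partition-defn)
  open import Data.List.Relation.Binary.BagAndSetEquality using (∼bag⇒↭)
  open import Data.List.Relation.Binary.Permutation.Propositional.Properties using (↭-length)
  open import Data.List.Relation.Unary.All as All using (All; []; _∷_)
  open import Data.List.Relation.Unary.AllPairs as AllPairs using (AllPairs; []; _∷_)
  import Data.List.Relation.Unary.AllPairs.Properties as AllPairs
  open import Data.List.Relation.Unary.Any as Any using (here; there)
  open import Data.List.Relation.Unary.Unique.Propositional using (Unique)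
  import Data.List.Relation.Unary.Unique.Propositional.Properties as Unique
  import Data.List.Membership.DecPropositional as DecMembership
  open import Data.Maybe using (Maybe; just)
  import Data.Maybe as Maybe
  open import Data.Maybe.Properties using (just-injective)
  open import Data.Product using (_×_; _,_; ∃; proj₁; proj₂)
  open import Data.Sum using (_⊎_; inj₁; inj₂; [_,_]′)
  open import Function using (_∘_; id)
  open import Function.Bundles using (mk⇔)
  open import Relation.Binary.Construct.Closure.Equivalence as Eq using (EqClosure)
  open import Relation.Binary.PropositionalEquality hiding ([_])
  open import Relation.Nullary using (yes; no; contradiction)
  open import Relation.Nullary.Decidable using (_⊎-dec_)
  open import Relation.Unary using (Decidable)
  open import Relation.Unary.Properties using (∁?)

  open DecMembership _≟ˢ_ using () renaming (_∈?_ to _∈ˢ?_)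

  Edges : Set
  Edges = List (Side × Side)

  infix 4 _⊢_~_

  _⊢_~_ : Edges → Side → Side → Set
  E ⊢ s ~ t = EqClosure (λ u v → (u , v) ∈ E) s t

  ~-mono : ∀ {E E′} → (∀ {e} → e ∈ E → e ∈ E′) → ∀ {s t} → E ⊢ s ~ t → E′ ⊢ s ~ t
  ~-mono sub = Eq.map sub

  ~-edge : ∀ {E s t} → (s , t) ∈ E → E ⊢ s ~ t
  ~-edge = Eq.return

  ~-refl : ∀ {E s} → E ⊢ s ~ s
  ~-refl = Eq.reflexive _

  ~-sym : ∀ {E s t} → E ⊢ s ~ t → E ⊢ t ~ s
  ~-sym = Eq.symmetric _

  ~-trans : ∀ {E s t u} → E ⊢ s ~ t → E ⊢ t ~ u → E ⊢ s ~ u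
  ~-trans = Eq.transitive _

  -- A certificate that the fibres of `f` on `V` are the classes generated by `E`. It refers to no
  -- algorithm, so a labelling found by hand can be compared with the one that accompanies `merge`.
  record Labelling {L : Set} (V : Word) (E : Edges) (f : Side → L) : Set where
    field
      respects  : ∀ {s t} → (s , t) ∈ E → f s ≡ f t
      connected : ∀ {s t} → s ∈ V → t ∈ V → f s ≡ f t → E ⊢ s ~ t

    respects-~ : ∀ {s t} → E ⊢ s ~ t → f s ≡ f t
    respects-~ = Eq.gfold isEquivalence f respects

  open Labelling

  identify : Side → Side → Side → Side
  identify s t u with u ≟ˢ s
  ... | yes _ = t
  ... | no  _ = u

  identify-source : ∀ s t → identify s t s ≡ t
  identify-source s t with s ≟ˢ s
  ... | yes _  = refl
  ... | no s≢s = contradiction refl s≢s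

  identify-target : ∀ s t → identify s t t ≡ t
  identify-target s t with t ≟ˢ s
  ... | yes _ = refl
  ... | no  _ = refl

  identify-other : ∀ {s u} t → u ≢ s → identify s t u ≡ u
  identify-other {s} {u} t u≢s with u ≟ˢ s
  ... | yes u≡s = contradiction u≡s u≢s
  ... | no  _   = refl

  identify-injective : ∀ s t u v → identify s t u ≡ identify s t v →
                       u ≡ v ⊎ ((u ≡ s ⊎ u ≡ t) × (v ≡ s ⊎ v ≡ t))
  identify-injective s t u v eq with u ≟ˢ s | v ≟ˢ s
  ... | yes p | yes q = inj₁ (trans p (sym q))
  ... | yes p | no  q = inj₂ (inj₁ p , inj₂ (sym eq))
  ... | no  p | yes q = inj₂ (inj₂ eq , inj₁ q)
  ... | no  p | no  q = inj₁ eq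

  -- The only coincidence that `identify` creates is between the labels of `s` and `t`, and corners
  -- carrying these labels are connected through the new edge.
  addEdge : ∀ {V E f s t} → Labelling V E f → s ∈ V → t ∈ V →
            Labelling V ((s , t) ∷ E) (identify (f s) (f t) ∘ f)
  addEdge {V} {E} {f} {s} {t} lab s∈V t∈V = record
    { respects  = λ where
        (here refl) → trans (identify-source (f s) (f t)) (sym (identify-target (f s) (f t)))
        (there e∈E) → cong (identify (f s) (f t)) (respects lab e∈E)
    ; connected = λ {u} {v} u∈V v∈V eq → [ (λ fu≡fv → weaken (connected lab u∈V v∈V fu≡fv))
        , (λ (p , q) → ~-trans (toEnd u∈V p) (~-sym (toEnd v∈V q)))
        ]′ (identify-injective (f s) (f t) (f u) (f v) eq)
    }
    where
    weaken : ∀ {u v} → E ⊢ u ~ v → (s , t) ∷ E ⊢ u ~ v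
    weaken = ~-mono there

    toEnd : ∀ {u} → u ∈ V → f u ≡ f s ⊎ f u ≡ f t → (s , t) ∷ E ⊢ u ~ t
    toEnd u∈V (inj₁ fu≡fs) = ~-trans (weaken (connected lab u∈V s∈V fu≡fs)) (~-edge (here refl))
    toEnd u∈V (inj₂ fu≡ft) = weaken (connected lab u∈V t∈V fu≡ft)

  Separated : ∀ {L : Set} → (Side → L) → List Side → List Side → Set
  Separated f B B′ = ∀ {s t} → s ∈ B → t ∈ B′ → f s ≢ f t

  -- `separate` speaks of labels rather than of corners: it says at once that blocks are disjoint
  -- and that no label is spread over two blocks, which turns a count of blocks into a count of
  -- labels.
  record Fibres {L : Set} (V : Word) (f : Side → L) (P : Partition) : Set where
    field
      nonempty : ∀ {B} → B ∈ P → ∃ λ s → s ∈ B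
      constant : ∀ {B s t} → B ∈ P → s ∈ B → t ∈ B → f s ≡ f t
      separate : AllPairs (Separated f) P
      covers   : ∀ {s} → s ∈ V → ∃ λ B → B ∈ P × s ∈ B
      within   : ∀ {B s} → B ∈ P → s ∈ B → s ∈ V

  open Fibres

  separated⇒≡ : ∀ {L : Set} {f : Side → L} {P B B′ s t} → AllPairs (Separated f) P →
                B ∈ P → B′ ∈ P → s ∈ B → t ∈ B′ → f s ≡ f t → B ≡ B′
  separated⇒≡ (_ ∷ _)    (here refl) (here refl)  _   _    _  = refl
  separated⇒≡ (all ∷ _)  (here refl) (there B′∈P) s∈B t∈B′ eq =
    contradiction eq (All.lookup all B′∈P s∈B t∈B′)
  separated⇒≡ (all ∷ _)  (there B∈P) (here refl)  s∈B t∈B′ eq =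
    contradiction (sym eq) (All.lookup all B∈P t∈B′ s∈B)
  separated⇒≡ (_ ∷ rest) (there B∈P) (there B′∈P) s∈B t∈B′ eq =
    separated⇒≡ rest B∈P B′∈P s∈B t∈B′ eq

  singletons : ∀ {V} → Unique V → Fibres V id (map [_] V)
  singletons {V} uniq = record
    { nonempty = λ B∈ → let (s , _ , B≡) = ∈-map⁻ [_] B∈ in s , subst (s ∈_) (sym B≡) (here refl)
    ; constant = λ B∈ s∈ t∈ → let (u , _ , B≡) = ∈-map⁻ [_] B∈ in
        trans (the (subst (_ ∈_) B≡ s∈)) (sym (the (subst (_ ∈_) B≡ t∈)))
    ; separate = AllPairs.map⁺ (AllPairs.map (λ { u≢v (here refl) (here refl) → u≢v }) uniq)
    ; covers   = λ s∈ → _ , ∈-map⁺ [_] s∈ , here refl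
    ; within   = λ B∈ s∈ → let (u , u∈ , B≡) = ∈-map⁻ [_] B∈ in
        subst (_∈ V) (sym (the (subst (_ ∈_) B≡ s∈))) u∈
    }
    where
    the : ∀ {s u : Side} → s ∈ [ u ] → s ≡ u
    the (here eq) = eq

  separated-relabel : ∀ {L L′ : Set} {f : Side → L} {g : Side → L′} {P} →
    (∀ {B B′ s t} → B ∈ P → B′ ∈ P → s ∈ B → t ∈ B′ → g s ≡ g t → f s ≡ f t) →
    AllPairs (Separated f) P → AllPairs (Separated g) P
  separated-relabel _ []           = []
  separated-relabel h (all ∷ rest) =
    All.tabulate (λ B′∈ s∈ t∈ eq → All.lookup all B′∈ s∈ t∈ (h (here refl) (there B′∈) s∈ t∈ eq))
    ∷ separated-relabel (λ B∈ B′∈ → h (there B∈) (there B′∈)) rest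

  touches? : ∀ s t → Decidable (λ (B : List Side) → s ∈ B ⊎ t ∈ B)
  touches? s t B = (s ∈ˢ? B) ⊎-dec (t ∈ˢ? B)

  -- A block is hit exactly when its label is that of `s` or that of `t`. If these labels agree
  -- there is a single hit block, `concat` returns it, and `identify` changes nothing.
  merge-fibres : ∀ {V f P s t} → Fibres V f P → s ∈ V → t ∈ V →
                 Fibres V (identify (f s) (f t) ∘ f)
                   (concat (filter (touches? s t) P) ∷ filter (∁? (touches? s t)) P)
  merge-fibres {V} {f} {P} {s} {t} F s∈V t∈V = record
    { nonempty = λ where
        (here refl) → let (B , B∈P , s∈B) = covers F s∈V in
          s , ∈-concat⁺′ s∈B (∈-filter⁺ Q? B∈P (inj₁ s∈B))
        (there B∈) → nonempty F (restIn B∈)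
    ; constant = λ where
        (here refl) x∈ y∈ → trans (hitLabel x∈) (sym (hitLabel y∈))
        (there B∈) x∈ y∈  → cong ν (constant F (restIn B∈) x∈ y∈)
    ; separate =
        All.tabulate (λ B∈ x∈ y∈ eq →
          restLabel B∈ y∈ .proj₂ (trans (sym (restLabel B∈ y∈ .proj₁)) (trans (sym eq) (hitLabel x∈))))
        ∷ separated-relabel
            (λ B∈ B′∈ x∈ y∈ eq →
              trans (sym (restLabel B∈ x∈ .proj₁)) (trans eq (restLabel B′∈ y∈ .proj₁)))
            (AllPairs.filter⁺ (∁? Q?) (separate F))
    ; covers   = cover
    ; within   = λ where
        (here refl) x∈ → let (B , x∈B , B∈) = ∈-concat⁻′ (filter Q? P) x∈ in
          within F (∈-filter⁻ Q? {xs = P} B∈ .proj₁) x∈B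
        (there B∈) x∈ → within F (restIn B∈) x∈
    }
    where
    Q? = touches? s t
    ν = identify (f s) (f t)

    restIn : ∀ {B} → B ∈ filter (∁? Q?) P → B ∈ P
    restIn B∈ = ∈-filter⁻ (∁? Q?) {xs = P} B∈ .proj₁

    hitLabel : ∀ {x} → x ∈ concat (filter Q? P) → ν (f x) ≡ f t
    hitLabel x∈ with ∈-concat⁻′ (filter Q? P) x∈
    ... | B , x∈B , B∈ with ∈-filter⁻ Q? {xs = P} B∈
    ... | B∈P , inj₁ s∈B = trans (cong ν (constant F B∈P x∈B s∈B)) (identify-source (f s) (f t))
    ... | B∈P , inj₂ t∈B = trans (cong ν (constant F B∈P x∈B t∈B)) (identify-target (f s) (f t))

    restLabel : ∀ {B x} → B ∈ filter (∁? Q?) P → x ∈ B → ν (f x) ≡ f x × f x ≢ f t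
    restLabel {B} {x} B∈ x∈ = identify-other (f t) (avoid inj₁ s∈V) , avoid inj₂ t∈V
      where
      avoid : ∀ {z} → (∀ {B} → z ∈ B → s ∈ B ⊎ t ∈ B) → z ∈ V → f x ≢ f z
      avoid touch z∈V eq =
        let (B′ , B′∈P , z∈B′) = covers F z∈V
            (B∈P , ¬Q)         = ∈-filter⁻ (∁? Q?) {xs = P} B∈
        in ¬Q (touch (subst (_ ∈_) (sym (separated⇒≡ (separate F) B∈P B′∈P x∈ z∈B′ eq)) z∈B′))

    cover : ∀ {x} → x ∈ V →
            ∃ λ B → B ∈ concat (filter Q? P) ∷ filter (∁? Q?) P × x ∈ B
    cover x∈V with covers F x∈V
    ... | B , B∈P , x∈B with Q? B
    ... | yes q = _ , here refl , ∈-concat⁺′ x∈B (∈-filter⁺ Q? B∈P q)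
    ... | no ¬q = B , there (∈-filter⁺ (∁? Q?) B∈P ¬q) , x∈B

  merge-≡ : ∀ s t P →
            merge (s , t) P ≡ concat (filter (touches? s t) P) ∷ filter (∁? (touches? s t)) P
  merge-≡ s t P = cong (λ (hit , rest) → concat hit ∷ rest) (partition-defn (touches? s t) P)

  components : ∀ {V} → Unique V → (E : Edges) →
               (∀ {s t} → (s , t) ∈ E → s ∈ V × t ∈ V) →
               ∃ λ (f : Side → Side) → Labelling V E f × Fibres V f (foldr merge (map [_] V) E)
  components uniq [] _ =
    id , record { respects = λ () ; connected = λ { _ _ refl → ~-refl } } , singletons uniq
  components {V} uniq ((s , t) ∷ E) ends =
    let f , lab , fib = components uniq E (λ e∈E → ends (there e∈E))
        s∈V , t∈V     = ends (here refl)
    in identify (f s) (f t) ∘ f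
     , addEdge lab s∈V t∈V
     , subst (Fibres V _) (sym (merge-≡ s t (foldr merge (map [_] V) E))) (merge-fibres fib s∈V t∈V)

  record Enumerates {L : Set} (V : Word) (f : Side → L) (ℓs : List L) : Set where
    field
      unique   : Unique ℓs
      labels   : ∀ {s} → s ∈ V → f s ∈ ℓs
      attained : ∀ {ℓ} → ℓ ∈ ℓs → ∃ λ s → s ∈ V × f s ≡ ℓ

  open Enumerates

  -- Reading the label at the head of each block gives a list without repetitions and with the
  -- members of `ℓs`, hence a permutation of it. `Maybe` appears because `head` is partial.
  length-fibres : ∀ {L : Set} {V : Word} {f : Side → L} {P ℓs} →
                  Fibres V f P → Enumerates V f ℓs → length P ≡ length ℓs
  length-fibres {L} {V} {f} {P} {ℓs} F en = begin
    length P              ≡⟨ length-map label P ⟨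
    length (map label P)  ≡⟨ ↭-length (∼bag⇒↭ (unique∧set⇒bag uniq (Unique.map⁺ just-injective (unique en)) (mk⇔ to from))) ⟩
    length (map just ℓs)  ≡⟨ length-map just ℓs ⟩
    length ℓs             ∎
    where
    open ≡-Reasoning

    label : List Side → Maybe L
    label B = Maybe.map f (head B)

    label-≡ : ∀ {B s} → B ∈ P → s ∈ B → label B ≡ just (f s)
    label-≡ {_ ∷ _} B∈P s∈B = cong just (constant F B∈P (here refl) s∈B)

    uniq : Unique (map label P)
    uniq = AllPairs.map⁺ (distinct id (separate F))
      where
      distinct : ∀ {Q} → (∀ {B} → B ∈ Q → B ∈ P) → AllPairs (Separated f) Q →
                 AllPairs (λ B B′ → label B ≢ label B′) Q
      distinct sub []           = []
      distinct sub (all ∷ rest) = All.tabulate (λ B′∈ eq →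
          let s , s∈B  = nonempty F (sub (here refl))
              t , t∈B′ = nonempty F (sub (there B′∈))
          in All.lookup all B′∈ s∈B t∈B′ (just-injective
               (trans (sym (label-≡ (sub (here refl)) s∈B)) (trans eq (label-≡ (sub (there B′∈)) t∈B′)))))
        ∷ distinct (sub ∘ there) rest

    to : ∀ {ℓ} → ℓ ∈ map label P → ℓ ∈ map just ℓs
    to ℓ∈ with ∈-map⁻ label ℓ∈
    ... | B , B∈P , refl = let (s , s∈B) = nonempty F B∈P in
      subst (_∈ map just ℓs) (sym (label-≡ B∈P s∈B)) (∈-map⁺ just (labels en (within F B∈P s∈B)))

    from : ∀ {ℓ} → ℓ ∈ map just ℓs → ℓ ∈ map label P
    from ℓ∈ with ∈-map⁻ just ℓ∈
    ... | ℓ , ℓ∈ℓs , refl with attained en ℓ∈ℓs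
    ... | s , s∈V , refl = let (B , B∈P , s∈B) = covers F s∈V in
      subst (_∈ map label P) (label-≡ B∈P s∈B) (∈-map⁺ label B∈P)

  -- Two labellings of the same edges have the same fibres, so the number of blocks left by `merge`
  -- can be read from whichever labelling is convenient.
  length-components : ∀ {L : Set} {V : Word} {E} {f : Side → L} {ℓs} → Unique V →
                      (∀ {s t} → (s , t) ∈ E → s ∈ V × t ∈ V) →
                      Labelling V E f → Enumerates V f ℓs →
                      length (foldr merge (map [_] V) E) ≡ length ℓs
  length-components {V = V} {E} {f} uniq ends lab en =
    let g , lab′ , F = components uniq E ends
        to   : ∀ {s t} → s ∈ V → t ∈ V → g s ≡ g t → f s ≡ f t
        to   = λ s∈ t∈ eq → respects-~ lab (connected lab′ s∈ t∈ eq)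
        from : ∀ {s t} → s ∈ V → t ∈ V → f s ≡ f t → g s ≡ g t
        from = λ s∈ t∈ eq → respects-~ lab′ (connected lab s∈ t∈ eq)
    in length-fibres (record
      { nonempty = nonempty F
      ; constant = λ B∈ s∈ t∈ → to (within F B∈ s∈) (within F B∈ t∈) (constant F B∈ s∈ t∈)
      ; separate = separated-relabel
          (λ B∈ B′∈ s∈ t∈ → from (within F B∈ s∈) (within F B′∈ t∈)) (separate F)
      ; covers   = covers F
      ; within   = within F
      }) en


-- One step of the automaton: inserting a letter

module Routings where

  open Components
  open import Data.Bool using (Bool; true; false; if_then_else_)
  open import Data.Fin as Fin using (Fin; zero; suc)
  open import Data.Fin.Patterns using (0F; 1F; 2F; 3F)
  open import Data.List using ([]; _∷_)
  open import Data.List.Membership.Propositional using (_∈_)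
  open import Data.List.Relation.Unary.Any using (here; there)
  open import Data.Nat using (ℕ; zero; suc; _+_)
  open import Data.Product using (_×_; _,_; proj₁; proj₂)
  open import Data.Sum using (_⊎_; inj₁; inj₂; [_,_]′)
  open import Data.Vec as Vec using (Vec; []; _∷_; lookup)
  open import Function using (_∘_; id; case_of_)
  open import Relation.Binary.PropositionalEquality hiding ([_])
  open import Relation.Nullary using (yes; no; does; contradiction)

  -- The letters a[ 1 ], a[ 2 ], … are inserted in this order into the word a a⁻ b b⁻ c c⁻.
  -- A letter of R₁, R₂, R₃, R₄ then goes into gap 0, 1, 2, 3: before the letters of R₁
  -- inserted so far, before a⁻, after b, before c⁻.
  Gap : Set
  Gap = Fin 4

  -- The corners and the gluings of a word, except for the gluings at the four gaps:
  -- the gluing at gap i is the edge from left i to right i.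
  record Core : Set where
    constructor core
    field
      sides      : Word
      edges      : Edges
      left right : Gap → Side

  open Core

  -- Inserting a side splits the gluing at its gap in two: one half becomes permanent, the other
  -- faces the place of the next letter and is the new gap. In gaps 0 and 2 later letters go before
  -- the new side, which becomes the right end; in gaps 1 and 3 they go after it, and its inverse
  -- becomes the left end.
  add : Letter → Bool → Bool → Core → Core
  add x k t (core N C l r) = core
    (x ⁺ ∷ x ⁻ ∷ N)
    ((if k then (x ⁻ , r 0F) else (l 1F , x ⁺)) ∷ (if t then (x ⁺ , r 2F) else (l 3F , x ⁻)) ∷ C)
    (λ { 1F → if k then l 1F else x ⁻ ; 3F → if t then l 3F else x ⁺ ; i → l i })
    (λ { 0F → if k then x ⁺ else r 0F ; 2F → if t then x ⁻ else r 2F ; i → r i })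

  -- Without the gluings at the gaps, the four open vertices are paths: lookup π i is the
  -- gap at whose right end the path begins that ends at the left end of gap i.
  Routing : Set
  Routing = Vec Gap 4

  redirect : Gap → Gap → Gap → Gap
  redirect i p m = if does (m Fin.≟ i) then p else m

  exchange : Gap → Gap
  exchange 0F = 2F
  exchange 2F = 0F
  exchange i  = i

  -- If both sides become right ends, they extend the paths beginning at gaps 0 and 2 crosswise,
  -- since `x ⁺` is glued to the old right end of gap 2. If both inverses become left ends, the
  -- paths ending at gaps 1 and 3 are crossed. In the mixed cases one corner of `x` joins the path
  -- ending at the old left end to the one beginning at the old right end, and the other corner is
  -- by itself a fresh path between the two gaps.
  reroute : Bool → Bool → Routing → Routing
  reroute true  true  π = Vec.map exchange π
  reroute true  false (p ∷ q ∷ r ∷ s ∷ []) =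
    if does (s Fin.≟ 0F) then p ∷ q ∷ r ∷ s ∷ []
    else redirect 0F s p ∷ redirect 0F s q ∷ redirect 0F s r ∷ 0F ∷ []
  reroute false true  (p ∷ q ∷ r ∷ s ∷ []) =
    if does (q Fin.≟ 2F) then p ∷ q ∷ r ∷ s ∷ []
    else redirect 2F q p ∷ 2F ∷ redirect 2F q r ∷ redirect 2F q s ∷ []
  reroute false false (p ∷ q ∷ r ∷ s ∷ []) = p ∷ s ∷ r ∷ q ∷ []

  newLoops : Bool → Bool → Routing → ℕ
  newLoops true  false π = if does (lookup π 3F Fin.≟ 0F) then 1 else 0
  newLoops false true  π = if does (lookup π 1F Fin.≟ 2F) then 1 else 0
  newLoops _     _     _ = 0

  -- Without the gap gluings there are four open paths, named by the gap at whose right end they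
  -- begin, and `k` closed loops. Connectedness is recorded by linking each corner to the
  -- representative of its label, a form that is easily carried over when edges are added.
  record Realises (G : Core) (π : Routing) (k : ℕ) : Set where
    field
      label        : Side → Gap ⊎ Fin k
      loop         : Fin k → Side
      label-right  : ∀ i → label (right G i) ≡ inj₁ i
      label-left   : ∀ i → label (left G i) ≡ inj₁ (lookup π i)
      label-loop   : ∀ j → label (loop j) ≡ inj₂ j
      right∈       : ∀ i → right G i ∈ sides G
      left∈        : ∀ i → left G i ∈ sides G
      loop∈        : ∀ j → loop j ∈ sides G
      ends         : ∀ {s t} → (s , t) ∈ edges G → s ∈ sides G × t ∈ sides G
      respects     : ∀ {s t} → (s , t) ∈ edges G → label s ≡ label t

    representative : Gap ⊎ Fin k → Side
    representative = [ right G , loop ]′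

    field
      represented  : ∀ {s} → s ∈ sides G → edges G ⊢ s ~ representative (label s)

    left~right : ∀ i → edges G ⊢ left G i ~ right G (lookup π i)
    left~right i = subst (λ ℓ → edges G ⊢ left G i ~ representative ℓ) (label-left i) (represented (left∈ i))

  open Realises

  extend : ∀ {L : Set} → Letter → L → L → (Side → L) → Side → L
  extend x ℓ⁺ ℓ⁻ f (z , e) = if does (x ≟ᴸ z) then (if e then ℓ⁺ else ℓ⁻) else f (z , e)

  extend-⁺ : ∀ {L : Set} x (ℓ⁺ ℓ⁻ : L) f → extend x ℓ⁺ ℓ⁻ f (x ⁺) ≡ ℓ⁺
  extend-⁺ x ℓ⁺ ℓ⁻ f with x ≟ᴸ x
  ... | yes _  = refl
  ... | no x≢x = contradiction refl x≢x

  extend-⁻ : ∀ {L : Set} x (ℓ⁺ ℓ⁻ : L) f → extend x ℓ⁺ ℓ⁻ f (x ⁻) ≡ ℓ⁻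
  extend-⁻ x ℓ⁺ ℓ⁻ f with x ≟ᴸ x
  ... | yes _  = refl
  ... | no x≢x = contradiction refl x≢x

  extend-other : ∀ {L : Set} x (ℓ⁺ ℓ⁻ : L) f s → x ≢ proj₁ s → extend x ℓ⁺ ℓ⁻ f s ≡ f s
  extend-other x ℓ⁺ ℓ⁻ f (z , _) x≢z with x ≟ᴸ z
  ... | yes x≡z = contradiction x≡z x≢z
  ... | no _    = refl

  Fresh : Letter → Core → Set
  Fresh x G = ∀ {s} → s ∈ sides G → x ≢ proj₁ s

  module _ {G : Core} {π : Routing} {k : ℕ} (R : Realises G π k)
           {x : Letter} (fresh : Fresh x G) where

    private
      N = sides G
      C = edges G
      l = left G
      r = right G

      N′ : Word
      N′ = x ⁺ ∷ x ⁻ ∷ N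

      old : ∀ {s} → s ∈ N → s ∈ N′
      old s∈N = there (there s∈N)

      plus : x ⁺ ∈ N′
      plus = here refl

      minus : x ⁻ ∈ N′
      minus = there (here refl)

      oldʳ : ∀ i → r i ∈ N′
      oldʳ i = old (right∈ R i)

      oldˡ : ∀ i → l i ∈ N′
      oldˡ i = old (left∈ R i)

    module Grow {k′ : ℕ} (τ : Gap ⊎ Fin k → Gap ⊎ Fin k′) (ℓ⁺ ℓ⁻ : Gap ⊎ Fin k′) where

      f : Side → Gap ⊎ Fin k′
      f = extend x ℓ⁺ ℓ⁻ (τ ∘ label R)

      f-⁺ : f (x ⁺) ≡ ℓ⁺
      f-⁺ = extend-⁺ x ℓ⁺ ℓ⁻ (τ ∘ label R)

      f-⁻ : f (x ⁻) ≡ ℓ⁻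
      f-⁻ = extend-⁻ x ℓ⁺ ℓ⁻ (τ ∘ label R)

      f-old : ∀ {s} → s ∈ N → f s ≡ τ (label R s)
      f-old {s} s∈N = extend-other x ℓ⁺ ℓ⁻ (τ ∘ label R) s (fresh s∈N)

      f-right : ∀ i → f (r i) ≡ τ (inj₁ i)
      f-right i = trans (f-old (right∈ R i)) (cong τ (label-right R i))

      f-left : ∀ i → f (l i) ≡ τ (inj₁ (lookup π i))
      f-left i = trans (f-old (left∈ R i)) (cong τ (label-left R i))

      f-loop : ∀ j → f (loop R j) ≡ τ (inj₂ j)
      f-loop j = trans (f-old (loop∈ R j)) (cong τ (label-loop R j))

      -- An old corner is already connected to its old representative, so connectedness has to be
      -- checked for the old representatives and the two new corners. `τ` tells what becomes of the
      -- old labels.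
      grow : ∀ {π′ : Routing} {e₁ e₂ : Side × Side} {l′ r′ : Gap → Side} (loop′ : Fin k′ → Side) →
             (∀ i → f (r′ i) ≡ inj₁ i) → (∀ i → f (l′ i) ≡ inj₁ (lookup π′ i)) →
             (∀ j → f (loop′ j) ≡ inj₂ j) →
             (∀ i → r′ i ∈ N′) → (∀ i → l′ i ∈ N′) → (∀ j → loop′ j ∈ N′) →
             proj₁ e₁ ∈ N′ × proj₂ e₁ ∈ N′ → proj₁ e₂ ∈ N′ × proj₂ e₂ ∈ N′ →
             f (proj₁ e₁) ≡ f (proj₂ e₁) → f (proj₁ e₂) ≡ f (proj₂ e₂) →
             let E = e₁ ∷ e₂ ∷ C ; rep = [ r′ , loop′ ]′ in
             (∀ ℓ → E ⊢ representative R ℓ ~ rep (τ ℓ)) →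
             E ⊢ x ⁺ ~ rep ℓ⁺ → E ⊢ x ⁻ ~ rep ℓ⁻ →
             Realises (core N′ E l′ r′) π′ k′
      grow {e₁ = e₁} {e₂} {l′} {r′} loop′ fr fl flp r∈ l∈ lp∈ end₁ end₂ resp₁ resp₂ old~ plus~ minus~ = record
        { label       = f
        ; loop        = loop′
        ; label-right = fr
        ; label-left  = fl
        ; label-loop  = flp
        ; right∈      = r∈
        ; left∈       = l∈
        ; loop∈       = lp∈
        ; ends        = λ where
            (here refl)         → end₁
            (there (here refl)) → end₂
            (there (there e∈))  → old (ends R e∈ .proj₁) , old (ends R e∈ .proj₂)
        ; respects    = λ where
            (here refl)         → resp₁
            (there (here refl)) → resp₂
            (there (there e∈))  → trans (f-old (ends R e∈ .proj₁))
              (trans (cong τ (respects R e∈)) (sym (f-old (ends R e∈ .proj₂))))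
        ; represented = λ where
            (here refl)         → subst (λ ℓ → _ ⊢ _ ~ rep ℓ) (sym f-⁺) plus~
            (there (here refl)) → subst (λ ℓ → _ ⊢ _ ~ rep ℓ) (sym f-⁻) minus~
            (there (there s∈))  → subst (λ ℓ → _ ⊢ _ ~ rep ℓ) (sym (f-old s∈))
              (~-trans (~-mono (λ e∈ → there (there e∈)) (represented R s∈)) (old~ _))
        }
        where rep = [ r′ , loop′ ]′

    private
      first : ∀ {e e′ : Side × Side} → e ∈ e ∷ e′ ∷ C
      first = here refl

      second : ∀ {e e′ : Side × Side} → e′ ∈ e ∷ e′ ∷ C
      second = there (here refl)

      weaken : ∀ {e e′ : Side × Side} {s t} → C ⊢ s ~ t → e ∷ e′ ∷ C ⊢ s ~ t
      weaken = ~-mono (λ e∈ → there (there e∈))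

      onGaps : ∀ {k} → (Gap → Gap) → Gap ⊎ Fin k → Gap ⊎ Fin k
      onGaps θ (inj₁ i) = inj₁ (θ i)
      onGaps θ (inj₂ j) = inj₂ j

      -- A closed path becomes the loop number 0.
      close : Gap → Gap ⊎ Fin k → Gap ⊎ Fin (suc k)
      close i (inj₁ m) = if does (m Fin.≟ i) then inj₂ zero else inj₁ m
      close i (inj₂ j) = inj₂ (suc j)

      close-other : ∀ {i m} → m ≢ i → close i (inj₁ m) ≡ inj₁ m
      close-other {i} {m} m≢i with m Fin.≟ i
      ... | yes m≡i = contradiction m≡i m≢i
      ... | no _    = refl

      redirect-other : ∀ {i m} p → m ≢ i → redirect i p m ≡ m
      redirect-other {i} {m} p m≢i with m Fin.≟ i
      ... | yes m≡i = contradiction m≡i m≢i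
      ... | no _    = refl

    exchangeRight : Realises (add x true true G) (Vec.map exchange π) k
    exchangeRight = grow (loop R)
      (λ { 0F → f-⁺ ; 1F → f-right 1F ; 2F → f-⁻ ; 3F → f-right 3F })
      (λ i → trans (left-old i) (cong inj₁ (sym (lookup-map i exchange π))))
      f-loop
      (λ { 0F → plus ; 1F → oldʳ 1F ; 2F → minus ; 3F → oldʳ 3F })
      (λ { 0F → oldˡ 0F ; 1F → oldˡ 1F ; 2F → oldˡ 2F ; 3F → oldˡ 3F })
      (λ j → old (loop∈ R j))
      (minus , oldʳ 0F) (plus , oldʳ 2F)
      (trans f-⁻ (sym (f-right 0F))) (trans f-⁺ (sym (f-right 2F)))
      (λ { (inj₁ 0F) → ~-sym (~-edge first) ; (inj₁ 1F) → ~-refl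
         ; (inj₁ 2F) → ~-sym (~-edge second) ; (inj₁ 3F) → ~-refl ; (inj₂ _) → ~-refl })
      ~-refl ~-refl
      where
      open Grow (onGaps exchange) (inj₁ 0F) (inj₁ 2F)
      open import Data.Vec.Properties using (lookup-map)

      left-old : ∀ i → f (left (add x true true G) i) ≡ inj₁ (exchange (lookup π i))
      left-old 0F = f-left 0F
      left-old 1F = f-left 1F
      left-old 2F = f-left 2F
      left-old 3F = f-left 3F

    exchangeLeft : Realises (add x false false G) (reroute false false π) k
    exchangeLeft = grow (loop R)
      (λ { 0F → f-right 0F ; 1F → f-right 1F ; 2F → f-right 2F ; 3F → f-right 3F })
      left-new
      f-loop
      (λ { 0F → oldʳ 0F ; 1F → oldʳ 1F ; 2F → oldʳ 2F ; 3F → oldʳ 3F })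
      (λ { 0F → oldˡ 0F ; 1F → minus ; 2F → oldˡ 2F ; 3F → plus })
      (λ j → old (loop∈ R j))
      (oldˡ 1F , plus) (oldˡ 3F , minus)
      (trans (f-left 1F) (sym f-⁺)) (trans (f-left 3F) (sym f-⁻))
      (λ { (inj₁ 0F) → ~-refl ; (inj₁ 1F) → ~-refl
         ; (inj₁ 2F) → ~-refl ; (inj₁ 3F) → ~-refl ; (inj₂ _) → ~-refl })
      (~-trans (~-sym (~-edge first)) (~-trans (weaken (left~right R 1F)) (same (lookup π 1F))))
      (~-trans (~-sym (~-edge second)) (~-trans (weaken (left~right R 3F)) (same (lookup π 3F))))
      where
      open Grow id (inj₁ (lookup π 1F)) (inj₁ (lookup π 3F))

      same : ∀ i {E} → E ⊢ r i ~ right (add x false false G) i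
      same 0F = ~-refl
      same 1F = ~-refl
      same 2F = ~-refl
      same 3F = ~-refl

      split : ∀ (π : Routing) → reroute false false π ≡
              lookup π 0F ∷ lookup π 3F ∷ lookup π 2F ∷ lookup π 1F ∷ []
      split (_ ∷ _ ∷ _ ∷ _ ∷ []) = refl

      left-new : ∀ i → f (left (add x false false G) i) ≡ inj₁ (lookup (reroute false false π) i)
      left-new i rewrite split π = new i
        where
        new : ∀ i → f (left (add x false false G) i) ≡
                    inj₁ (lookup (lookup π 0F ∷ lookup π 3F ∷ lookup π 2F ∷ lookup π 1F ∷ []) i)
        new 0F = f-left 0F
        new 1F = f-⁻
        new 2F = f-left 2F
        new 3F = f-⁺

    -- If the path entering at the right end of gap 0 leaves at the left end of gap 3,
    -- then it becomes a loop; otherwise it is joined to the path leaving there.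
    cutRight : (∀ i j → lookup π i ≡ lookup π j → i ≡ j) →
               Realises (add x true false G) (reroute true false π) (newLoops true false π + k)
    cutRight = cut π refl
      where
      cut : ∀ π′ → π′ ≡ π → (∀ i j → lookup π i ≡ lookup π j → i ≡ j) →
            Realises (add x true false G) (reroute true false π′) (newLoops true false π′ + k)
      cut (p ∷ q ∷ t ∷ u ∷ []) refl inj with u Fin.≟ 0F
      ... | yes refl = grow (λ { zero → r 0F ; (suc j) → loop R j })
        (λ { 0F → f-⁺ ; 1F → f-right 1F ; 2F → f-right 2F ; 3F → f-right 3F })
        -- By injectivity no other gap ends the path that closes up, so these labels survive
        -- `close`.
        (λ { 0F → trans (f-left 0F) (close-other (λ eq → case inj 0F 3F eq of λ ()))
           ; 1F → trans (f-left 1F) (close-other (λ eq → case inj 1F 3F eq of λ ()))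
           ; 2F → trans (f-left 2F) (close-other (λ eq → case inj 2F 3F eq of λ ()))
           ; 3F → f-⁺ })
        (λ { zero → f-right 0F ; (suc j) → f-loop j })
        (λ { 0F → plus ; 1F → oldʳ 1F ; 2F → oldʳ 2F ; 3F → oldʳ 3F })
        (λ { 0F → oldˡ 0F ; 1F → oldˡ 1F ; 2F → oldˡ 2F ; 3F → plus })
        (λ { zero → oldʳ 0F ; (suc j) → old (loop∈ R j) })
        (minus , oldʳ 0F) (oldˡ 3F , minus)
        (trans f-⁻ (sym (f-right 0F))) (trans (f-left 3F) (sym f-⁻))
        (λ { (inj₁ 0F) → ~-refl ; (inj₁ 1F) → ~-refl ; (inj₁ 2F) → ~-refl
           ; (inj₁ 3F) → ~-refl ; (inj₂ _) → ~-refl })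
        ~-refl (~-edge first)
        where open Grow (close 0F) (inj₁ 0F) (inj₂ zero)
      ... | no u≢0 = grow (loop R)
        (λ { 0F → f-⁺ ; 1F → f-right 1F ; 2F → f-right 2F ; 3F → f-right 3F })
        (λ { 0F → f-left 0F ; 1F → f-left 1F ; 2F → f-left 2F ; 3F → f-⁺ })
        f-loop
        (λ { 0F → plus ; 1F → oldʳ 1F ; 2F → oldʳ 2F ; 3F → oldʳ 3F })
        (λ { 0F → oldˡ 0F ; 1F → oldˡ 1F ; 2F → oldˡ 2F ; 3F → plus })
        (λ j → old (loop∈ R j))
        (minus , oldʳ 0F) (oldˡ 3F , minus)
        (trans f-⁻ (sym (f-right 0F)))
        (trans (f-left 3F) (trans (cong inj₁ (redirect-other u u≢0)) (sym f-⁻)))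
        (λ { (inj₁ 0F) → ~-trans (~-sym (~-edge first)) joined ; (inj₁ 1F) → ~-refl
           ; (inj₁ 2F) → ~-refl ; (inj₁ 3F) → ~-refl ; (inj₂ _) → ~-refl })
        ~-refl joined
        where
        open Grow (onGaps (redirect 0F u)) (inj₁ 0F) (inj₁ u)

        same : ∀ i {E} → i ≢ 0F → E ⊢ r i ~ right (add x true false G) i
        same 0F i≢0 = contradiction refl i≢0
        same 1F _   = ~-refl
        same 2F _   = ~-refl
        same 3F _   = ~-refl

        joined : edges (add x true false G) ⊢ x ⁻ ~ right (add x true false G) u
        joined = ~-trans (~-sym (~-edge second)) (~-trans (weaken (left~right R 3F)) (same u u≢0))

    -- The mirror image of the previous case: the path ending at gap 1 meets the path beginning at
    -- gap 2 and closes up if they are the same.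
    cutLeft : (∀ i j → lookup π i ≡ lookup π j → i ≡ j) →
              Realises (add x false true G) (reroute false true π) (newLoops false true π + k)
    cutLeft = cut π refl
      where
      cut : ∀ π′ → π′ ≡ π → (∀ i j → lookup π i ≡ lookup π j → i ≡ j) →
            Realises (add x false true G) (reroute false true π′) (newLoops false true π′ + k)
      cut (p ∷ q ∷ t ∷ u ∷ []) refl inj with q Fin.≟ 2F
      ... | yes refl = grow (λ { zero → r 2F ; (suc j) → loop R j })
        (λ { 0F → f-right 0F ; 1F → f-right 1F ; 2F → f-⁻ ; 3F → f-right 3F })
        (λ { 0F → trans (f-left 0F) (close-other (λ eq → case inj 0F 1F eq of λ ()))
           ; 1F → f-⁻
           ; 2F → trans (f-left 2F) (close-other (λ eq → case inj 2F 1F eq of λ ()))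
           ; 3F → trans (f-left 3F) (close-other (λ eq → case inj 3F 1F eq of λ ())) })
        (λ { zero → f-right 2F ; (suc j) → f-loop j })
        (λ { 0F → oldʳ 0F ; 1F → oldʳ 1F ; 2F → minus ; 3F → oldʳ 3F })
        (λ { 0F → oldˡ 0F ; 1F → minus ; 2F → oldˡ 2F ; 3F → oldˡ 3F })
        (λ { zero → oldʳ 2F ; (suc j) → old (loop∈ R j) })
        (oldˡ 1F , plus) (plus , oldʳ 2F)
        (trans (f-left 1F) (sym f-⁺)) (trans f-⁺ (sym (f-right 2F)))
        (λ { (inj₁ 0F) → ~-refl ; (inj₁ 1F) → ~-refl ; (inj₁ 2F) → ~-refl
           ; (inj₁ 3F) → ~-refl ; (inj₂ _) → ~-refl })
        (~-edge second) ~-refl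
        where open Grow (close 2F) (inj₂ zero) (inj₁ 2F)
      ... | no q≢2 = grow (loop R)
        (λ { 0F → f-right 0F ; 1F → f-right 1F ; 2F → f-⁻ ; 3F → f-right 3F })
        (λ { 0F → f-left 0F ; 1F → f-⁻ ; 2F → f-left 2F ; 3F → f-left 3F })
        f-loop
        (λ { 0F → oldʳ 0F ; 1F → oldʳ 1F ; 2F → minus ; 3F → oldʳ 3F })
        (λ { 0F → oldˡ 0F ; 1F → minus ; 2F → oldˡ 2F ; 3F → oldˡ 3F })
        (λ j → old (loop∈ R j))
        (oldˡ 1F , plus) (plus , oldʳ 2F)
        (trans (f-left 1F) (trans (cong inj₁ (redirect-other q q≢2)) (sym f-⁺)))
        (trans f-⁺ (sym (f-right 2F)))
        (λ { (inj₁ 0F) → ~-refl ; (inj₁ 1F) → ~-refl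
           ; (inj₁ 2F) → ~-trans (~-sym (~-edge second)) joined ; (inj₁ 3F) → ~-refl ; (inj₂ _) → ~-refl })
        joined ~-refl
        where
        open Grow (onGaps (redirect 2F q)) (inj₁ q) (inj₁ 2F)

        same : ∀ i {E} → i ≢ 2F → E ⊢ r i ~ right (add x false true G) i
        same 0F _   = ~-refl
        same 1F _   = ~-refl
        same 2F i≢2 = contradiction refl i≢2
        same 3F _   = ~-refl

        joined : edges (add x false true G) ⊢ x ⁺ ~ right (add x false true G) q
        joined = ~-trans (~-sym (~-edge first)) (~-trans (weaken (left~right R 1F)) (same q q≢2))

    realises-add : (∀ i j → lookup π i ≡ lookup π j → i ≡ j) → ∀ kᵇ tᵇ →
                   Realises (add x kᵇ tᵇ G) (reroute kᵇ tᵇ π) (newLoops kᵇ tᵇ π + k)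
    realises-add inj true  true  = exchangeRight
    realises-add inj true  false = cutRight inj
    realises-add inj false true  = cutLeft inj
    realises-add inj false false = exchangeLeft


-- The ladder word as a sequence of insertions

module LadderGraph where

  open Components
  open Routings
  open import Data.Bool using (true; false)
  open import Data.Fin as Fin using (Fin; suc; toℕ)
  open import Data.Fin.Patterns using (0F; 1F; 2F; 3F)
  open import Data.Fin.Subset using (Subset; ∁)
  open import Data.Fin.Subset.Properties using (_∈?_)
  open import Data.List using (List; []; _∷_; [_]; _++_; map; filter; reverse; allFin; tabulate; zip)
  open import Data.List.Membership.Propositional using (_∈_)
  open import Data.List.Properties using (map-++; unfold-reverse; map-tabulate; ++-assoc; map-∘; map-cong)
  open import Data.List.Relation.Binary.Permutation.Propositional using (_↭_; ↭-refl; ↭-trans; ↭-prep; module PermutationReasoning)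
  open import Data.List.Relation.Binary.Permutation.Propositional.Properties using (++⁺; ++⁺ˡ; shift; shifts; ++-comm; ++-identityʳ)
  open import Data.Nat using (ℕ; suc; _+_)
  open import Data.Nat.Properties using (+-suc; +-comm)
  open import Data.Product using (_,_)
  open import Data.Vec as Vec using ([]; _∷_)
  open import Function using (_∘_; id)
  open import Relation.Binary.PropositionalEquality hiding ([_])
  open import Relation.Nullary using (yes; no)

  open Core

  -- The gluings read along `w` when the side before it has inverse `u` and the side after it is
  -- `v`. Unlike a cyclic word, such a stretch can be cut anywhere.
  chain : Side → Word → Side → Edges
  chain u []      v = (u , v) ∷ []
  chain u (s ∷ w) v = (u , s) ∷ chain (inverse s) w v

  chain-++ : ∀ u w s w′ v → chain u (w ++ s ∷ w′) v ≡ chain u w s ++ chain (inverse s) w′ v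
  chain-++ u []      s w′ v = refl
  chain-++ u (t ∷ w) s w′ v = cong ((u , t) ∷_) (chain-++ (inverse t) w s w′ v)

  cornerGluings-∷ : ∀ s w → cornerGluings (s ∷ w) ≡ chain (inverse s) w s
  cornerGluings-∷ s w = go s w
    where
    go : ∀ u w → map (λ (x , y) → inverse x , y) (zip (u ∷ w) (w ++ [ s ])) ≡ chain (inverse u) w s
    go u []      = refl
    go u (t ∷ w) = cong ((inverse u , t) ∷_) (go t w)

  -- The word is cut at its last side `z` and at an inner side `s`. The stretch in front of `s`
  -- follows `z` cyclically, so its chain starts at `inverse z`, even if `w` is empty.
  cornerGluings-cyclic : ∀ w s w′ z → cornerGluings (w ++ s ∷ w′ ++ [ z ]) ↭
                         chain (inverse z) w s ++ chain (inverse s) w′ z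
  cornerGluings-cyclic [] s w′ z = begin
    cornerGluings (s ∷ w′ ++ [ z ])                      ≡⟨ cornerGluings-∷ s (w′ ++ [ z ]) ⟩
    chain (inverse s) (w′ ++ [ z ]) s                    ≡⟨ chain-++ (inverse s) w′ z [] s ⟩
    chain (inverse s) w′ z ++ [ inverse z , s ]          ↭⟨ ++-comm (chain (inverse s) w′ z) _ ⟩
    (inverse z , s) ∷ chain (inverse s) w′ z             ∎
    where open PermutationReasoning
  cornerGluings-cyclic (u ∷ w) s w′ z = begin
    cornerGluings (u ∷ w ++ s ∷ w′ ++ [ z ])             ≡⟨ cornerGluings-∷ u (w ++ s ∷ w′ ++ [ z ]) ⟩
    chain (inverse u) (w ++ s ∷ w′ ++ [ z ]) u           ≡⟨ chain-++ (inverse u) w s (w′ ++ [ z ]) u ⟩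
    chain (inverse u) w s ++ chain (inverse s) (w′ ++ [ z ]) u
      ≡⟨ cong (chain (inverse u) w s ++_) (chain-++ (inverse s) w′ z [] u) ⟩
    chain (inverse u) w s ++ chain (inverse s) w′ z ++ [ inverse z , u ]
      ≡⟨ ++-assoc (chain (inverse u) w s) (chain (inverse s) w′ z) _ ⟨
    (chain (inverse u) w s ++ chain (inverse s) w′ z) ++ [ inverse z , u ]
      ↭⟨ ++-comm (chain (inverse u) w s ++ chain (inverse s) w′ z) _ ⟩
    (inverse z , u) ∷ chain (inverse u) w s ++ chain (inverse s) w′ z ∎
    where open PermutationReasoning

  -- The letters a[ m + k ] for k ∈ K.
  rungs : ∀ {n} → ℕ → Subset n → List Letter
  rungs m []          = []
  rungs m (true  ∷ K) = a[ suc m ] ∷ rungs (suc m) K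
  rungs m (false ∷ K) = rungs (suc m) K

  filter-suc : ∀ {n} e (K : Subset n) ks →
               filter (_∈? (e ∷ K)) (map suc ks) ≡ map suc (filter (_∈? K) ks)
  filter-suc e K []       = refl
  filter-suc e K (k ∷ ks) with k ∈? K
  ... | yes _ = cong (suc k ∷_) (filter-suc e K ks)
  ... | no _  = filter-suc e K ks

  rungs-filter : ∀ {n} m (K : Subset n) →
                 map (λ k → a[ m + suc (toℕ k) ]) (filter (_∈? K) (allFin n)) ≡ rungs m K
  rungs-filter-suc : ∀ {n} m e (K : Subset n) →
    map (λ k → a[ m + suc (toℕ k) ]) (filter (_∈? (e ∷ K)) (tabulate suc)) ≡ rungs (suc m) K

  rungs-filter m []          = refl
  rungs-filter m (true  ∷ K) = cong₂ _∷_ (cong a[_] (+-comm m 1)) (rungs-filter-suc m true K)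
  rungs-filter m (false ∷ K) = rungs-filter-suc m false K

  rungs-filter-suc {n} m e K = begin
    map letter (filter (_∈? (e ∷ K)) (tabulate suc))
      ≡⟨ cong (map letter ∘ filter (_∈? (e ∷ K))) (map-tabulate id suc) ⟨
    map letter (filter (_∈? (e ∷ K)) (map suc (allFin n)))
      ≡⟨ cong (map letter) (filter-suc e K (allFin n)) ⟩
    map letter (map suc (filter (_∈? K) (allFin n)))
      ≡⟨ map-∘ (filter (_∈? K) (allFin n)) ⟨
    map (letter ∘ suc) (filter (_∈? K) (allFin n))
      ≡⟨ map-cong (λ k → cong a[_] (+-suc m (suc (toℕ k)))) _ ⟩
    map (λ k → a[ suc m + suc (toℕ k) ]) (filter (_∈? K) (allFin n))
      ≡⟨ rungs-filter (suc m) K ⟩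
    rungs (suc m) K ∎
    where
    open ≡-Reasoning

    letter : Fin (suc n) → Letter
    letter k = a[ m + suc (toℕ k) ]

  halfSides : ∀ {n} → (Letter → Side) → ℕ → Subset n → Word
  halfSides f m K = map f (reverse (rungs m K)) ++ map f (rungs m (∁ K))

  halfEdges : ∀ {n} → (Letter → Side) → ℕ → Subset n → (l r l′ r′ : Side) → Edges
  halfEdges f m K l r l′ r′ =
    chain l (map f (reverse (rungs m K))) r ++ chain l′ (map f (rungs m (∁ K))) r′

  map-reverse-∷ : ∀ {A B : Set} (f : A → B) x xs → map f (reverse (x ∷ xs)) ≡ map f (reverse xs) ++ [ f x ]
  map-reverse-∷ f x xs = trans (cong (map f) (unfold-reverse x xs)) (map-++ f (reverse xs) [ x ])

  halfSides-∷ : ∀ {n} f m e (K : Subset n) → halfSides f m (e ∷ K) ↭ f a[ suc m ] ∷ halfSides f (suc m) K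
  halfSides-∷ f m true  K = begin
    map f (reverse (a[ suc m ] ∷ rungs (suc m) K)) ++ v  ≡⟨ cong (_++ v) (map-reverse-∷ f _ (rungs (suc m) K)) ⟩
    (w ++ [ f a[ suc m ] ]) ++ v                         ≡⟨ ++-assoc w _ v ⟩
    w ++ f a[ suc m ] ∷ v                                ↭⟨ shift (f a[ suc m ]) w v ⟩
    f a[ suc m ] ∷ w ++ v                                ∎
    where
    open PermutationReasoning
    w = map f (reverse (rungs (suc m) K))
    v = map f (rungs (suc m) (∁ K))
  halfSides-∷ f m false K = shift (f a[ suc m ]) (map f (reverse (rungs (suc m) K))) _

  -- In the decreasing product the letter of least index stands last, next to `r`. Its gluing to `r`
  -- is final, and the remaining letters see it as their right end, exactly as in `add`.
  halfEdges-in : ∀ {n} f m (K : Subset n) l r l′ r′ → let y = f a[ suc m ] in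
                 halfEdges f m (true ∷ K) l r l′ r′ ↭ (inverse y , r) ∷ halfEdges f (suc m) K l y l′ r′
  halfEdges-in f m K l r l′ r′ = begin
    chain l (map f (reverse (a[ suc m ] ∷ rungs (suc m) K))) r ++ v
      ≡⟨ cong (λ w′ → chain l w′ r ++ v) (map-reverse-∷ f _ (rungs (suc m) K)) ⟩
    chain l (w ++ [ y ]) r ++ v                       ≡⟨ cong (_++ v) (chain-++ l w y [] r) ⟩
    (chain l w y ++ [ inverse y , r ]) ++ v           ≡⟨ ++-assoc (chain l w y) _ v ⟩
    chain l w y ++ (inverse y , r) ∷ v                ↭⟨ shift (inverse y , r) (chain l w y) v ⟩
    (inverse y , r) ∷ chain l w y ++ v                ∎
    where
    open PermutationReasoning
    y = f a[ suc m ]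
    w = map f (reverse (rungs (suc m) K))
    v = chain l′ (map f (rungs (suc m) (∁ K))) r′

  halfEdges-out : ∀ {n} f m (K : Subset n) l r l′ r′ → let y = f a[ suc m ] in
                  halfEdges f m (false ∷ K) l r l′ r′ ↭ (l′ , y) ∷ halfEdges f (suc m) K l r (inverse y) r′
  halfEdges-out f m K l r l′ r′ =
    shift (l′ , f a[ suc m ]) (chain l (map f (reverse (rungs (suc m) K))) r) _

  module _ {n : ℕ} (m : ℕ) (K T : Subset n) (G : Core) where

    allSides : Word
    allSides = sides G ++ halfSides _⁺ m K ++ halfSides _⁻ m T

    allEdges : Edges
    allEdges = edges G ++ halfEdges _⁺ m K (left G 0F) (right G 0F) (left G 1F) (right G 1F)
                       ++ halfEdges _⁻ m T (left G 2F) (right G 2F) (left G 3F) (right G 3F)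

  pull-out : ∀ {A : Set} {x y : A} xs {ys ys′ zs zs′} → ys ↭ x ∷ ys′ → zs ↭ y ∷ zs′ →
             xs ++ ys ++ zs ↭ x ∷ y ∷ xs ++ ys′ ++ zs′
  pull-out {x = x} {y} xs {ys} {ys′} {zs} {zs′} p q = begin
    xs ++ ys ++ zs              ↭⟨ ++⁺ˡ xs (++⁺ p q) ⟩
    xs ++ x ∷ ys′ ++ y ∷ zs′    ↭⟨ shift x xs _ ⟩
    x ∷ xs ++ ys′ ++ y ∷ zs′    ↭⟨ ↭-prep x (++⁺ˡ xs (shift y ys′ zs′)) ⟩
    x ∷ xs ++ y ∷ ys′ ++ zs′    ↭⟨ ↭-prep x (shift y xs _) ⟩
    x ∷ y ∷ xs ++ ys′ ++ zs′    ∎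
    where open PermutationReasoning

  allSides-∷ : ∀ {n} m e (K : Subset n) d T G →
               allSides m (e ∷ K) (d ∷ T) G ↭ allSides (suc m) K T (add a[ suc m ] e d G)
  allSides-∷ m e K d T G = pull-out (sides G) (halfSides-∷ _⁺ m e K) (halfSides-∷ _⁻ m d T)

  allEdges-∷ : ∀ {n} m e (K : Subset n) d T G →
               allEdges m (e ∷ K) (d ∷ T) G ↭ allEdges (suc m) K T (add a[ suc m ] e d G)
  allEdges-∷ m true  K true  T G = pull-out (edges G) (halfEdges-in  _⁺ m K _ _ _ _) (halfEdges-in  _⁻ m T _ _ _ _)
  allEdges-∷ m true  K false T G = pull-out (edges G) (halfEdges-in  _⁺ m K _ _ _ _) (halfEdges-out _⁻ m T _ _ _ _)
  allEdges-∷ m false K true  T G = pull-out (edges G) (halfEdges-out _⁺ m K _ _ _ _) (halfEdges-in  _⁻ m T _ _ _ _)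
  allEdges-∷ m false K false T G = pull-out (edges G) (halfEdges-out _⁺ m K _ _ _ _) (halfEdges-out _⁻ m T _ _ _ _)

  complete : ∀ {n} → ℕ → Subset n → Subset n → Core → Core
  complete m []      []      G = G
  complete m (e ∷ K) (d ∷ T) G = complete (suc m) K T (add a[ suc m ] e d G)

  gapEdges : Core → Edges
  gapEdges G = (left G 0F , right G 0F) ∷ (left G 1F , right G 1F) ∷
               (left G 2F , right G 2F) ∷ (left G 3F , right G 3F) ∷ []

  complete-sides : ∀ {n} m (K T : Subset n) G → allSides m K T G ↭ sides (complete m K T G)
  complete-sides m []      []      G = ++-identityʳ (sides G)
  complete-sides m (e ∷ K) (d ∷ T) G = ↭-trans (allSides-∷ m e K d T G) (complete-sides (suc m) K T _)

  complete-edges : ∀ {n} m (K T : Subset n) G →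
                   allEdges m K T G ↭ edges (complete m K T G) ++ gapEdges (complete m K T G)
  complete-edges m []      []      G = ↭-refl
  complete-edges m (e ∷ K) (d ∷ T) G = ↭-trans (allEdges-∷ m e K d T G) (complete-edges (suc m) K T _)

  -- The gluings of the cyclic word a a⁻ b b⁻ c c⁻. Those read after a⁻ and after b⁻ are permanent;
  -- the other four are the gaps, where the four products are still empty.
  initial : Core
  initial = core
    (a ⁺ ∷ a ⁻ ∷ b ⁺ ∷ b ⁻ ∷ c ⁺ ∷ c ⁻ ∷ [])
    ((a ⁺ , b ⁺) ∷ (b ⁺ , c ⁺) ∷ [])
    (λ { 0F → c ⁺ ; 1F → a ⁻ ; 2F → b ⁻ ; 3F → c ⁻ })
    (λ { 0F → a ⁺ ; 1F → a ⁻ ; 2F → b ⁻ ; 3F → c ⁻ })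

  module _ {n : ℕ} (K T : Subset n) where

    private
      w₁ = map _⁺ (reverse (rungs 0 K))
      w₂ = map _⁺ (rungs 0 (∁ K))
      w₃ = map _⁻ (reverse (rungs 0 T))
      w₄ = map _⁻ (rungs 0 (∁ T))

    ladder-≡ : ladder K T ≡ w₁ ++ a ⁺ ∷ w₂ ++ a ⁻ ∷ b ⁺ ∷ w₃ ++ b ⁻ ∷ c ⁺ ∷ w₄ ++ c ⁻ ∷ []
    ladder-≡ = cong₂ (λ (v₁ , v₂) (v₃ , v₄) → v₁ ++ a ⁺ ∷ v₂ ++ a ⁻ ∷ b ⁺ ∷ v₃ ++ b ⁻ ∷ c ⁺ ∷ v₄ ++ c ⁻ ∷ [])
      (cong₂ _,_ (cong (map _⁺ ∘ reverse) (rungs-filter 0 K)) (cong (map _⁺) (rungs-filter 0 (∁ K))))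
      (cong₂ _,_ (cong (map _⁻ ∘ reverse) (rungs-filter 0 T)) (cong (map _⁻) (rungs-filter 0 (∁ T))))

    ladder-sides : ladder K T ↭ allSides 0 K T initial
    ladder-sides = begin
      ladder K T  ≡⟨ ladder-≡ ⟩
      w₁ ++ a ⁺ ∷ w₂ ++ a ⁻ ∷ b ⁺ ∷ w₃ ++ b ⁻ ∷ c ⁺ ∷ w₄ ++ c ⁻ ∷ []
        ↭⟨ ++⁺ˡ w₁ (↭-prep (a ⁺) (++⁺ˡ w₂ (↭-prep (a ⁻) (↭-prep (b ⁺) (++⁺ˡ w₃ (↭-prep (b ⁻) (↭-prep (c ⁺)
             (++-comm w₄ (c ⁻ ∷ []))))))))) ⟩
      w₁ ++ a ⁺ ∷ w₂ ++ (a ⁻ ∷ b ⁺ ∷ []) ++ w₃ ++ (b ⁻ ∷ c ⁺ ∷ c ⁻ ∷ []) ++ w₄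
        ↭⟨ ++⁺ˡ w₁ (↭-prep (a ⁺) (shifts w₂ (a ⁻ ∷ b ⁺ ∷ []))) ⟩
      w₁ ++ (a ⁺ ∷ a ⁻ ∷ b ⁺ ∷ []) ++ w₂ ++ w₃ ++ (b ⁻ ∷ c ⁺ ∷ c ⁻ ∷ []) ++ w₄
        ↭⟨ shifts w₁ (a ⁺ ∷ a ⁻ ∷ b ⁺ ∷ []) ⟩
      (a ⁺ ∷ a ⁻ ∷ b ⁺ ∷ []) ++ w₁ ++ w₂ ++ w₃ ++ (b ⁻ ∷ c ⁺ ∷ c ⁻ ∷ []) ++ w₄
        ↭⟨ ++⁺ˡ (a ⁺ ∷ a ⁻ ∷ b ⁺ ∷ []) (++⁺ˡ w₁ (++⁺ˡ w₂ (shifts w₃ (b ⁻ ∷ c ⁺ ∷ c ⁻ ∷ [])))) ⟩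
      (a ⁺ ∷ a ⁻ ∷ b ⁺ ∷ []) ++ w₁ ++ w₂ ++ (b ⁻ ∷ c ⁺ ∷ c ⁻ ∷ []) ++ w₃ ++ w₄
        ↭⟨ ++⁺ˡ (a ⁺ ∷ a ⁻ ∷ b ⁺ ∷ []) (++⁺ˡ w₁ (shifts w₂ (b ⁻ ∷ c ⁺ ∷ c ⁻ ∷ []))) ⟩
      (a ⁺ ∷ a ⁻ ∷ b ⁺ ∷ []) ++ w₁ ++ (b ⁻ ∷ c ⁺ ∷ c ⁻ ∷ []) ++ w₂ ++ w₃ ++ w₄
        ↭⟨ ++⁺ˡ (a ⁺ ∷ a ⁻ ∷ b ⁺ ∷ []) (shifts w₁ (b ⁻ ∷ c ⁺ ∷ c ⁻ ∷ [])) ⟩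
      sides initial ++ w₁ ++ w₂ ++ w₃ ++ w₄
        ≡⟨ cong (sides initial ++_) (++-assoc w₁ w₂ (w₃ ++ w₄)) ⟨
      sides initial ++ (w₁ ++ w₂) ++ w₃ ++ w₄ ∎
      where open PermutationReasoning

    ladder-edges : cornerGluings (ladder K T) ↭ allEdges 0 K T initial
    ladder-edges = begin
      cornerGluings (ladder K T)  ≡⟨ cong cornerGluings (trans ladder-≡ assoc) ⟩
      cornerGluings (w₁ ++ a ⁺ ∷ (w₂ ++ a ⁻ ∷ b ⁺ ∷ w₃ ++ b ⁻ ∷ c ⁺ ∷ w₄) ++ [ c ⁻ ])
        ↭⟨ cornerGluings-cyclic w₁ (a ⁺) _ (c ⁻) ⟩
      e₁ ++ chain (a ⁻) (w₂ ++ a ⁻ ∷ b ⁺ ∷ w₃ ++ b ⁻ ∷ c ⁺ ∷ w₄) (c ⁻)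
        ≡⟨ cong (e₁ ++_) (chain-++ (a ⁻) w₂ (a ⁻) _ (c ⁻)) ⟩
      e₁ ++ e₂ ++ (a ⁺ , b ⁺) ∷ chain (b ⁻) (w₃ ++ b ⁻ ∷ c ⁺ ∷ w₄) (c ⁻)
        ≡⟨ cong (λ e → e₁ ++ e₂ ++ (a ⁺ , b ⁺) ∷ e) (chain-++ (b ⁻) w₃ (b ⁻) _ (c ⁻)) ⟩
      e₁ ++ e₂ ++ (a ⁺ , b ⁺) ∷ e₃ ++ (b ⁺ , c ⁺) ∷ e₄
        ↭⟨ ++⁺ˡ e₁ (++⁺ˡ e₂ (↭-prep (a ⁺ , b ⁺) (shift (b ⁺ , c ⁺) e₃ e₄))) ⟩
      e₁ ++ e₂ ++ edges initial ++ e₃ ++ e₄      ↭⟨ ++⁺ˡ e₁ (shifts e₂ (edges initial)) ⟩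
      e₁ ++ edges initial ++ e₂ ++ e₃ ++ e₄      ↭⟨ shifts e₁ (edges initial) ⟩
      edges initial ++ e₁ ++ e₂ ++ e₃ ++ e₄      ≡⟨ cong (edges initial ++_) (++-assoc e₁ e₂ (e₃ ++ e₄)) ⟨
      edges initial ++ (e₁ ++ e₂) ++ e₃ ++ e₄    ∎
      where
      open PermutationReasoning
      e₁ = chain (c ⁺) w₁ (a ⁺)
      e₂ = chain (a ⁻) w₂ (a ⁻)
      e₃ = chain (b ⁻) w₃ (b ⁻)
      e₄ = chain (c ⁻) w₄ (c ⁻)

      assoc : w₁ ++ a ⁺ ∷ w₂ ++ a ⁻ ∷ b ⁺ ∷ w₃ ++ b ⁻ ∷ c ⁺ ∷ w₄ ++ c ⁻ ∷ [] ≡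
              w₁ ++ a ⁺ ∷ (w₂ ++ a ⁻ ∷ b ⁺ ∷ w₃ ++ b ⁻ ∷ c ⁺ ∷ w₄) ++ [ c ⁻ ]
      assoc = cong (λ v → w₁ ++ a ⁺ ∷ v) (sym (trans (++-assoc w₂ _ _)
        (cong (λ v → w₂ ++ a ⁻ ∷ b ⁺ ∷ v) (++-assoc w₃ _ _))))


-- Vertices as cycles of the final routing and loops closed on the way

module Vertices where

  open Components
  open Routings
  open LadderGraph
  open import Data.Bool using (true; false; if_then_else_)
  open import Data.Fin as Fin using (Fin; suc)
  open import Data.Fin.Patterns using (0F; 1F; 2F; 3F)
  open import Data.Fin.Properties using (all?)
  open import Data.Fin.Subset using (Subset)
  open import Data.List using (List; []; _∷_; [_]; _++_; map; filter; foldr; length; allFin; concatMap)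
  open import Data.List.Membership.Propositional using (_∈_)
  open import Data.List.Membership.Propositional.Properties using (∈-map⁺; ∈-map⁻; ∈-++⁺ˡ; ∈-++⁺ʳ; ∈-++⁻; ∈-filter⁺; ∈-filter⁻; ∈-allFin)
  import Data.List.Membership.DecPropositional as DecMembership
  open import Data.List.Properties using (length-map; length-++; length-tabulate)
  open import Data.List.Relation.Binary.Permutation.Propositional using (_↭_; ↭-sym; ↭-trans)
  open import Data.List.Relation.Binary.Permutation.Propositional.Properties using (∈-resp-↭)
  open import Data.List.Relation.Unary.All as All using (All; []; _∷_)
  open import Data.List.Relation.Unary.AllPairs using ([]; _∷_)
  open import Data.List.Relation.Unary.Any using (here; there)
  open import Data.List.Relation.Unary.Unique.Propositional using (Unique)
  import Data.List.Relation.Unary.Unique.Propositional.Properties as Unique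
  import Data.List.Relation.Binary.Permutation.Setoid.Properties as PermutationSetoid
  open import Data.List.Relation.Binary.Permutation.Propositional using (↭⇒↭ₛ)
  open import Data.Nat using (ℕ; suc; _+_; _≤_; z≤n)
  open import Data.Nat.Properties using (≤-refl; m≤n⇒m≤1+n; 1+n≰n; +-assoc; +-identityʳ)
  open import Data.Product using (_×_; _,_; ∃; proj₁; proj₂)
  open import Data.Sum as Sum using (_⊎_; inj₁; inj₂)
  open import Data.Sum.Properties using (inj₁-injective; inj₂-injective)
  open import Data.Vec as Vec using (Vec; []; _∷_; lookup)
  import Data.Vec.Properties as Vec
  open import Function using (_∘_; id)
  open import Relation.Binary.PropositionalEquality hiding ([_])
  open import Relation.Nullary using (Dec; does)
  open import Relation.Nullary.Decidable using (from-yes; map′; _×-dec_; _→-dec_)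

  open Core
  open Realises
  open Labelling
  open Enumerates

  orbit : Routing → Gap → List Gap
  orbit π i = i ∷ lookup π i ∷ lookup π (lookup π i) ∷ lookup π (lookup π (lookup π i)) ∷ []

  least : Gap → List Gap → Gap
  least = foldr λ i j → if does (i Fin.≤? j) then i else j

  -- The least gap of a cycle serves as its name, so cycles are counted by the gaps that name
  -- themselves.
  root : Routing → Gap → Gap
  root π i = least i (orbit π i)

  isRoot? : (π : Routing) (i : Gap) → Dec (root π i ≡ i)
  isRoot? π i = root π i Fin.≟ i

  cycles : Routing → ℕ
  cycles π = length (filter (isRoot? π) (allFin 4))

  -- The facts about `lookup` and `root` used below, in a decidable form: for the 24 routings
  -- concerned they are verified by evaluation.
  record IsPermutation (π : Routing) : Set where
    constructor isPermutation
    field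
      injective  : ∀ i j → lookup π i ≡ lookup π j → i ≡ j
      root-next  : ∀ i → root π (lookup π i) ≡ root π i
      root-root  : ∀ i → root π (root π i) ≡ root π i
      root∈orbit : ∀ i → root π i ∈ orbit π i

  open IsPermutation

  isPermutation? : (π : Routing) → Dec (IsPermutation π)
  isPermutation? π = map′
    (λ (p , q , r , s) → isPermutation p q r s)
    (λ p → injective p , root-next p , root-root p , root∈orbit p)
    (all? (λ i → all? λ j → (lookup π i Fin.≟ lookup π j) →-dec (i Fin.≟ j)) ×-dec
     all? (λ i → root π (lookup π i) Fin.≟ root π i) ×-dec
     all? (λ i → root π (root π i) Fin.≟ root π i) ×-dec
     all? (λ i → DecMembership._∈?_ Fin._≟_ (root π i) (orbit π i)))

  module _ {G : Core} {π : Routing} {k : ℕ} (R : Realises G π k) (P : IsPermutation π) where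

    private
      E : Edges
      E = edges G ++ gapEdges G

      component : Side → Gap ⊎ Fin k
      component s = Sum.map₁ (root π) (label R s)

      gap∈ : ∀ i → (left G i , right G i) ∈ gapEdges G
      gap∈ 0F = here refl
      gap∈ 1F = there (here refl)
      gap∈ 2F = there (there (here refl))
      gap∈ 3F = there (there (there (here refl)))

      gap∈⁻ : ∀ {e} → e ∈ gapEdges G → ∃ λ i → e ≡ (left G i , right G i)
      gap∈⁻ (here refl)                         = 0F , refl
      gap∈⁻ (there (here refl))                 = 1F , refl
      gap∈⁻ (there (there (here refl)))         = 2F , refl
      gap∈⁻ (there (there (there (here refl)))) = 3F , refl

      weaken : ∀ {s t} → edges G ⊢ s ~ t → E ⊢ s ~ t
      weaken = ~-mono ∈-++⁺ˡ

      next : ∀ i → E ⊢ right G i ~ right G (lookup π i)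
      next i = ~-trans (~-sym (~-edge (∈-++⁺ʳ (edges G) (gap∈ i)))) (weaken (left~right R i))

      along : ∀ {i j} → j ∈ orbit π i → E ⊢ right G i ~ right G j
      along (here refl)                         = ~-refl
      along (there (here refl))                 = next _
      along (there (there (here refl)))         = ~-trans (next _) (next _)
      along (there (there (there (here refl)))) = ~-trans (next _) (~-trans (next _) (next _))

      towards : ∀ ℓ → E ⊢ representative R ℓ ~ representative R (Sum.map₁ (root π) ℓ)
      towards (inj₁ i) = along (root∈orbit P i)
      towards (inj₂ j) = ~-refl

      component~ : ∀ {s} → s ∈ sides G → E ⊢ s ~ representative R (component s)
      component~ {s} s∈ = ~-trans (weaken (represented R s∈)) (towards (label R s))

    -- Closing gap `i` glues its left end, where the path from gap `lookup π i` ends, to its right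
    -- end. Hence the open paths merge along the cycles of `π`, while the loops stay apart.
    closed-labelling : Labelling (sides G) E component
    closed-labelling = record
      { respects  = λ e∈ → Sum.[ cong (Sum.map₁ (root π)) ∘ respects R , gaps ∘ gap∈⁻ ] (∈-++⁻ (edges G) e∈)
      ; connected = λ {s} {t} s∈ t∈ eq → ~-trans (component~ s∈)
          (subst (λ ℓ → E ⊢ representative R ℓ ~ t) (sym eq) (~-sym (component~ t∈)))
      }
      where
      gaps : ∀ {s t} → ∃ (λ i → (s , t) ≡ (left G i , right G i)) → component s ≡ component t
      gaps (i , refl) = begin
        Sum.map₁ (root π) (label R (left G i))   ≡⟨ cong (Sum.map₁ (root π)) (label-left R i) ⟩
        inj₁ (root π (lookup π i))               ≡⟨ cong inj₁ (root-next P i) ⟩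
        inj₁ (root π i)                          ≡⟨ cong (Sum.map₁ (root π)) (label-right R i) ⟨
        Sum.map₁ (root π) (label R (right G i))  ∎
        where open ≡-Reasoning

    private
      roots : List Gap
      roots = filter (isRoot? π) (allFin 4)

    closed-enumeration : Enumerates (sides G) component (map inj₁ roots ++ map inj₂ (allFin k))
    closed-enumeration = record
      { unique   = Unique.++⁺ (Unique.map⁺ inj₁-injective (Unique.filter⁺ (isRoot? π) (Unique.allFin⁺ 4)))
                     (Unique.map⁺ inj₂-injective (Unique.allFin⁺ k)) disjoint
      ; labels   = λ {s} _ → listed (label R s)
      ; attained = λ ℓ∈ → Sum.[ attained₁ , attained₂ ] (∈-++⁻ (map inj₁ roots) ℓ∈)
      }
      where
      disjoint : ∀ {ℓ} → ℓ ∈ map inj₁ roots × ℓ ∈ map inj₂ (allFin k) → _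
      disjoint (p , q) with ∈-map⁻ inj₁ p | ∈-map⁻ inj₂ q
      ... | _ , _ , refl | _ , _ , ()

      listed : ∀ ℓ → Sum.map₁ (root π) ℓ ∈ map inj₁ roots ++ map inj₂ (allFin k)
      listed (inj₁ i) = ∈-++⁺ˡ (∈-map⁺ inj₁ (∈-filter⁺ (isRoot? π) (∈-allFin _) (root-root P i)))
      listed (inj₂ j) = ∈-++⁺ʳ (map inj₁ roots) (∈-map⁺ inj₂ (∈-allFin j))

      attained₁ : ∀ {ℓ} → ℓ ∈ map inj₁ roots → ∃ λ s → s ∈ sides G × component s ≡ ℓ
      attained₁ ℓ∈ with ∈-map⁻ inj₁ ℓ∈
      ... | i , i∈ , refl = right G i , right∈ R i , trans (cong (Sum.map₁ (root π)) (label-right R i))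
              (cong inj₁ (∈-filter⁻ (isRoot? π) {xs = allFin 4} i∈ .proj₂))

      attained₂ : ∀ {ℓ} → ℓ ∈ map inj₂ (allFin k) → ∃ λ s → s ∈ sides G × component s ≡ ℓ
      attained₂ ℓ∈ with ∈-map⁻ inj₂ ℓ∈
      ... | j , _ , refl = loop R j , loop∈ R j , cong (Sum.map₁ (root π)) (label-loop R j)

    length-enumeration : length (map inj₁ roots ++ map {B = Gap ⊎ Fin k} inj₂ (allFin k)) ≡ cycles π + k
    length-enumeration = begin
      length (map inj₁ roots ++ map inj₂ (allFin k))             ≡⟨ length-++ (map inj₁ roots) ⟩
      length (map inj₁ roots) + length (map inj₂ (allFin k))     ≡⟨ cong₂ _+_ (length-map inj₁ roots) (trans (length-map inj₂ (allFin k)) (length-tabulate id)) ⟩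
      cycles π + k                                               ∎
      where open ≡-Reasoning

    vertices-realised : ∀ {w} → Unique w → w ↭ sides G → cornerGluings w ↭ E →
                        length (vertices w) ≡ cycles π + k
    vertices-realised {w} uniq w↭ e↭ = trans (length-components uniq
      (λ e∈ → let s∈ , t∈ = endsE (∈-resp-↭ e↭ e∈) in back s∈ , back t∈)
      (record
        { respects  = λ e∈ → respects closed-labelling (∈-resp-↭ e↭ e∈)
        ; connected = λ s∈ t∈ eq → ~-mono (∈-resp-↭ (↭-sym e↭))
            (connected closed-labelling (∈-resp-↭ w↭ s∈) (∈-resp-↭ w↭ t∈) eq)
        })
      (record
        { unique   = unique closed-enumeration
        ; labels   = λ s∈ → labels closed-enumeration (∈-resp-↭ w↭ s∈)
        ; attained = λ ℓ∈ → let s , s∈ , eq = attained closed-enumeration ℓ∈ in s , back s∈ , eq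
        }))
      length-enumeration
      where
      back : ∀ {s} → s ∈ sides G → s ∈ w
      back = ∈-resp-↭ (↭-sym w↭)

      endsE : ∀ {s t} → (s , t) ∈ E → s ∈ sides G × t ∈ sides G
      endsE e∈ with ∈-++⁻ (edges G) e∈
      ... | inj₁ e∈C = ends R e∈C
      ... | inj₂ e∈g with gap∈⁻ e∈g
      ... | i , refl = left∈ R i , right∈ R i

  level : Letter → ℕ
  level a[ i ] = i
  level _      = 0

  below⇒fresh : ∀ {m G} → All (λ s → level (proj₁ s) ≤ m) (sides G) → Fresh a[ suc m ] G
  below⇒fresh bound s∈ eq = 1+n≰n (subst (λ x → level x ≤ _) (sym eq) (All.lookup bound s∈))

  add-below : ∀ {m G} e d → All (λ s → level (proj₁ s) ≤ m) (sides G) →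
              All (λ s → level (proj₁ s) ≤ suc m) (sides (add a[ suc m ] e d G))
  add-below e d bound = ≤-refl ∷ ≤-refl ∷ All.map m≤n⇒m≤1+n bound

  add-unique : ∀ {m G} e d → All (λ s → level (proj₁ s) ≤ m) (sides G) → Unique (sides G) →
               Unique (sides (add a[ suc m ] e d G))
  add-unique {m} {G} e d bound uniq =
    ((λ ()) ∷ All.tabulate (λ s∈ eq → below⇒fresh {m} {G} bound s∈ (cong proj₁ eq))) ∷
    (All.tabulate (λ s∈ eq → below⇒fresh {m} {G} bound s∈ (cong proj₁ eq))) ∷ uniq

  complete-unique : ∀ {n} m (K T : Subset n) G → All (λ s → level (proj₁ s) ≤ m) (sides G) →
                    Unique (sides G) → Unique (sides (complete m K T G))
  complete-unique m []      []      G _     uniq = uniq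
  complete-unique m (e ∷ K) (d ∷ T) G bound uniq =
    complete-unique (suc m) K T (add a[ suc m ] e d G) (add-below {m} {G} e d bound) (add-unique {m} {G} e d bound uniq)

  _≟ᴿ_ : (π σ : Routing) → Dec (π ≡ σ)
  _≟ᴿ_ = Vec.≡-dec Fin._≟_

  insertions : ∀ {A : Set} {n} → A → Vec A n → List (Vec A (suc n))
  insertions x []       = [ x ∷ [] ]
  insertions x (y ∷ ys) = (x ∷ y ∷ ys) ∷ map (y ∷_) (insertions x ys)

  permutations : List Routing
  permutations = concatMap (insertions 0F) (concatMap (insertions 1F) (insertions 2F (3F ∷ [])))

  permutations-isPermutation : All IsPermutation permutations
  permutations-isPermutation = from-yes (All.all? isPermutation? permutations)

  identity : Routing
  identity = Vec.allFin 4

  identity∈ : identity ∈ permutations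
  identity∈ = from-yes (DecMembership._∈?_ _≟ᴿ_ identity permutations)

  reroute∈ : All (λ π → ∀ e d → reroute e d π ∈ permutations) permutations
  reroute∈ = from-yes (All.all? (λ π → map′ (λ { (p , q , r , s) true true → p ; (p , q , r , s) true false → q
     ; (p , q , r , s) false true → r ; (p , q , r , s) false false → s })
     (λ h → h true true , h true false , h false true , h false false)
     (R? (reroute true true π) ×-dec R? (reroute true false π) ×-dec
      R? (reroute false true π) ×-dec R? (reroute false false π))) permutations)
    where
    R? : (π : Routing) → Dec (π ∈ permutations)
    R? π = DecMembership._∈?_ _≟ᴿ_ π permutations

  finalRouting : ∀ {n} → Subset n → Subset n → Routing → Routing
  finalRouting []      []      π = π
  finalRouting (e ∷ K) (d ∷ T) π = finalRouting K T (reroute e d π)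

  loops : ∀ {n} → Subset n → Subset n → Routing → ℕ
  loops []      []      π = 0
  loops (e ∷ K) (d ∷ T) π = loops K T (reroute e d π) + newLoops e d π

  finalRouting∈ : ∀ {n} (K T : Subset n) {π} → π ∈ permutations → finalRouting K T π ∈ permutations
  finalRouting∈ []      []      π∈ = π∈
  finalRouting∈ (e ∷ K) (d ∷ T) π∈ = finalRouting∈ K T (All.lookup reroute∈ π∈ e d)

  complete-realises : ∀ {n} m (K T : Subset n) {G π k} → All (λ s → level (proj₁ s) ≤ m) (sides G) →
                      π ∈ permutations → Realises G π k →
                      Realises (complete m K T G) (finalRouting K T π) (loops K T π + k)
  complete-realises m []      []      bound π∈ R = R
  complete-realises m (e ∷ K) (d ∷ T) {G} {π} {k} bound π∈ R =
    subst (Realises _ _) (sym (+-assoc (loops K T (reroute e d π)) (newLoops e d π) k))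
      (complete-realises (suc m) K T (add-below {m} {G} e d bound) (All.lookup reroute∈ π∈ e d)
        (realises-add R (below⇒fresh {m} {G} bound) (injective (All.lookup permutations-isPermutation π∈)) e d))

  initial-realises : Realises initial identity 0
  initial-realises = record
    { label       = λ { (a , true) → inj₁ 0F ; (b , true) → inj₁ 0F ; (c , true) → inj₁ 0F
                      ; (a , false) → inj₁ 1F ; (b , false) → inj₁ 2F ; (c , false) → inj₁ 3F
                      ; (a[ _ ] , _) → inj₁ 0F }
    ; loop        = λ ()
    ; label-right = λ { 0F → refl ; 1F → refl ; 2F → refl ; 3F → refl }
    ; label-left  = λ { 0F → refl ; 1F → refl ; 2F → refl ; 3F → refl }
    ; label-loop  = λ ()
    ; right∈      = λ { 0F → here refl ; 1F → there (here refl) ; 2F → there (there (there (here refl)))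
                      ; 3F → there (there (there (there (there (here refl))))) }
    ; left∈       = λ { 0F → there (there (there (there (here refl)))) ; 1F → there (here refl)
                      ; 2F → there (there (there (here refl)))
                      ; 3F → there (there (there (there (there (here refl))))) }
    ; loop∈       = λ ()
    ; ends        = λ { (here refl) → here refl , there (there (here refl))
                      ; (there (here refl)) → there (there (here refl)) , there (there (there (there (here refl)))) }
    ; respects    = λ { (here refl) → refl ; (there (here refl)) → refl }
    ; represented = λ
        { (here refl)                                             → ~-refl
        ; (there (here refl))                                     → ~-refl
        ; (there (there (here refl)))                             → ~-sym (~-edge (here refl))
        ; (there (there (there (here refl))))                     → ~-refl
        ; (there (there (there (there (here refl)))))             →
            ~-sym (~-trans (~-edge (here refl)) (~-edge (there (here refl))))
        ; (there (there (there (there (there (here refl))))))     → ~-refl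
        }
    }

  vertices-ladder : ∀ {n} (K T : Subset n) →
                    length (vertices (ladder K T)) ≡ cycles (finalRouting K T identity) + loops K T identity
  vertices-ladder K T = trans
    (vertices-realised (complete-realises 0 K T initial-below identity∈ initial-realises)
      (All.lookup permutations-isPermutation (finalRouting∈ K T identity∈))
      (PermutationSetoid.Unique-resp-↭ (setoid Side) (↭⇒↭ₛ (↭-sym sides↭))
        (complete-unique 0 K T initial initial-below initial-unique))
      sides↭
      (↭-trans (ladder-edges K T) (complete-edges 0 K T initial)))
    (cong (cycles (finalRouting K T identity) +_) (+-identityʳ (loops K T identity)))
    where
    sides↭ : ladder K T ↭ sides (complete 0 K T initial)
    sides↭ = ↭-trans (ladder-sides K T) (complete-sides 0 K T initial)

    initial-below : All (λ s → level (proj₁ s) ≤ 0) (sides initial)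
    initial-below = z≤n ∷ z≤n ∷ z≤n ∷ z≤n ∷ z≤n ∷ z≤n ∷ []

    initial-unique : Unique (sides initial)
    initial-unique = from-yes (unique? (sides initial))
      where open import Data.List.Relation.Unary.Unique.DecPropositional _≟ˢ_ using (unique?)


-- The genus as a sum over moves, and the transfer system

module Census where

  open Components
  open Routings
  open LadderGraph
  open Vertices
  open import Data.Bool using (Bool; true; false; if_then_else_)
  open import Data.Fin.Patterns using (0F; 1F; 2F; 3F)
  open import Data.Fin.Subset using (Subset)
  open import Data.List using (List; []; _∷_; _++_; map; filter; length; cartesianProduct)
  open import Data.List.Membership.Propositional using (_∈_)
  open import Data.List.Properties using (map-++; map-∘; map-cong; ≡-dec)
  open import Data.List.Relation.Binary.Permutation.Propositional using (_↭_; ↭-sym; ↭-trans; ↭-reflexive)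
  open import Data.List.Relation.Binary.Permutation.Propositional.Properties using (↭-length) renaming (map⁺ to ↭-map⁺)
  open import Data.List.Relation.Unary.All as All using (All; []; _∷_)
  open import Data.Nat using (ℕ; zero; suc; _+_; _*_; _∸_; _/_; _≟_; ⌊_/2⌋)
  open import Data.Nat.DivMod using (m*n/n≡m)
  open import Data.Nat.ListAction using (sum)
  open import Data.Nat.ListAction.Properties using (sum-++; sum-↭)
  open import Data.Nat.Properties using (+-suc; +-identityʳ; m+n∸m≡n; *-comm; ≤-decTotalOrder)
  open import Data.Nat.Solver using (module +-*-Solver)
  open import Data.Product using (_×_; _,_)
  import Data.Product.Properties as Product
  open import Data.Product.Relation.Binary.Lex.NonStrict using (×-decTotalOrder)
  open import Data.Vec as Vec using ([]; _∷_)
  open import Function using (_∘_)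
  open import Relation.Binary.PropositionalEquality hiding ([_])
  open import Relation.Nullary using (Dec; does)
  open import Relation.Unary using (Decidable)
  open import Relation.Nullary.Decidable using (from-yes; map′; _×-dec_)

  open Core

  -- One new edge raises the number of vertices plus twice the genus by one, and the vertices are
  -- the cycles together with the loops. That neither the subtraction nor the halving truncates is
  -- the content of `euler-step`.
  newHandles : Bool → Bool → Routing → ℕ
  newHandles e d π = ⌊ suc (cycles π) ∸ (newLoops e d π + cycles (reroute e d π)) /2⌋

  everyMove? : ∀ {P : Bool → Bool → Set} → (∀ e d → Dec (P e d)) → Dec (∀ e d → P e d)
  everyMove? P? = map′
    (λ { (p , q , r , s) true true → p ; (p , q , r , s) true false → q
       ; (p , q , r , s) false true → r ; (p , q , r , s) false false → s })
    (λ h → h true true , h true false , h false true , h false false)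
    (P? true true ×-dec P? true false ×-dec P? false true ×-dec P? false false)

  euler-step : All (λ π → ∀ e d → newLoops e d π + cycles (reroute e d π) + 2 * newHandles e d π ≡ suc (cycles π))
                   permutations
  euler-step = from-yes (All.all? (λ π → everyMove? λ e d →
    newLoops e d π + cycles (reroute e d π) + 2 * newHandles e d π ≟ suc (cycles π)) permutations)

  handles : ∀ {n} → Subset n → Subset n → Routing → ℕ
  handles []      []      π = 0
  handles (e ∷ K) (d ∷ T) π = newHandles e d π + handles K T (reroute e d π)

  euler : ∀ {n} (K T : Subset n) {π} → π ∈ permutations →
          cycles (finalRouting K T π) + loops K T π + 2 * handles K T π ≡ n + cycles π
  euler []      []      {π} _  = trans (+-identityʳ _) (+-identityʳ _)
  euler {suc n} (e ∷ K) (d ∷ T) {π} π∈ = begin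
    c′ + (l′ + l) + 2 * (h + h′)        ≡⟨ solve 5 (λ c′ l′ l h h′ → c′ :+ (l′ :+ l) :+ con 2 :* (h :+ h′)
                                             := (c′ :+ l′ :+ con 2 :* h′) :+ (l :+ con 2 :* h)) refl c′ l′ l h h′ ⟩
    (c′ + l′ + 2 * h′) + (l + 2 * h)    ≡⟨ cong (_+ (l + 2 * h)) (euler K T (All.lookup reroute∈ π∈ e d)) ⟩
    (n + cycles π′) + (l + 2 * h)       ≡⟨ solve 4 (λ n c l h → (n :+ c) :+ (l :+ con 2 :* h)
                                             := n :+ (l :+ c :+ con 2 :* h)) refl n (cycles π′) l h ⟩
    n + (l + cycles π′ + 2 * h)         ≡⟨ cong (n +_) (All.lookup euler-step π∈ e d) ⟩
    n + suc (cycles π)                  ≡⟨ +-suc n (cycles π) ⟩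
    suc n + cycles π                    ∎
    where
    open ≡-Reasoning
    open +-*-Solver
    π′ = reroute e d π
    c′ = cycles (finalRouting K T π′)
    l′ = loops K T π′
    l  = newLoops e d π
    h  = newHandles e d π
    h′ = handles K T π′

  length-complete : ∀ {n} m (K T : Subset n) G → length (sides (complete m K T G)) ≡ n * 2 + length (sides G)
  length-complete m []      []      G = refl
  length-complete {suc n} m (e ∷ K) (d ∷ T) G = trans (length-complete (suc m) K T (add a[ suc m ] e d G))
    (trans (+-suc (n * 2) _) (cong suc (+-suc (n * 2) _)))

  genus-ladder : ∀ {n} (K T : Subset n) → genus (ladder K T) ≡ handles K T identity
  genus-ladder {n} K T = begin
    (1 + length (ladder K T) / 2 ∸ V) / 2    ≡⟨ cong (λ l → (1 + l ∸ V) / 2) half ⟩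
    (1 + (n + 3) ∸ V) / 2                    ≡⟨ cong (λ l → (l ∸ V) / 2) (trans (sym (+-suc n 3)) (sym characteristic)) ⟩
    (V + H * 2 ∸ V) / 2                      ≡⟨ cong (_/ 2) (m+n∸m≡n V (H * 2)) ⟩
    H * 2 / 2                                ≡⟨ m*n/n≡m H 2 ⟩
    H                                        ∎
    where
    open ≡-Reasoning
    V = length (vertices (ladder K T))
    H = handles K T identity

    half : length (ladder K T) / 2 ≡ n + 3
    half = trans (cong (_/ 2) (trans
        (↭-length (↭-trans (ladder-sides K T) (complete-sides 0 K T initial)))
        (trans (length-complete 0 K T initial) (+-*-Solver.solve 1 (λ n → n :* con 2 :+ con 6 := (n :+ con 3) :* con 2) refl n))))
      (m*n/n≡m (n + 3) 2)
      where open +-*-Solver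

    -- The 4 counts the cycles of `identity`, the vertices of the sphere a a⁻ b b⁻ c c⁻. It makes
    -- the right side one more than the number n + 3 of edges, as in the definition of the genus.
    characteristic : V + H * 2 ≡ n + 4
    characteristic = trans (cong₂ _+_ (vertices-ladder K T) (*-comm H 2)) (euler K T identity∈)

  δ : ℕ → ℕ → ℕ
  δ i j = if does (i ≟ j) then 1 else 0

  length-filter : ∀ {A : Set} {P : A → Set} (P? : Decidable P) xs →
                  length (filter P? xs) ≡ sum (map (λ x → if does (P? x) then 1 else 0) xs)
  length-filter P? []       = refl
  length-filter P? (x ∷ xs) with does (P? x)
  ... | true  = cong suc (length-filter P? xs)
  ... | false = length-filter P? xs

  sum-cartesianProduct : ∀ {A B : Set} (f : A × B → ℕ) xs ys →
    sum (map f (cartesianProduct xs ys)) ≡ sum (map (λ x → sum (map (λ y → f (x , y)) ys)) xs)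
  sum-cartesianProduct f []       ys = refl
  sum-cartesianProduct f (x ∷ xs) ys = begin
    sum (map f (map (x ,_) ys ++ cartesianProduct xs ys))
      ≡⟨ cong sum (map-++ f (map (x ,_) ys) (cartesianProduct xs ys)) ⟩
    sum (map f (map (x ,_) ys) ++ map f (cartesianProduct xs ys))
      ≡⟨ sum-++ (map f (map (x ,_) ys)) _ ⟩
    sum (map f (map (x ,_) ys)) + sum (map f (cartesianProduct xs ys))
      ≡⟨ cong₂ _+_ (cong sum (map-∘ ys)) (sym (sum-cartesianProduct f xs ys)) ⟨
    sum (map (λ y → f (x , y)) ys) + sum (map (λ x → sum (map (λ y → f (x , y)) ys)) xs) ∎
    where open ≡-Reasoning

  sum-map-+ : ∀ {A : Set} (f g : A → ℕ) xs → sum (map (λ x → f x + g x) xs) ≡ sum (map f xs) + sum (map g xs)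
  sum-map-+ f g []       = refl
  sum-map-+ f g (x ∷ xs) = trans (cong (f x + g x +_) (sum-map-+ f g xs))
    (solve 4 (λ p q r s → p :+ q :+ (r :+ s) := p :+ r :+ (q :+ s)) refl (f x) (g x) (sum (map f xs)) (sum (map g xs)))
    where open +-*-Solver

  sum-map-0 : ∀ {A : Set} (xs : List A) → sum (map (λ _ → 0) xs) ≡ 0
  sum-map-0 []       = refl
  sum-map-0 (x ∷ xs) = sum-map-0 xs

  ∑ : ∀ n → (Subset n → ℕ) → ℕ
  ∑ n f = sum (map f (allSubsets n))

  ∑-suc : ∀ n (f : Subset (suc n) → ℕ) → ∑ (suc n) f ≡ ∑ n (f ∘ (true ∷_)) + ∑ n (f ∘ (false ∷_))
  ∑-suc n f = trans (cong sum (map-++ f (map (true ∷_) (allSubsets n)) _))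
    (trans (sum-++ (map f (map (true ∷_) (allSubsets n))) _)
      (cong₂ _+_ (cong sum (sym (map-∘ (allSubsets n)))) (cong sum (sym (map-∘ (allSubsets n))))))

  ∑-cong : ∀ n {f g : Subset n → ℕ} → (∀ K → f K ≡ g K) → ∑ n f ≡ ∑ n g
  ∑-cong n f≗g = cong sum (map-cong f≗g (allSubsets n))

  ∑∑ : ∀ n → (Subset n → Subset n → ℕ) → ℕ
  ∑∑ n f = ∑ n λ K → ∑ n (f K)

  moves : List (Bool × Bool)
  moves = (true , true) ∷ (true , false) ∷ (false , true) ∷ (false , false) ∷ []

  ∑∑-suc : ∀ n f → ∑∑ (suc n) f ≡ sum (map (λ (e , d) → ∑∑ n λ K T → f (e ∷ K) (d ∷ T)) moves)
  ∑∑-suc n f = begin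
    ∑∑ (suc n) f               ≡⟨ ∑-suc n (λ K → ∑ (suc n) (f K)) ⟩
    ∑ n (λ K → ∑ (suc n) (f (true ∷ K))) + ∑ n (λ K → ∑ (suc n) (f (false ∷ K)))
                               ≡⟨ cong₂ _+_ (inner true) (inner false) ⟩
    (S true true + S true false) + (S false true + S false false)
      ≡⟨ solve 4 (λ p q r s → (p :+ q) :+ (r :+ s) := p :+ (q :+ (r :+ (s :+ con 0)))) refl
           (S true true) (S true false) (S false true) (S false false) ⟩
    sum (map (λ (e , d) → S e d) moves)  ∎
    where
    open ≡-Reasoning
    open +-*-Solver
    S : Bool → Bool → ℕ
    S e d = ∑∑ n λ K T → f (e ∷ K) (d ∷ T)

    inner : ∀ e → ∑ n (λ K → ∑ (suc n) (f (e ∷ K))) ≡ S e true + S e false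
    inner e = trans (∑-cong n (λ K → ∑-suc n (f (e ∷ K)))) (sum-map-+ _ _ (allSubsets n))

  -- The coefficients of xʲ p.
  raise : ∀ {A : Set} → A → ℕ → (ℕ → A) → ℕ → A
  raise z zero    p i       = p i
  raise z (suc j) p zero    = z
  raise z (suc j) p (suc i) = raise z j p i

  tally : ℕ → Routing → ℕ → ℕ
  tally n π i = ∑∑ n λ K T → δ (handles K T π) i

  ∑∑-shift : ∀ n (h : Subset n → Subset n → ℕ) j i →
             ∑∑ n (λ K T → δ (j + h K T) i) ≡ raise 0 j (λ i → ∑∑ n λ K T → δ (h K T) i) i
  ∑∑-shift n h zero    i       = refl
  ∑∑-shift n h (suc j) zero    = trans (∑-cong n (λ K → sum-map-0 (allSubsets n))) (sum-map-0 (allSubsets n))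
  ∑∑-shift n h (suc j) (suc i) = ∑∑-shift n h j i

  g₁₁≡tally : ∀ n i → g₁₁ n i ≡ tally n identity i
  g₁₁≡tally n i = begin
    g₁₁ n i
      ≡⟨ length-filter (λ w → genus w ≟ i) (𝒮₁₁ n) ⟩
    sum (map (λ w → δ (genus w) i) (map (λ (K , T) → ladder K T) pairs))
      ≡⟨ cong sum (map-∘ pairs) ⟨
    sum (map (λ (K , T) → δ (genus (ladder K T)) i) pairs)
      ≡⟨ cong sum (map-cong (λ (K , T) → cong (λ g → δ g i) (genus-ladder K T)) pairs) ⟩
    sum (map (λ (K , T) → δ (handles K T identity) i) pairs)
      ≡⟨ sum-cartesianProduct _ (allSubsets n) (allSubsets n) ⟩
    tally n identity i ∎
    where
    open ≡-Reasoning
    pairs = cartesianProduct (allSubsets n) (allSubsets n)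

  -- Routings of the same class have the same number of successors of each class and each
  -- number of new handles; the classes were found by partition refinement.
  class : Routing → ℕ
  class (0F ∷ 1F ∷ 2F ∷ 3F ∷ []) = 0
  class (0F ∷ 1F ∷ 3F ∷ 2F ∷ []) = 6
  class (0F ∷ 2F ∷ 1F ∷ 3F ∷ []) = 1
  class (0F ∷ 2F ∷ 3F ∷ 1F ∷ []) = 4
  class (0F ∷ 3F ∷ 1F ∷ 2F ∷ []) = 2
  class (0F ∷ 3F ∷ 2F ∷ 1F ∷ []) = 5
  class (1F ∷ 0F ∷ 2F ∷ 3F ∷ []) = 6
  class (1F ∷ 0F ∷ 3F ∷ 2F ∷ []) = 11
  class (1F ∷ 2F ∷ 0F ∷ 3F ∷ []) = 4
  class (1F ∷ 2F ∷ 3F ∷ 0F ∷ []) = 12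
  class (1F ∷ 3F ∷ 0F ∷ 2F ∷ []) = 7
  class (1F ∷ 3F ∷ 2F ∷ 0F ∷ []) = 4
  class (2F ∷ 0F ∷ 1F ∷ 3F ∷ []) = 2
  class (2F ∷ 0F ∷ 3F ∷ 1F ∷ []) = 7
  class (2F ∷ 1F ∷ 0F ∷ 3F ∷ []) = 5
  class (2F ∷ 1F ∷ 3F ∷ 0F ∷ []) = 4
  class (2F ∷ 3F ∷ 0F ∷ 1F ∷ []) = 3
  class (2F ∷ 3F ∷ 1F ∷ 0F ∷ []) = 8
  class (3F ∷ 0F ∷ 1F ∷ 2F ∷ []) = 10
  class (3F ∷ 0F ∷ 2F ∷ 1F ∷ []) = 2
  class (3F ∷ 1F ∷ 0F ∷ 2F ∷ []) = 2
  class (3F ∷ 1F ∷ 2F ∷ 0F ∷ []) = 1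
  class (3F ∷ 2F ∷ 0F ∷ 1F ∷ []) = 8
  class (3F ∷ 2F ∷ 1F ∷ 0F ∷ []) = 9
  class _ = 13

  -- The transfer matrix: each entry is the class of a successor with the number of new handles.
  -- Classes 0 to 12 cover all permutations; the empty list is the value at the leftover 13.
  successorClasses : ℕ → List (ℕ × ℕ)
  successorClasses 0  = (1 , 1) ∷ (1 , 1) ∷ (5 , 1) ∷ (5 , 1) ∷ []
  successorClasses 1  = (1 , 0) ∷ (2 , 1) ∷ (2 , 1) ∷ (9 , 1) ∷ []
  successorClasses 2  = (1 , 0) ∷ (1 , 0) ∷ (8 , 1) ∷ (8 , 1) ∷ []
  successorClasses 3  = (5 , 0) ∷ (5 , 0) ∷ (8 , 1) ∷ (8 , 1) ∷ []
  successorClasses 4  = (4 , 0) ∷ (6 , 0) ∷ (7 , 1) ∷ (12 , 1) ∷ []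
  successorClasses 5  = (0 , 0) ∷ (3 , 1) ∷ (4 , 1) ∷ (4 , 1) ∷ []
  successorClasses 6  = (4 , 1) ∷ (4 , 1) ∷ (4 , 1) ∷ (4 , 1) ∷ []
  successorClasses 7  = (4 , 0) ∷ (4 , 0) ∷ (4 , 0) ∷ (4 , 0) ∷ []
  successorClasses 8  = (2 , 0) ∷ (2 , 0) ∷ (8 , 0) ∷ (9 , 0) ∷ []
  successorClasses 9  = (9 , 0) ∷ (9 , 0) ∷ (10 , 1) ∷ (10 , 1) ∷ []
  successorClasses 10 = (9 , 0) ∷ (9 , 0) ∷ (9 , 0) ∷ (9 , 0) ∷ []
  successorClasses 11 = (12 , 1) ∷ (12 , 1) ∷ (12 , 1) ∷ (12 , 1) ∷ []
  successorClasses 12 = (11 , 0) ∷ (11 , 0) ∷ (12 , 0) ∷ (12 , 0) ∷ []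
  successorClasses _  = []

  outcome : Routing → Bool × Bool → ℕ × ℕ
  outcome π (e , d) = class (reroute e d π) , newHandles e d π

  -- Both lists are sorted first, so that equality of multisets becomes an equality of lists decided
  -- by evaluation.
  successors-class : All (λ π → map (outcome π) moves ↭ successorClasses (class π))
                         permutations
  successors-class = All.map (λ {π} eq → ↭-trans (↭-sym (sort-↭ _)) (↭-trans (↭-reflexive eq) (sort-↭ _)))
    (from-yes (All.all? (λ π → ≡-dec (Product.≡-dec _≟_ _≟_)
      (sort (map (outcome π) moves)) (sort (successorClasses (class π)))) permutations))
    where
    open import Data.List.Sort.Base using (module SortingAlgorithm)
    open import Data.List.Sort.InsertionSort (×-decTotalOrder ≤-decTotalOrder ≤-decTotalOrder) using (insertionSort)
    open SortingAlgorithm insertionSort using (sort; sort-↭)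

  census : ℕ → ℕ → ℕ → ℕ
  census zero    k i = δ 0 i
  census (suc n) k i = sum (map (λ (k′ , j) → raise 0 j (census n k′) i) (successorClasses k))

  raise-cong : ∀ {A : Set} (z : A) j {p q : ℕ → A} → (∀ i → p i ≡ q i) → ∀ i → raise z j p i ≡ raise z j q i
  raise-cong z zero    p≗q i       = p≗q i
  raise-cong z (suc j) p≗q zero    = refl
  raise-cong z (suc j) p≗q (suc i) = raise-cong z j p≗q i

  tally≡census : ∀ n {π} → π ∈ permutations → ∀ i → tally n π i ≡ census n (class π) i
  tally≡census zero    {π} _  i = trans (+-identityʳ _) (+-identityʳ _)
  tally≡census (suc n) {π} π∈ i = begin
    tally (suc n) π i
      ≡⟨ ∑∑-suc n (λ K T → δ (handles K T π) i) ⟩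
    sum (map (λ (e , d) → ∑∑ n λ K T → δ (newHandles e d π + handles K T (reroute e d π)) i) moves)
      ≡⟨ cong sum (map-cong (λ (e , d) → ∑∑-shift n (λ K T → handles K T (reroute e d π)) (newHandles e d π) i) moves) ⟩
    sum (map (λ (e , d) → raise 0 (newHandles e d π) (tally n (reroute e d π)) i) moves)
      ≡⟨ cong sum (map-cong (λ (e , d) → raise-cong 0 (newHandles e d π) (tally≡census n (All.lookup reroute∈ π∈ e d)) i) moves) ⟩
    sum (map (λ (e , d) → raise 0 (newHandles e d π) (census n (class (reroute e d π))) i) moves)
      ≡⟨ cong sum (map-∘ {g = λ (k′ , j) → raise 0 j (census n k′) i} {f = outcome π} moves) ⟩
    sum (map (λ (k′ , j) → raise 0 j (census n k′) i) (map (outcome π) moves))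
      ≡⟨ sum-↭ (↭-map⁺ _ (All.lookup successors-class π∈)) ⟩
    census (suc n) (class π) i ∎
    where open ≡-Reasoning

  g₁₁≡census : ∀ n i → g₁₁ n i ≡ census n 0 i
  g₁₁≡census n i = trans (g₁₁≡tally n i) (tally≡census n identity∈ i)


-- Solution of the transfer system

module ClosedForm where

  open Census
  open import Data.Integer using (ℤ; +_; 0ℤ; 1ℤ) renaming (_+_ to _⊕_; _*_ to _⊗_; _-_ to _⊖_)
  import Data.Integer.Properties as ℤ
  open import Data.Integer.Tactic.RingSolver using () renaming (solve to ℤ-ring; solve-∀ to ℤ-ring-∀)
  open import Data.List using (List; []; _∷_; map)
  open import Data.Nat using (ℕ; zero; suc; _+_)
  open import Data.Nat.ListAction using (sum)
  open import Data.Product using (_×_; _,_)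
  open import Relation.Binary.PropositionalEquality hiding ([_])

  infix 9 _↑_

  _↑_ : (ℕ → ℤ) → ℕ → ℕ → ℤ
  p ↑ j = raise 0ℤ j p

  -- Polynomials in x are given by their coefficients; I is the constant 1.
  I : ℕ → ℤ
  I zero    = 1ℤ
  I (suc _) = 0ℤ

  E : ℕ → ℕ → ℕ → ℤ
  E k n i = + census n k i

  total : ℕ → List (ℕ × ℕ) → ℕ → ℕ → ℤ
  total m []             n i = 0ℤ
  total m ((k , j) ∷ ks) n i = (E k n ↑ (m + j)) i ⊕ total m ks n i

  E-suc : ∀ k n i → E k (suc n) i ≡ total 0 (successorClasses k) n i
  E-suc k n i = go (successorClasses k)
    where
    pos-raise : ∀ j (p : ℕ → ℕ) i → + raise 0 j p i ≡ ((λ i → + p i) ↑ j) i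
    pos-raise zero    p i       = refl
    pos-raise (suc j) p zero    = refl
    pos-raise (suc j) p (suc i) = pos-raise j p i

    go : ∀ ks → + sum (map (λ (k′ , j) → raise 0 j (census n k′) i) ks) ≡ total 0 ks n i
    go []             = refl
    go ((k , j) ∷ ks) = trans (ℤ.pos-+ (raise 0 j (census n k) i) _)
      (cong₂ _⊕_ (pos-raise j (census n k) i) (go ks))

  -- Substituting one transfer equation into another brings in a factor x whenever the move creates
  -- a handle, so the equations are also needed after multiplication by x.
  E-suc↑ : ∀ k n i → (E k (suc n) ↑ 1) i ≡ total 1 (successorClasses k) n i
  E-suc↑ k n (suc i) = trans (E-suc k n i) (go (successorClasses k))
    where
    go : ∀ ks → total 0 ks n i ≡ total 1 ks n (suc i)
    go []             = refl
    go ((k , j) ∷ ks) = cong ((E k n ↑ j) i ⊕_) (go ks)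
  E-suc↑ k n zero    = go (successorClasses k)
    where
    go : ∀ ks → 0ℤ ≡ total 1 ks n zero
    go []             = refl
    go ((k , j) ∷ ks) = trans (go ks) (sym (ℤ.+-identityˡ _))

  -- Eliminating the other classes from the transfer system leaves second order recurrences,
  -- whose solutions are combinations of recurrent sequences with (p , q) = (2 , 8), (1 , 8), (0 , 4).
  recurrent : (p q u v : ℤ) → ℕ → ℕ → ℤ
  recurrent p q u v zero          i = u ⊗ I i
  recurrent p q u v (suc zero)    i = v ⊗ I i
  recurrent p q u v (suc (suc n)) i = p ⊗ recurrent p q u v (suc n) i ⊕ q ⊗ (recurrent p q u v n ↑ 1) i

  delayed : (ℕ → ℕ → ℤ) → ℕ → ℕ → ℤ
  delayed s zero    i = 0ℤ
  delayed s (suc n) i = s n i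

  -- The solution with value 1 at index 0 and value 0 at index -1. The latter is supplied by
  -- `delayed`, so the recurrence holds from the first step on.
  module Fundamental (p q : ℤ) where

    S : ℕ → ℕ → ℤ
    S = recurrent p q 1ℤ p

    private
      unit : ∀ p q r → p ⊗ r ≡ p ⊗ (+ 1 ⊗ r) ⊕ q ⊗ + 0
      unit = ℤ-ring-∀

      zeros : ∀ p q → + 0 ≡ p ⊗ + 0 ⊕ q ⊗ + 0
      zeros = ℤ-ring-∀

    step : ∀ n i → S (suc n) i ≡ p ⊗ S n i ⊕ q ⊗ (delayed S n ↑ 1) i
    step zero    zero    = unit p q (I zero)
    step zero    (suc i) = unit p q (I (suc i))
    step (suc n) i       = refl

    step↑ : ∀ n j i → (S (suc n) ↑ j) i ≡ p ⊗ (S n ↑ j) i ⊕ q ⊗ (delayed S n ↑ suc j) i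
    step↑ n zero    i       = step n i
    step↑ n (suc j) zero    = zeros p q
    step↑ n (suc j) (suc i) = step↑ n j i

  private
    A Â B B̂ C Ĉ : ℕ → ℕ → ℤ
    A = recurrent (+ 2) (+ 8) (+ 1) (+ 2)
    B = recurrent (+ 1) (+ 8) (+ 1) (+ 1)
    C = recurrent (+ 0) (+ 4) (+ 1) (+ 0)
    Â = delayed A
    B̂ = delayed B
    Ĉ = delayed C

    module FA = Fundamental (+ 2) (+ 8)
    module FB = Fundamental (+ 1) (+ 8)
    module FC = Fundamental (+ 0) (+ 4)

  -- Classes 11 and 12 form a closed subsystem: E 12 (n + 2) = 2 E 12 (n + 1) + 2 E 11 (n + 1) and E
  -- 11 (n + 1) = 4 x E 12 n, which gives (p , q) = (2 , 8).
  closed₁₂ : ∀ n i → E 12 n i ≡ A n i ⊕ + 2 ⊗ Â n i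
  closed₁₂↑ : ∀ n i → (E 12 n ↑ 1) i ≡ (A n ↑ 1) i ⊕ + 2 ⊗ (Â n ↑ 1) i
  closed₁₂↑ n zero    = refl
  closed₁₂↑ n (suc i) = closed₁₂ n i
  closed₁₂ zero          zero    = refl
  closed₁₂ zero          (suc i) = refl
  closed₁₂ (suc zero)    zero    = refl
  closed₁₂ (suc zero)    (suc i) = refl
  closed₁₂ (suc (suc n)) i       = combine
    (E-suc 12 (suc n) i) (E-suc 11 n i) (closed₁₂ (suc n) i) (closed₁₂↑ n i) (FA.step n i)
    where
    combine : ∀ {e e₁₁ e₁₂ x₁₂ a₁ a₀ xa xh} →
      e ≡ e₁₁ ⊕ (e₁₁ ⊕ (e₁₂ ⊕ (e₁₂ ⊕ 0ℤ))) → e₁₁ ≡ x₁₂ ⊕ (x₁₂ ⊕ (x₁₂ ⊕ (x₁₂ ⊕ 0ℤ))) →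
      e₁₂ ≡ a₁ ⊕ + 2 ⊗ a₀ → x₁₂ ≡ xa ⊕ + 2 ⊗ xh → a₁ ≡ + 2 ⊗ a₀ ⊕ + 8 ⊗ xh →
      e ≡ + 2 ⊗ a₁ ⊕ + 8 ⊗ xa ⊕ + 2 ⊗ a₁
    combine {a₀ = a₀} {xa} {xh} refl refl refl refl refl = ℤ-ring (a₀ ∷ xa ∷ xh ∷ [])

  -- Classes 9 and 10 also form a closed subsystem. The factor x now sits on the way out of class 9
  -- instead of the way back to it, so the recurrence is that of class 12 and only the initial
  -- values differ.
  closed₉ : ∀ n i → E 9 n i ≡ A n i ⊕ + 2 ⊗ (Â n ↑ 1) i
  closed₉↑ : ∀ n i → (E 9 n ↑ 1) i ≡ (A n ↑ 1) i ⊕ + 2 ⊗ (Â n ↑ 2) i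
  closed₉↑ n zero    = refl
  closed₉↑ n (suc i) = closed₉ n i
  closed₉ zero          zero          = refl
  closed₉ zero          (suc i)       = refl
  closed₉ (suc zero)    zero          = refl
  closed₉ (suc zero)    (suc zero)    = refl
  closed₉ (suc zero)    (suc (suc i)) = refl
  closed₉ (suc (suc n)) i             = combine
    {a₁ = A (suc n) i} {xa = (A n ↑ 1) i} {(Â n ↑ 2) i}
    (E-suc 9 (suc n) i) (closed₉ (suc n) i) (E-suc↑ 10 n i) (closed₉↑ n i) (FA.step↑ n 1 i)
    where
    combine : ∀ {e e₉ x₁₀ x₉ a₁ a₁x xa h₂} →
      e ≡ e₉ ⊕ (e₉ ⊕ (x₁₀ ⊕ (x₁₀ ⊕ 0ℤ))) → e₉ ≡ a₁ ⊕ + 2 ⊗ xa →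
      x₁₀ ≡ x₉ ⊕ (x₉ ⊕ (x₉ ⊕ (x₉ ⊕ 0ℤ))) → x₉ ≡ xa ⊕ + 2 ⊗ h₂ → a₁x ≡ + 2 ⊗ xa ⊕ + 8 ⊗ h₂ →
      e ≡ + 2 ⊗ a₁ ⊕ + 8 ⊗ xa ⊕ + 2 ⊗ a₁x
    combine {a₁ = a₁} {xa = xa} {h₂} refl refl refl refl refl = ℤ-ring (a₁ ∷ xa ∷ h₂ ∷ [])

  -- Classes 6 and 7 lead back to class 4, which leaves E 4 (n + 2) = E 4 (n + 1) + 8 x E 4 n + x E
  -- 12 (n + 1): the recurrence for (1 , 8), driven by a solution of that for (2 , 8).
  closed₄ : ∀ n i → E 4 n i ≡ (A n ↑ 1) i ⊕ + 2 ⊗ (Â n ↑ 1) i ⊕ B n i ⊕ B̂ n i ⊖ (B n ↑ 1) i ⊖ (B̂ n ↑ 1) i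
  closed₄↑ : ∀ n i → (E 4 n ↑ 1) i ≡
    (A n ↑ 2) i ⊕ + 2 ⊗ (Â n ↑ 2) i ⊕ (B n ↑ 1) i ⊕ (B̂ n ↑ 1) i ⊖ (B n ↑ 2) i ⊖ (B̂ n ↑ 2) i
  closed₄↑ n zero    = refl
  closed₄↑ n (suc i) = closed₄ n i
  closed₄ zero          zero          = refl
  closed₄ zero          (suc zero)    = refl
  closed₄ zero          (suc (suc i)) = refl
  closed₄ (suc zero)    zero          = refl
  closed₄ (suc zero)    (suc zero)    = refl
  closed₄ (suc zero)    (suc (suc i)) = refl
  closed₄ (suc (suc n)) i             = combine
    {a₁ = (A n ↑ 1) i} {a₂ = (A n ↑ 2) i} {h₂ = (Â n ↑ 2) i} {b₀ = B n i} {b₁ = (B n ↑ 1) i}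
    {b₂ = (B n ↑ 2) i} {k₁ = (B̂ n ↑ 1) i} {k₂ = (B̂ n ↑ 2) i}
    (E-suc 4 (suc n) i) (closed₄ (suc n) i) (E-suc 6 n i) (E-suc↑ 7 n i) (closed₄↑ n i) (closed₁₂↑ (suc n) i)
    (FA.step↑ (suc n) 1 i) (FB.step (suc n) i) (FB.step↑ (suc n) 1 i)
    (FA.step↑ n 1 i) (FB.step n i) (FB.step↑ n 1 i)
    where
    combine : ∀ {e e₄ e₆ x₇ x₁₂ x₄ A₂ B₂ B₂x A₁ B₁ B₁x a₁ a₂ h₂ b₀ b₁ b₂ k₁ k₂} →
      e ≡ e₄ ⊕ (e₆ ⊕ (x₇ ⊕ (x₁₂ ⊕ 0ℤ))) →
      e₄ ≡ A₁ ⊕ + 2 ⊗ a₁ ⊕ B₁ ⊕ b₀ ⊖ B₁x ⊖ b₁ →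
      e₆ ≡ x₄ ⊕ (x₄ ⊕ (x₄ ⊕ (x₄ ⊕ 0ℤ))) → x₇ ≡ x₄ ⊕ (x₄ ⊕ (x₄ ⊕ (x₄ ⊕ 0ℤ))) →
      x₄ ≡ a₂ ⊕ + 2 ⊗ h₂ ⊕ b₁ ⊕ k₁ ⊖ b₂ ⊖ k₂ → x₁₂ ≡ A₁ ⊕ + 2 ⊗ a₁ →
      A₂ ≡ + 2 ⊗ A₁ ⊕ + 8 ⊗ a₂ → B₂ ≡ + 1 ⊗ B₁ ⊕ + 8 ⊗ b₁ → B₂x ≡ + 1 ⊗ B₁x ⊕ + 8 ⊗ b₂ →
      A₁ ≡ + 2 ⊗ a₁ ⊕ + 8 ⊗ h₂ → B₁ ≡ + 1 ⊗ b₀ ⊕ + 8 ⊗ k₁ → B₁x ≡ + 1 ⊗ b₁ ⊕ + 8 ⊗ k₂ →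
      e ≡ A₂ ⊕ + 2 ⊗ A₁ ⊕ B₂ ⊕ B₁ ⊖ B₂x ⊖ B₁x
    combine {a₁ = a₁} {a₂} {h₂} {b₀} {b₁} {b₂} {k₁} {k₂} refl refl refl refl refl refl refl refl refl refl refl refl =
      ℤ-ring (a₁ ∷ a₂ ∷ h₂ ∷ b₀ ∷ b₁ ∷ b₂ ∷ k₁ ∷ k₂ ∷ [])

  -- The transfer equations give x E 8 and E 1 the same increment 2 x E 2 + x E 9, so their
  -- difference keeps its initial value x - 1. This removes class 8 from the system.
  difference₁₈ : ∀ n i → (E 8 n ↑ 1) i ≡ E 1 n i ⊖ I i ⊕ (I ↑ 1) i
  difference₁₈↑ : ∀ n i → (E 8 n ↑ 2) i ≡ (E 1 n ↑ 1) i ⊖ (I ↑ 1) i ⊕ (I ↑ 2) i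
  difference₁₈↑ n zero    = refl
  difference₁₈↑ n (suc i) = difference₁₈ n i
  difference₁₈ zero    zero          = refl
  difference₁₈ zero    (suc zero)    = refl
  difference₁₈ zero    (suc (suc i)) = refl
  difference₁₈ (suc n) i = combine
    {e₁ = E 1 n i} {(E 2 n ↑ 1) i} {(E 9 n ↑ 1) i} {I i} {(I ↑ 1) i}
    (E-suc↑ 8 n i) (E-suc 1 n i) (difference₁₈ n i)
    where
    combine : ∀ {x₈′ e₁′ x₈ e₁ x₂ x₉ u v} →
      x₈′ ≡ x₂ ⊕ (x₂ ⊕ (x₈ ⊕ (x₉ ⊕ 0ℤ))) → e₁′ ≡ e₁ ⊕ (x₂ ⊕ (x₂ ⊕ (x₉ ⊕ 0ℤ))) →
      x₈ ≡ e₁ ⊖ u ⊕ v → x₈′ ≡ e₁′ ⊖ u ⊕ v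
    combine {e₁ = e₁} {x₂} {x₉} {u} {v} refl refl refl = ℤ-ring (e₁ ∷ x₂ ∷ x₉ ∷ u ∷ v ∷ [])

  -- Eliminating classes 2 and 8 leaves E 1 (n + 2) = E 1 (n + 1) + 8 x E 1 n - 4 x (1 - x) + x E 9
  -- (n + 1). The inhomogeneity - 4 x (1 - x) has the particular solution (1 - x) / 2; hence the
  -- doubling.
  closed₁ : ∀ n i → + 2 ⊗ E 1 n i ≡ + 2 ⊗ (A n ↑ 1) i ⊕ + 4 ⊗ (Â n ↑ 2) i
    ⊕ + 4 ⊗ (B̂ n ↑ 1) i ⊕ B n i ⊖ + 4 ⊗ (B̂ n ↑ 2) i ⊖ (B n ↑ 1) i ⊕ I i ⊖ (I ↑ 1) i
  closed₁↑ : ∀ n i → + 2 ⊗ (E 1 n ↑ 1) i ≡ + 2 ⊗ (A n ↑ 2) i ⊕ + 4 ⊗ (Â n ↑ 3) i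
    ⊕ + 4 ⊗ (B̂ n ↑ 2) i ⊕ (B n ↑ 1) i ⊖ + 4 ⊗ (B̂ n ↑ 3) i ⊖ (B n ↑ 2) i ⊕ (I ↑ 1) i ⊖ (I ↑ 2) i
  closed₁↑ n zero    = refl
  closed₁↑ n (suc i) = closed₁ n i
  closed₁ zero          zero                = refl
  closed₁ zero          (suc zero)          = refl
  closed₁ zero          (suc (suc i))       = refl
  closed₁ (suc zero)    zero                = refl
  closed₁ (suc zero)    (suc zero)          = refl
  closed₁ (suc zero)    (suc (suc zero))    = refl
  closed₁ (suc zero)    (suc (suc (suc i))) = refl
  closed₁ (suc (suc n)) i                   = combine
    {a₁ = (A n ↑ 1) i} {a₂ = (A n ↑ 2) i} {h₂ = (Â n ↑ 2) i} {h₃ = (Â n ↑ 3) i} {b₀ = B n i}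
    {b₁ = (B n ↑ 1) i} {b₂ = (B n ↑ 2) i} {k₁ = (B̂ n ↑ 1) i} {k₂ = (B̂ n ↑ 2) i} {k₃ = (B̂ n ↑ 3) i}
    (E-suc 1 (suc n) i) (E-suc↑ 2 n i) (difference₁₈↑ n i) (closed₉↑ (suc n) i)
    (closed₁ (suc n) i) (closed₁↑ n i)
    (FA.step↑ (suc n) 1 i) (FB.step (suc n) i) (FB.step↑ (suc n) 1 i)
    (FA.step↑ n 1 i) (FA.step↑ n 2 i) (FB.step n i) (FB.step↑ n 1 i) (FB.step↑ n 2 i)
    where
    combine : ∀ {e e₁ x₂ x₈ x₉ x₁ A₂ B₂ B₂x A₁ A₁x B₁ B₁x B₁xx u v w a₁ a₂ h₂ h₃ b₀ b₁ b₂ k₁ k₂ k₃} →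
      e ≡ e₁ ⊕ (x₂ ⊕ (x₂ ⊕ (x₉ ⊕ 0ℤ))) → x₂ ≡ x₁ ⊕ (x₁ ⊕ (x₈ ⊕ (x₈ ⊕ 0ℤ))) →
      x₈ ≡ x₁ ⊖ v ⊕ w → x₉ ≡ A₁ ⊕ + 2 ⊗ a₂ →
      + 2 ⊗ e₁ ≡ + 2 ⊗ A₁ ⊕ + 4 ⊗ a₂ ⊕ + 4 ⊗ b₁ ⊕ B₁ ⊖ + 4 ⊗ b₂ ⊖ B₁x ⊕ u ⊖ v →
      + 2 ⊗ x₁ ≡ + 2 ⊗ a₂ ⊕ + 4 ⊗ h₃ ⊕ + 4 ⊗ k₂ ⊕ b₁ ⊖ + 4 ⊗ k₃ ⊖ b₂ ⊕ v ⊖ w →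
      A₂ ≡ + 2 ⊗ A₁ ⊕ + 8 ⊗ a₂ → B₂ ≡ + 1 ⊗ B₁ ⊕ + 8 ⊗ b₁ → B₂x ≡ + 1 ⊗ B₁x ⊕ + 8 ⊗ b₂ →
      A₁ ≡ + 2 ⊗ a₁ ⊕ + 8 ⊗ h₂ → A₁x ≡ + 2 ⊗ a₂ ⊕ + 8 ⊗ h₃ →
      B₁ ≡ + 1 ⊗ b₀ ⊕ + 8 ⊗ k₁ → B₁x ≡ + 1 ⊗ b₁ ⊕ + 8 ⊗ k₂ → B₁xx ≡ + 1 ⊗ b₂ ⊕ + 8 ⊗ k₃ →
      + 2 ⊗ e ≡ + 2 ⊗ A₂ ⊕ + 4 ⊗ A₁x ⊕ + 4 ⊗ B₁x ⊕ B₂ ⊖ + 4 ⊗ B₁xx ⊖ B₂x ⊕ u ⊖ v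
    combine {e₁ = e₁} {x₁ = x₁} {u = u} {v} {w} {a₁} {a₂} {h₂} {h₃} {b₀} {b₁} {b₂} {k₁} {k₂} {k₃}
      refl refl refl refl p q refl refl refl refl refl refl refl refl =
      -- The equations `p` and `q` concern doubled unknowns, so the goal is first rewritten in terms
      -- of `+ 2 ⊗ e₁` and `+ 2 ⊗ x₁`.
      trans (double e₁ x₁ v w a₁ a₂ h₂) (trans (cong₂ (λ s t → s ⊕ + 8 ⊗ t ⊖ + 8 ⊗ v ⊕ + 8 ⊗ w
          ⊕ + 2 ⊗ (+ 2 ⊗ a₁ ⊕ + 8 ⊗ h₂ ⊕ + 2 ⊗ a₂)) p q)
        (ℤ-ring (u ∷ v ∷ w ∷ a₁ ∷ a₂ ∷ h₂ ∷ h₃ ∷ b₀ ∷ b₁ ∷ b₂ ∷ k₁ ∷ k₂ ∷ k₃ ∷ [])))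
      where
      double : ∀ e₁ x₁ v w a₁ a₂ h₂ → let x₈ = x₁ ⊖ v ⊕ w ; x₂ = x₁ ⊕ (x₁ ⊕ (x₈ ⊕ (x₈ ⊕ 0ℤ))) in
        + 2 ⊗ (e₁ ⊕ (x₂ ⊕ (x₂ ⊕ (+ 2 ⊗ a₁ ⊕ + 8 ⊗ h₂ ⊕ + 2 ⊗ a₂ ⊕ 0ℤ)))) ≡
        + 2 ⊗ e₁ ⊕ + 8 ⊗ (+ 2 ⊗ x₁) ⊖ + 8 ⊗ v ⊕ + 8 ⊗ w ⊕ + 2 ⊗ (+ 2 ⊗ a₁ ⊕ + 8 ⊗ h₂ ⊕ + 2 ⊗ a₂)
      double = ℤ-ring-∀

  -- Eliminating classes 0, 3 and 8 leaves E 5 (n + 2) = 4 x E 5 n + 4 x E 1 n - 2 x (1 - x) + 2 x E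
  -- 4 (n + 1). The constant cancels against the one in `closed₁`, and the homogeneous part is the
  -- recurrence for (0 , 4).
  closed₅ : ∀ n i → E 5 n i ≡ C n i ⊕ Ĉ n i ⊖ + 3 ⊗ (Ĉ n ↑ 1) i
    ⊕ + 6 ⊗ (Â n ↑ 2) i ⊕ + 6 ⊗ (B̂ n ↑ 1) i ⊖ + 6 ⊗ (B̂ n ↑ 2) i
  closed₅↑ : ∀ n i → (E 5 n ↑ 1) i ≡ (C n ↑ 1) i ⊕ (Ĉ n ↑ 1) i ⊖ + 3 ⊗ (Ĉ n ↑ 2) i
    ⊕ + 6 ⊗ (Â n ↑ 3) i ⊕ + 6 ⊗ (B̂ n ↑ 2) i ⊖ + 6 ⊗ (B̂ n ↑ 3) i
  closed₅↑ n zero    = refl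
  closed₅↑ n (suc i) = closed₅ n i
  closed₅ zero          zero                = refl
  closed₅ zero          (suc zero)          = refl
  closed₅ zero          (suc (suc i))       = refl
  closed₅ (suc zero)    zero                = refl
  closed₅ (suc zero)    (suc zero)          = refl
  closed₅ (suc zero)    (suc (suc zero))    = refl
  closed₅ (suc zero)    (suc (suc (suc i))) = refl
  closed₅ (suc (suc n)) i                   = combine
    {a₂ = (A n ↑ 2) i} {h₃ = (Â n ↑ 3) i} {b₁ = (B n ↑ 1) i} {b₂ = (B n ↑ 2) i} {k₂ = (B̂ n ↑ 2) i}
    {k₃ = (B̂ n ↑ 3) i} {c₀ = C n i} {c₁ = (C n ↑ 1) i} {d₁ = (Ĉ n ↑ 1) i} {d₂ = (Ĉ n ↑ 2) i}
    (E-suc 5 (suc n) i) (E-suc 0 n i) (E-suc↑ 3 n i) (closed₄↑ (suc n) i) (difference₁₈↑ n i) (closed₅↑ n i) (closed₁↑ n i)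
    (FC.step (suc n) i) (FC.step n i) (FC.step↑ n 1 i) (FA.step↑ n 2 i) (FB.step↑ n 1 i) (FB.step↑ n 2 i)
    where
    combine : ∀ {e e₀ x₃ x₄ x₈ x₅ x₁ C₂ C₁ C₁x A₁ B₁ B₁x u v a₂ h₃ b₁ b₂ k₂ k₃ c₀ c₁ d₁ d₂} →
      e ≡ e₀ ⊕ (x₃ ⊕ (x₄ ⊕ (x₄ ⊕ 0ℤ))) →
      e₀ ≡ x₁ ⊕ (x₁ ⊕ (x₅ ⊕ (x₅ ⊕ 0ℤ))) → x₃ ≡ x₅ ⊕ (x₅ ⊕ (x₈ ⊕ (x₈ ⊕ 0ℤ))) →
      x₄ ≡ A₁ ⊕ + 2 ⊗ a₂ ⊕ B₁ ⊕ b₁ ⊖ B₁x ⊖ b₂ → x₈ ≡ x₁ ⊖ u ⊕ v →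
      x₅ ≡ c₁ ⊕ d₁ ⊖ + 3 ⊗ d₂ ⊕ + 6 ⊗ h₃ ⊕ + 6 ⊗ k₂ ⊖ + 6 ⊗ k₃ →
      + 2 ⊗ x₁ ≡ + 2 ⊗ a₂ ⊕ + 4 ⊗ h₃ ⊕ + 4 ⊗ k₂ ⊕ b₁ ⊖ + 4 ⊗ k₃ ⊖ b₂ ⊕ u ⊖ v →
      C₂ ≡ + 0 ⊗ C₁ ⊕ + 4 ⊗ c₁ → C₁ ≡ + 0 ⊗ c₀ ⊕ + 4 ⊗ d₁ → C₁x ≡ + 0 ⊗ c₁ ⊕ + 4 ⊗ d₂ →
      A₁ ≡ + 2 ⊗ a₂ ⊕ + 8 ⊗ h₃ → B₁ ≡ + 1 ⊗ b₁ ⊕ + 8 ⊗ k₂ → B₁x ≡ + 1 ⊗ b₂ ⊕ + 8 ⊗ k₃ →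
      e ≡ C₂ ⊕ C₁ ⊖ + 3 ⊗ C₁x ⊕ + 6 ⊗ A₁ ⊕ + 6 ⊗ B₁ ⊖ + 6 ⊗ B₁x
    combine {x₁ = x₁} {u = u} {v} {a₂} {h₃} {b₁} {b₂} {k₂} {k₃} {c₀} {c₁} {d₁} {d₂}
      refl refl refl refl refl refl p refl refl refl refl refl refl =
      trans (double x₁ u v x₄ x₅) (trans (cong (λ s → + 2 ⊗ s ⊖ + 2 ⊗ u ⊕ + 2 ⊗ v ⊕ (+ 4 ⊗ x₅ ⊕ + 2 ⊗ x₄)) p)
        (finish u v a₂ h₃ b₁ b₂ k₂ k₃ c₀ c₁ d₁ d₂))
      where
      A₁ B₁ B₁x x₄ x₅ : ℤ
      A₁  = + 2 ⊗ a₂ ⊕ + 8 ⊗ h₃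
      B₁  = + 1 ⊗ b₁ ⊕ + 8 ⊗ k₂
      B₁x = + 1 ⊗ b₂ ⊕ + 8 ⊗ k₃
      x₄  = A₁ ⊕ + 2 ⊗ a₂ ⊕ B₁ ⊕ b₁ ⊖ B₁x ⊖ b₂
      x₅  = c₁ ⊕ d₁ ⊖ + 3 ⊗ d₂ ⊕ + 6 ⊗ h₃ ⊕ + 6 ⊗ k₂ ⊖ + 6 ⊗ k₃

      double : ∀ x₁ u v x₄ x₅ → let x₈ = x₁ ⊖ u ⊕ v in
        x₁ ⊕ (x₁ ⊕ (x₅ ⊕ (x₅ ⊕ 0ℤ))) ⊕ (x₅ ⊕ (x₅ ⊕ (x₈ ⊕ (x₈ ⊕ 0ℤ))) ⊕ (x₄ ⊕ (x₄ ⊕ 0ℤ))) ≡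
        + 2 ⊗ (+ 2 ⊗ x₁) ⊖ + 2 ⊗ u ⊕ + 2 ⊗ v ⊕ (+ 4 ⊗ x₅ ⊕ + 2 ⊗ x₄)
      double = ℤ-ring-∀

      finish : ∀ u v a₂ h₃ b₁ b₂ k₂ k₃ c₀ c₁ d₁ d₂ →
        let A₁  = + 2 ⊗ a₂ ⊕ + 8 ⊗ h₃
            B₁  = + 1 ⊗ b₁ ⊕ + 8 ⊗ k₂
            B₁x = + 1 ⊗ b₂ ⊕ + 8 ⊗ k₃
            C₁  = + 0 ⊗ c₀ ⊕ + 4 ⊗ d₁
        in + 2 ⊗ (+ 2 ⊗ a₂ ⊕ + 4 ⊗ h₃ ⊕ + 4 ⊗ k₂ ⊕ b₁ ⊖ + 4 ⊗ k₃ ⊖ b₂ ⊕ u ⊖ v) ⊖ + 2 ⊗ u ⊕ + 2 ⊗ v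
             ⊕ (+ 4 ⊗ (c₁ ⊕ d₁ ⊖ + 3 ⊗ d₂ ⊕ + 6 ⊗ h₃ ⊕ + 6 ⊗ k₂ ⊖ + 6 ⊗ k₃)
                ⊕ + 2 ⊗ (A₁ ⊕ + 2 ⊗ a₂ ⊕ B₁ ⊕ b₁ ⊖ B₁x ⊖ b₂)) ≡
           (+ 0 ⊗ C₁ ⊕ + 4 ⊗ c₁) ⊕ C₁ ⊖ + 3 ⊗ (+ 0 ⊗ c₁ ⊕ + 4 ⊗ d₂) ⊕ + 6 ⊗ A₁ ⊕ + 6 ⊗ B₁ ⊖ + 6 ⊗ B₁x
      finish = ℤ-ring-∀

  lucas : ℕ → ℕ → ℕ → ℤ
  lucas p = recurrent (+ p) (+ 8) (+ 2) (+ p)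

  -- In 2 x E 1 + 2 x E 5 the fundamental solutions S for (2 , 8) and (1 , 8) occur in the
  -- combination p S n + 16 x S (n - 1). This is the companion solution with initial values 2 and p,
  -- the source of the Lucas numbers.
  closed₀ : ∀ n i → E 0 (suc n) i ≡
    (lucas 2 (suc n) ↑ 2) i ⊕ (lucas 1 (suc n) ↑ 1) i ⊖ (lucas 1 (suc n) ↑ 2) i ⊕ (I ↑ 1) i ⊖ (I ↑ 2) i
    ⊕ + 2 ⊗ (C n ↑ 1) i ⊕ + 2 ⊗ (Ĉ n ↑ 1) i ⊖ + 6 ⊗ (Ĉ n ↑ 2) i
  closed₀ n i = combine {a₂ = (A n ↑ 2) i} {b₁ = (B n ↑ 1) i} {(B n ↑ 2) i} (E-suc 0 n i) (closed₁↑ n i) (closed₅↑ n i)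
    (lucas-fundamental 2 n 2 i) (lucas-fundamental 1 n 1 i) (lucas-fundamental 1 n 2 i)
    where
    lucas-fundamental : ∀ p n j i → let module F = Fundamental (+ p) (+ 8) in
      (lucas p (suc n) ↑ j) i ≡ + p ⊗ (F.S n ↑ j) i ⊕ + 16 ⊗ (delayed F.S n ↑ suc j) i
    lucas-fundamental p n (suc j) zero    = solve₁ (+ p)
      where
      solve₁ : ∀ p → 0ℤ ≡ p ⊗ 0ℤ ⊕ + 16 ⊗ 0ℤ
      solve₁ = ℤ-ring-∀
    lucas-fundamental p n (suc j) (suc i) = lucas-fundamental p n j i
    lucas-fundamental p zero zero zero    = solve₁ (+ p)
      where
      solve₁ : ∀ p → p ⊗ 1ℤ ≡ p ⊗ (1ℤ ⊗ 1ℤ) ⊕ + 16 ⊗ 0ℤ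
      solve₁ = ℤ-ring-∀
    lucas-fundamental p zero zero (suc i) = solve₁ (+ p)
      where
      solve₁ : ∀ p → p ⊗ 0ℤ ≡ p ⊗ (1ℤ ⊗ 0ℤ) ⊕ + 16 ⊗ 0ℤ
      solve₁ = ℤ-ring-∀
    lucas-fundamental p (suc zero) zero zero = solve₁ (+ p)
      where
      solve₁ : ∀ p → p ⊗ (p ⊗ 1ℤ) ⊕ + 8 ⊗ 0ℤ ≡ p ⊗ (p ⊗ 1ℤ) ⊕ + 16 ⊗ 0ℤ
      solve₁ = ℤ-ring-∀
    lucas-fundamental p (suc zero) zero (suc i) = solve₁ (+ p) (I (suc i)) (I i)
      where
      solve₁ : ∀ p u v → p ⊗ (p ⊗ u) ⊕ + 8 ⊗ (+ 2 ⊗ v) ≡ p ⊗ (p ⊗ u) ⊕ + 16 ⊗ (1ℤ ⊗ v)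
      solve₁ = ℤ-ring-∀
    lucas-fundamental p (suc (suc n)) zero i = solve₁ {+ p} {s₁ = F.S (suc n) i} {s₀x = (F.S n ↑ 1) i} {(delayed F.S n ↑ 2) i}
      (lucas-fundamental p (suc n) zero i) (lucas-fundamental p n 1 i) (F.step↑ (suc n) 0 i) (F.step↑ n 1 i)
      where
      module F = Fundamental (+ p) (+ 8)
      solve₁ : ∀ {p l₁ l₀ s₂ s₁ s₁x s₀x d₁} → l₁ ≡ p ⊗ s₁ ⊕ + 16 ⊗ s₀x → l₀ ≡ p ⊗ s₀x ⊕ + 16 ⊗ d₁ →
        s₂ ≡ p ⊗ s₁ ⊕ + 8 ⊗ s₀x → s₁x ≡ p ⊗ s₀x ⊕ + 8 ⊗ d₁ →
        p ⊗ l₁ ⊕ + 8 ⊗ l₀ ≡ p ⊗ s₂ ⊕ + 16 ⊗ s₁x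
      solve₁ {p} {s₁ = s₁} {s₀x = s₀x} {d₁} refl refl refl refl = ℤ-ring (p ∷ s₁ ∷ s₀x ∷ d₁ ∷ [])

    combine : ∀ {e x₁ x₅ V W Wx v w a₂ h₃ b₁ b₂ k₂ k₃ c₁ d₁ d₂} →
      e ≡ x₁ ⊕ (x₁ ⊕ (x₅ ⊕ (x₅ ⊕ 0ℤ))) →
      + 2 ⊗ x₁ ≡ + 2 ⊗ a₂ ⊕ + 4 ⊗ h₃ ⊕ + 4 ⊗ k₂ ⊕ b₁ ⊖ + 4 ⊗ k₃ ⊖ b₂ ⊕ v ⊖ w →
      x₅ ≡ c₁ ⊕ d₁ ⊖ + 3 ⊗ d₂ ⊕ + 6 ⊗ h₃ ⊕ + 6 ⊗ k₂ ⊖ + 6 ⊗ k₃ →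
      V ≡ + 2 ⊗ a₂ ⊕ + 16 ⊗ h₃ → W ≡ + 1 ⊗ b₁ ⊕ + 16 ⊗ k₂ → Wx ≡ + 1 ⊗ b₂ ⊕ + 16 ⊗ k₃ →
      e ≡ V ⊕ W ⊖ Wx ⊕ v ⊖ w ⊕ + 2 ⊗ c₁ ⊕ + 2 ⊗ d₁ ⊖ + 6 ⊗ d₂
    combine {x₁ = x₁} {v = v} {w} {a₂} {h₃} {b₁} {b₂} {k₂} {k₃} {c₁} {d₁} {d₂} refl p refl refl refl refl =
      trans (double x₁ x₅) (trans (cong (_⊕ + 2 ⊗ x₅) p)
        (finish v w a₂ h₃ b₁ b₂ k₂ k₃ c₁ d₁ d₂))
      where
      x₅ = c₁ ⊕ d₁ ⊖ + 3 ⊗ d₂ ⊕ + 6 ⊗ h₃ ⊕ + 6 ⊗ k₂ ⊖ + 6 ⊗ k₃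

      double : ∀ x₁ x₅ → x₁ ⊕ (x₁ ⊕ (x₅ ⊕ (x₅ ⊕ 0ℤ))) ≡ + 2 ⊗ x₁ ⊕ + 2 ⊗ x₅
      double = ℤ-ring-∀

      finish : ∀ v w a₂ h₃ b₁ b₂ k₂ k₃ c₁ d₁ d₂ →
        + 2 ⊗ a₂ ⊕ + 4 ⊗ h₃ ⊕ + 4 ⊗ k₂ ⊕ b₁ ⊖ + 4 ⊗ k₃ ⊖ b₂ ⊕ v ⊖ w
          ⊕ + 2 ⊗ (c₁ ⊕ d₁ ⊖ + 3 ⊗ d₂ ⊕ + 6 ⊗ h₃ ⊕ + 6 ⊗ k₂ ⊖ + 6 ⊗ k₃) ≡
        (+ 2 ⊗ a₂ ⊕ + 16 ⊗ h₃) ⊕ (+ 1 ⊗ b₁ ⊕ + 16 ⊗ k₂) ⊖ (+ 1 ⊗ b₂ ⊕ + 16 ⊗ k₃)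
          ⊕ v ⊖ w ⊕ + 2 ⊗ c₁ ⊕ + 2 ⊗ d₁ ⊖ + 6 ⊗ d₂
      finish = ℤ-ring-∀


-- The genus distribution in terms of Lucas numbers

module Formula where

  open Census
  open ClosedForm
  open import Data.Integer using (ℤ; +_; 0ℤ; 1ℤ) renaming (_+_ to _⊕_; _*_ to _⊗_; _-_ to _⊖_)
  import Data.Integer.Properties as ℤ
  open import Data.Integer.Tactic.RingSolver using () renaming (solve-∀ to ℤ-ring-∀)
  open import Data.Nat using (ℕ; zero; suc; _+_; _*_; _^_; _≤_; _<_; s≤s; s<s)
  open import Data.Nat.Properties using (+-suc; +-comm; +-identityʳ; *-identityˡ; ^-zeroˡ; ≤-refl; ≤-trans; m<n⇒m<1+n; ≤-reflexive; +-cancelʳ-≡; m≤n⇒m≤1+n; m≤n⇒m<n∨m≡n)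
  open import Data.Nat.Tactic.RingSolver using () renaming (solve-∀ to ℕ-ring-∀)
  open import Data.Product using (_×_; _,_; ∃)
  open import Data.Sum using (_⊎_; inj₁; inj₂)
  open import Relation.Binary.PropositionalEquality hiding ([_])

  -- The coefficients of the Lucas polynomials: L k d is the coefficient of xᵏ in
  -- the polynomial of index 2 k + d.
  L : ℕ → ℕ → ℕ
  L zero    zero    = 2
  L zero    (suc d) = 1
  L (suc k) zero    = 2
  L (suc k) (suc d) = L (suc k) d + L k (suc d)

  B : ℕ → ℕ → ℕ
  B k d = 8 ^ k * L k d

  recurrent-vanish : ∀ p q u v n k → n < k * 2 → recurrent p q u v n k ≡ + 0
  recurrent-vanish p q u v zero          (suc k) _               = ℤ.*-zeroʳ u
  recurrent-vanish p q u v (suc zero)    (suc k) _               = ℤ.*-zeroʳ v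
  recurrent-vanish p q u v (suc (suc n)) (suc k) (s<s (s<s n<)) =
    trans (cong₂ (λ s t → p ⊗ s ⊕ q ⊗ t) (recurrent-vanish p q u v (suc n) (suc k) (s<s (m<n⇒m<1+n n<)))
                                         (recurrent-vanish p q u v n k n<))
          (vanish p q)
    where
    vanish : ∀ p q → p ⊗ + 0 ⊕ q ⊗ + 0 ≡ + 0
    vanish = ℤ-ring-∀

  lucas-vanish : ∀ p n k → n < k * 2 → lucas p n k ≡ + 0
  lucas-vanish p = recurrent-vanish (+ p) (+ 8) (+ 2) (+ p)

  -- At index 2 k + d the coefficient of xᵏ collects 8 from each of k double steps and p from each
  -- of d single steps. So p enters through p ^ d alone, and the same `B` serves both Lucas
  -- sequences.
  lucas-value : ∀ p k d → lucas p (k * 2 + d) k ≡ + (p ^ d * B k d)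
  lucas-value p zero    zero          = refl
  lucas-value p zero    (suc zero)    = trans (ℤ.*-identityʳ (+ p)) (cong +_ (unit p))
    where
    unit : ∀ p → p ≡ p * 1 * 1
    unit = ℕ-ring-∀
  lucas-value p zero    (suc (suc d)) = begin
    + p ⊗ lucas p (suc d) 0 ⊕ + 8 ⊗ 0ℤ  ≡⟨ cong (λ s → + p ⊗ s ⊕ + 8 ⊗ 0ℤ) (lucas-value p 0 (suc d)) ⟩
    + p ⊗ + (p ^ suc d * 1) ⊕ + 8 ⊗ 0ℤ  ≡⟨ ℤ.+-identityʳ _ ⟩
    + p ⊗ + (p ^ suc d * 1)             ≡⟨ ℤ.pos-* p _ ⟨
    + (p * (p ^ suc d * 1))             ≡⟨ cong +_ (assoc p (p ^ suc d)) ⟩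
    + (p ^ suc (suc d) * 1)             ∎
    where
    open ≡-Reasoning
    assoc : ∀ p q → p * (q * 1) ≡ p * q * 1
    assoc = ℕ-ring-∀
  lucas-value p (suc k) zero          = begin
    + p ⊗ lucas p (suc (k * 2 + 0)) (suc k) ⊕ + 8 ⊗ lucas p (k * 2 + 0) k
      ≡⟨ cong₂ (λ s t → + p ⊗ s ⊕ + 8 ⊗ t) (lucas-vanish p (suc (k * 2 + 0)) (suc k) (s<s (s≤s (≤-reflexive (+-identityʳ (k * 2))))))
                                           (lucas-value p k 0) ⟩
    + p ⊗ + 0 ⊕ + 8 ⊗ + (1 * B k 0)  ≡⟨ cong₂ _⊕_ (ℤ.*-zeroʳ (+ p)) (sym (ℤ.pos-* 8 (1 * B k 0))) ⟩
    + (8 * (1 * (8 ^ k * L k 0)))    ≡⟨ cong (λ l → + (8 * (1 * (8 ^ k * l)))) (double k) ⟩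
    + (8 * (1 * (8 ^ k * 2)))        ≡⟨ cong +_ (assoc (8 ^ k)) ⟩
    + (1 * B (suc k) 0)              ∎
    where
    open ≡-Reasoning
    double : ∀ k → L k 0 ≡ 2
    double zero    = refl
    double (suc k) = refl
    assoc : ∀ e → 8 * (1 * (e * 2)) ≡ 1 * (8 * e * 2)
    assoc = ℕ-ring-∀
  lucas-value p (suc k) (suc d)       = begin
    + p ⊗ lucas p (suc (k * 2 + suc d)) (suc k) ⊕ + 8 ⊗ lucas p (k * 2 + suc d) k
      ≡⟨ cong₂ (λ s t → + p ⊗ s ⊕ + 8 ⊗ t)
           (trans (cong (λ n → lucas p (suc n) (suc k)) (+-suc (k * 2) d)) (lucas-value p (suc k) d))
           (lucas-value p k (suc d)) ⟩
    + p ⊗ + (p ^ d * B (suc k) d) ⊕ + 8 ⊗ + (p ^ suc d * B k (suc d))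
      ≡⟨ cong₂ _⊕_ (ℤ.pos-* p (p ^ d * B (suc k) d)) (ℤ.pos-* 8 (p ^ suc d * B k (suc d))) ⟨
    + (p * (p ^ d * B (suc k) d) + 8 * (p ^ suc d * B k (suc d)))
      ≡⟨ cong +_ (collect p (p ^ d) (8 ^ k) (L (suc k) d) (L k (suc d))) ⟩
    + (p ^ suc d * B (suc k) (suc d)) ∎
    where
    open ≡-Reasoning
    collect : ∀ p q e l m → p * (q * (8 * e * l)) + 8 * (p * q * (e * m)) ≡ p * q * (8 * e * (l + m))
    collect = ℕ-ring-∀

  -- The coefficients of the sequence for (p , q) = (0 , 4), indexed like L.
  spike : ℕ → ℕ → ℕ
  spike zero    k = 4 ^ k
  spike (suc _) k = 0

  spikes : ℕ → ℕ → ℤ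
  spikes = recurrent (+ 0) (+ 4) (+ 1) (+ 0)

  spikes-vanish : ∀ n k → n < k * 2 → spikes n k ≡ + 0
  spikes-vanish = recurrent-vanish (+ 0) (+ 4) (+ 1) (+ 0)

  spikes-value : ∀ k d → spikes (k * 2 + d) k ≡ + spike d k
  spikes-value zero    zero          = refl
  spikes-value zero    (suc zero)    = refl
  spikes-value zero    (suc (suc d)) = refl
  spikes-value (suc k) d             = trans (cong (λ s → + 0 ⊗ spikes (suc (k * 2 + d)) (suc k) ⊕ + 4 ⊗ s) (spikes-value k d))
    (trans (ℤ.+-identityˡ _) (trans (sym (ℤ.pos-* 4 (spike d k))) (cong +_ (four d))))
    where
    four : ∀ d → 4 * spike d k ≡ spike d (suc k)
    four zero    = refl
    four (suc d) = refl

  ι : ℕ → ℕ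
  ι zero    = 1
  ι (suc _) = 0

  -- All negative terms stand on the left, which keeps the identity within ℕ. `ι` comes from the
  -- term - x² of `closed₀`.
  g₁₁-value : ∀ n k {v w w′ c₁ c₂ c₃} →
    lucas 2 (suc n) k ≡ + v → lucas 1 (suc n) (suc k) ≡ + w → lucas 1 (suc n) k ≡ + w′ →
    spikes n (suc k) ≡ + c₁ → delayed spikes n (suc k) ≡ + c₂ → delayed spikes n k ≡ + c₃ →
    g₁₁ (suc n) (2 + k) + (w′ + ι k + 6 * c₃) ≡ v + w + 2 * (c₁ + c₂)
  g₁₁-value n k {v} {w} {w′} {c₁} {c₂} {c₃} V W W′ C₁ C₂ C₃ = ℤ.+-injective (begin
    + (g + (w′ + ι k + 6 * c₃))
      ≡⟨ trans (ℤ.pos-+ g _) (cong (+ g ⊕_) (trans (ℤ.pos-+ (w′ + ι k) (6 * c₃))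
           (cong₂ _⊕_ (ℤ.pos-+ w′ (ι k)) (ℤ.pos-* 6 c₃)))) ⟩
    + g ⊕ (+ w′ ⊕ + ι k ⊕ + 6 ⊗ + c₃)
      ≡⟨ cong (λ s → s ⊕ (+ w′ ⊕ + ι k ⊕ + 6 ⊗ + c₃)) expand ⟩
    (+ v ⊕ + w ⊖ + w′ ⊕ + 0 ⊖ + ι k ⊕ + 2 ⊗ + c₁ ⊕ + 2 ⊗ + c₂ ⊖ + 6 ⊗ + c₃) ⊕ (+ w′ ⊕ + ι k ⊕ + 6 ⊗ + c₃)
      ≡⟨ cancel (+ v) (+ w) (+ w′) (+ ι k) (+ c₁) (+ c₂) (+ c₃) ⟩
    + v ⊕ + w ⊕ + 2 ⊗ (+ c₁ ⊕ + c₂)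
      ≡⟨ trans (ℤ.pos-+ (v + w) _) (cong₂ _⊕_ (ℤ.pos-+ v w) (trans (ℤ.pos-* 2 (c₁ + c₂)) (cong (+ 2 ⊗_) (ℤ.pos-+ c₁ c₂)))) ⟨
    + (v + w + 2 * (c₁ + c₂)) ∎)
    where
    open ≡-Reasoning
    g = g₁₁ (suc n) (2 + k)

    pos-ι : ∀ k → I k ≡ + ι k
    pos-ι zero    = refl
    pos-ι (suc k) = refl

    expand : + g ≡ + v ⊕ + w ⊖ + w′ ⊕ + 0 ⊖ + ι k ⊕ + 2 ⊗ + c₁ ⊕ + 2 ⊗ + c₂ ⊖ + 6 ⊗ + c₃
    expand = trans (cong +_ (g₁₁≡census (suc n) (2 + k))) (trans (closed₀ n (2 + k))
      (cong₂ _⊖_ (cong₂ _⊕_ (cong₂ _⊕_ (cong₂ _⊖_ (cong₂ _⊕_ (cong₂ _⊖_ (cong₂ _⊕_ V W) W′) refl) (pos-ι k))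
         (cong (+ 2 ⊗_) C₁)) (cong (+ 2 ⊗_) C₂)) (cong (+ 6 ⊗_) C₃)))

    cancel : ∀ v w w′ u c₁ c₂ c₃ →
      (v ⊕ w ⊖ w′ ⊕ + 0 ⊖ u ⊕ + 2 ⊗ c₁ ⊕ + 2 ⊗ c₂ ⊖ + 6 ⊗ c₃) ⊕ (w′ ⊕ u ⊕ + 6 ⊗ c₃) ≡ v ⊕ w ⊕ + 2 ⊗ (c₁ ⊕ c₂)
    cancel = ℤ-ring-∀

  lucas₁-value : ∀ k d → lucas 1 (k * 2 + d) k ≡ + B k d
  lucas₁-value k d = trans (lucas-value 1 k d)
    (cong +_ (trans (cong (_* B k d) (^-zeroˡ d)) (*-identityˡ (B k d))))

  -- `spikes` is also needed at coefficient k + 1. There the indices 2 k + d + 1 and 2 k + d leave d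
  -- - 1 and d - 2 single steps; the value is 0 when that is negative.
  spike₁ spike₂ : ℕ → ℕ → ℕ
  spike₁ zero    k = 0
  spike₁ (suc d) k = spike d (suc k)
  spike₂ zero    k = 0
  spike₂ (suc d) k = spike₁ d k

  -- With d = n - 2 (k + 1), both (k , 2 + d) and (k + 1 , d) belong to index n, so every Lucas term
  -- is expressed through `B` at the same n.
  g₁₁-formula : ∀ k d → g₁₁ (suc k * 2 + d) (2 + k) + (B k (2 + d) + ι k + 6 * spike d k) ≡
                2 ^ (2 + d) * B k (2 + d) + B (suc k) d + 2 * (spike₁ d k + spike₂ d k)
  g₁₁-formula k d = g₁₁-value (suc (k * 2 + d)) k
    (trans (cong (λ n → lucas 2 n k) index) (lucas-value 2 k (2 + d)))
    (lucas₁-value (suc k) d)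
    (trans (cong (λ n → lucas 1 n k) index) (lucas₁-value k (2 + d)))
    (first d) (second d) (spikes-value k d)
    where
    index : suc (suc (k * 2 + d)) ≡ k * 2 + (2 + d)
    index = sym (trans (+-suc (k * 2) (suc d)) (cong suc (+-suc (k * 2) d)))

    first : ∀ d → spikes (suc (k * 2 + d)) (suc k) ≡ + spike₁ d k
    first zero    = spikes-vanish (suc (k * 2 + 0)) (suc k) (s<s (s≤s (≤-reflexive (+-identityʳ (k * 2)))))
    first (suc d) = trans (cong (λ n → spikes (suc n) (suc k)) (+-suc (k * 2) d)) (spikes-value (suc k) d)

    second : ∀ d → spikes (k * 2 + d) (suc k) ≡ + spike₂ d k
    second zero    = spikes-vanish (k * 2 + 0) (suc k) (s≤s (m≤n⇒m≤1+n (≤-reflexive (+-identityʳ (k * 2)))))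
    second (suc d) = trans (cong (λ n → spikes n (suc k)) (+-suc (k * 2) d)) (first d)

  -- The top genus for odd n, where `g₁₁-formula` would need d = -1. What remains is 2 B - B.
  g₁₁-last : ∀ k → g₁₁ (suc (suc k * 2)) (3 + k) ≡ B (suc k) 1
  g₁₁-last k = +-cancelʳ-≡ (1 ^ 1 * B (suc k) 1 + 0 + 0) _ _ (trans (g₁₁-value (suc k * 2) (suc k)
    (at 2) (lucas-vanish 1 (suc (suc k * 2)) (2 + k) ≤-refl)
    (at 1)
    (spikes-vanish (suc k * 2) (2 + k) (m≤n⇒m≤1+n ≤-refl))
    (spikes-vanish (suc (k * 2)) (2 + k) (m≤n⇒m≤1+n (m≤n⇒m≤1+n ≤-refl)))
    (spikes-vanish (suc (k * 2)) (1 + k) ≤-refl))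
    (collect (B (suc k) 1)))
    where
    at : ∀ p → lucas p (suc (suc k * 2)) (suc k) ≡ + (p ^ 1 * B (suc k) 1)
    at p = trans (cong (λ n → lucas p n (suc k)) (+-comm 1 (suc k * 2))) (lucas-value p (suc k) 1)

    collect : ∀ e → 2 ^ 1 * e + 0 + 2 * (0 + 0) ≡ e + (1 ^ 1 * e + 0 + 0)
    collect = ℕ-ring-∀

  -- Below index 2 k all coefficients vanish. At index 2 k the leading coefficients of the two Lucas
  -- sequences agree, since p ^ 0 = 1, and cancel.
  g₁₁-vanish : ∀ n k → suc n ≤ k * 2 → g₁₁ (suc n) (2 + k) ≡ 0
  g₁₁-vanish n (suc k) n<2k = vanish (leading (m≤n⇒m<n∨m≡n n<2k))
    where
    earlier : ∀ n k → n < k * 2 → delayed spikes n k ≡ + 0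
    earlier zero    k _  = refl
    earlier (suc n) k n< = spikes-vanish n k (≤-trans (m≤n⇒m≤1+n ≤-refl) n<)

    Leading : ℕ → Set
    Leading e = lucas 2 (suc n) (suc k) ≡ + e × lucas 1 (suc n) (suc k) ≡ + e

    leading : suc n < suc k * 2 ⊎ suc n ≡ suc k * 2 → ∃ Leading
    leading (inj₁ n<) = 0 , lucas-vanish 2 (suc n) (suc k) n< , lucas-vanish 1 (suc n) (suc k) n<
    leading (inj₂ n≡) = B (suc k) 0
      , trans (cong (λ n → lucas 2 n (suc k)) n≡′) (trans (lucas-value 2 (suc k) 0) (cong +_ (*-identityˡ (B (suc k) 0))))
      , trans (cong (λ n → lucas 1 n (suc k)) n≡′) (lucas₁-value (suc k) 0)
      where
      n≡′ : suc n ≡ suc k * 2 + 0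
      n≡′ = trans n≡ (sym (+-identityʳ (suc k * 2)))

    vanish : ∃ Leading → g₁₁ (suc n) (3 + k) ≡ 0
    vanish (e , l₂ , l₁) = +-cancelʳ-≡ (e + 0 + 0) _ _ (trans (g₁₁-value n (suc k)
      l₂ (lucas-vanish 1 (suc n) (2 + k) (s≤s (m≤n⇒m≤1+n n<2k))) l₁
      (spikes-vanish n (2 + k) (m≤n⇒m≤1+n (m≤n⇒m≤1+n n<2k)))
      (earlier n (2 + k) (m≤n⇒m≤1+n (m≤n⇒m≤1+n n<2k))) (earlier n (1 + k) n<2k)) (collect e))
      where
      collect : ∀ e → e + 0 + 2 * (0 + 0) ≡ 0 + (e + 0 + 0)
      collect = ℕ-ring-∀

  g₁₁-zero : ∀ n → g₁₁ (suc n) 0 ≡ 0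
  g₁₁-zero n = ℤ.+-injective (trans (cong +_ (g₁₁≡census (suc n) 0)) (closed₀ n 0))

  g₁₁-one : ∀ n → g₁₁ (3 + n) 1 ≡ 2
  g₁₁-one n = ℤ.+-injective (trans (cong +_ (g₁₁≡census (3 + n) 1)) (trans (closed₀ (2 + n) 1)
    (cong₂ (λ l (c₁ , c₂) → 0ℤ ⊕ l ⊖ 0ℤ ⊕ 1ℤ ⊖ 0ℤ ⊕ + 2 ⊗ c₁ ⊕ + 2 ⊗ c₂ ⊖ + 6 ⊗ 0ℤ)
      (lucas₁-value 0 (3 + n)) (cong₂ _,_ (spikes-value 0 (2 + n)) (spikes-value 0 (1 + n))))))


-- Quotients of consecutive coefficients, and monotonicity for large n

module Growth where

  open Formula
  open import Data.Nat using (zero; suc; _+_; _*_; _^_; _!; _≤_; _<_; z≤n; s≤s; NonZero; _∸_)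
  open import Data.Nat.Properties
  open import Data.Nat.Tactic.RingSolver using () renaming (solve-∀ to ℕ-ring-∀)
  open import Data.Product using (_,_)
  open import Relation.Binary.PropositionalEquality hiding ([_])

  -- The formula n / (n - k) C(n - k, k) with n = 2 k + d and n - k = m + 1, cleared of
  -- denominators.
  L-factorial : ∀ k d m → k + d ≡ suc m → L k d * (k ! * d !) ≡ (k + k + d) * m !
  L-factorial zero    (suc d) .d refl = unit (suc d) (d !)
    where
    unit : ∀ s f → 1 * (1 * (s * f)) ≡ (0 + 0 + s) * f
    unit = ℕ-ring-∀
  L-factorial (suc k) zero    m  refl rewrite +-identityʳ k = double k (k !)
    where
    double : ∀ k f → 2 * ((1 + k) * f * 1) ≡ ((1 + k) + (1 + k) + 0) * f
    double = ℕ-ring-∀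
  L-factorial (suc k) (suc d) m  refl rewrite +-suc k d =
    trans (split k d (L (suc k) d) (L k (suc d)) (k !) (d !))
      (trans (cong₂ (λ s t → suc d * s + suc k * t) (L-factorial (suc k) d (k + d) refl) (L-factorial k (suc d) (k + d) (+-suc k d)))
        (join k d ((k + d) !)))
    where
    split : ∀ k d l l′ e f → (l + l′) * ((1 + k) * e * ((1 + d) * f)) ≡
            (1 + d) * (l * ((1 + k) * e * f)) + (1 + k) * (l′ * (e * ((1 + d) * f)))
    split = ℕ-ring-∀
    join : ∀ k d f → (1 + d) * (((1 + k) + (1 + k) + d) * f) + (1 + k) * ((k + k + (1 + d)) * f) ≡
           ((1 + k) + (1 + k) + (1 + d)) * ((1 + (k + d)) * f)
    join = ℕ-ring-∀

  L-ratio : ∀ k d → (suc k * (k + suc d)) * L (suc k) d ≡ (2 + d) * (1 + d) * L k (2 + d)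
  L-ratio k d = *-cancelʳ-≡ _ _ (k ! * d !) {{m*n≢0 (k !) (d !) {{k !≢0}} {{d !≢0}}}} (begin
    (suc k * (k + suc d)) * L (suc k) d * (k ! * d !)
      ≡⟨ left k d (L (suc k) d) (k !) (d !) ⟩
    suc (k + d) * (L (suc k) d * (suc k ! * d !))
      ≡⟨ cong (suc (k + d) *_) (L-factorial (suc k) d (k + d) refl) ⟩
    suc (k + d) * ((suc k + suc k + d) * (k + d) !)
      ≡⟨ middle k d ((k + d) !) ⟩
    (k + k + (2 + d)) * suc (k + d) !
      ≡⟨ L-factorial k (2 + d) (suc (k + d)) (trans (+-suc k (suc d)) (cong suc (+-suc k d))) ⟨
    L k (2 + d) * (k ! * (2 + d) !)
      ≡⟨ right d (L k (2 + d)) (k !) (d !) ⟩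
    (2 + d) * (1 + d) * L k (2 + d) * (k ! * d !) ∎)
    where
    open ≡-Reasoning
    left : ∀ k d l e f → ((1 + k) * (k + (1 + d))) * l * (e * f) ≡ (1 + (k + d)) * (l * ((1 + k) * e * f))
    left = ℕ-ring-∀
    middle : ∀ k d f → (1 + (k + d)) * (((1 + k) + (1 + k) + d) * f) ≡ (k + k + (2 + d)) * ((1 + (k + d)) * f)
    middle = ℕ-ring-∀
    right : ∀ d l e f → l * (e * ((2 + d) * ((1 + d) * f))) ≡ (2 + d) * (1 + d) * l * (e * f)
    right = ℕ-ring-∀

  -- The source of the growth estimates: for fixed n the quotient b (k + 1) / b k is 8 (d + 2) (d +
  -- 1) / ((k + 1) (k + 1 + d)), which equals 4 at d = k - 1, that is, at n = 3 k + 1.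
  B-ratio : ∀ k d → (suc k * (k + suc d)) * B (suc k) d ≡ (8 * ((2 + d) * (1 + d))) * B k (2 + d)
  B-ratio k d = trans (left (suc k * (k + suc d)) (8 ^ k) (L (suc k) d))
    (trans (cong (8 * 8 ^ k *_) (L-ratio k d)) (right ((2 + d) * (1 + d)) (8 ^ k) (L k (2 + d))))
    where
    left : ∀ r e l → r * (8 * e * l) ≡ 8 * e * (r * l)
    left = ℕ-ring-∀
    right : ∀ r e l → 8 * e * (r * l) ≡ 8 * r * (e * l)
    right = ℕ-ring-∀

  rise-by : ∀ m k d → m * (suc k * (k + suc d)) ≤ 8 * ((2 + d) * (1 + d)) → m * B k (2 + d) ≤ B (suc k) d
  rise-by m k d le = *-cancelˡ-≤ (suc k * (k + suc d)) {{nz}} (begin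
    (suc k * (k + suc d)) * (m * B k (2 + d))   ≡⟨ swap (suc k * (k + suc d)) m (B k (2 + d)) ⟩
    m * (suc k * (k + suc d)) * B k (2 + d)     ≤⟨ *-monoˡ-≤ (B k (2 + d)) le ⟩
    8 * ((2 + d) * (1 + d)) * B k (2 + d)       ≡⟨ B-ratio k d ⟨
    (suc k * (k + suc d)) * B (suc k) d         ∎)
    where
    open ≤-Reasoning
    nz : NonZero (suc k * (k + suc d))
    nz rewrite +-suc k d = _
    swap : ∀ r m e → r * (m * e) ≡ m * r * e
    swap = ℕ-ring-∀

  fall-by : ∀ m p k d → p * (8 * ((2 + d) * (1 + d))) ≤ m * (suc k * (k + suc d)) →
            p * B (suc k) d ≤ m * B k (2 + d)
  fall-by m p k d le = *-cancelˡ-≤ (suc k * (k + suc d)) {{nz}} (begin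
    (suc k * (k + suc d)) * (p * B (suc k) d)     ≡⟨ swap (suc k * (k + suc d)) p (B (suc k) d) ⟩
    p * ((suc k * (k + suc d)) * B (suc k) d)     ≡⟨ cong (p *_) (B-ratio k d) ⟩
    p * (8 * ((2 + d) * (1 + d)) * B k (2 + d))   ≡⟨ *-assoc p _ _ ⟨
    p * (8 * ((2 + d) * (1 + d))) * B k (2 + d)   ≤⟨ *-monoˡ-≤ (B k (2 + d)) le ⟩
    m * (suc k * (k + suc d)) * B k (2 + d)       ≡⟨ swap′ m (suc k * (k + suc d)) (B k (2 + d)) ⟩
    (suc k * (k + suc d)) * (m * B k (2 + d))     ∎)
    where
    open ≤-Reasoning
    nz : NonZero (suc k * (k + suc d))
    nz rewrite +-suc k d = _
    swap : ∀ r m e → r * (m * e) ≡ m * (r * e)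
    swap = ℕ-ring-∀
    swap′ : ∀ m r e → m * r * e ≡ r * (m * e)
    swap′ = ℕ-ring-∀

  L-positive : ∀ k d → 1 ≤ L k d
  L-positive zero    zero    = s≤s z≤n
  L-positive zero    (suc d) = s≤s z≤n
  L-positive (suc k) zero    = s≤s z≤n
  L-positive (suc k) (suc d) = ≤-trans (L-positive (suc k) d) (m≤m+n _ _)

  8^≤B : ∀ k d → 8 ^ k ≤ B k d
  8^≤B k d = ≤-trans (≤-reflexive (sym (*-identityʳ (8 ^ k)))) (*-monoʳ-≤ (8 ^ k) (L-positive k d))

  1≤B : ∀ k d → 1 ≤ B k d
  1≤B k d = ≤-trans (m^n>0 8 k) (8^≤B k d)

  next-index : ∀ k d → suc k * 2 + (2 + d) ≡ suc (suc k) * 2 + d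
  next-index k d = trans (+-suc (suc k * 2) (suc d)) (cong suc (+-suc (suc k * 2) d))

  formula : ∀ {k} d → 1 ≤ k → g₁₁ (suc k * 2 + d) (2 + k) + (B k (2 + d) + 6 * spike d k) ≡
            2 ^ (2 + d) * B k (2 + d) + B (suc k) d + 2 * (spike₁ d k + spike₂ d k)
  formula {suc k} d _ = trans (cong (λ b → g₁₁ (suc (suc k) * 2 + d) (3 + k) + (b + 6 * spike d (suc k)))
    (sym (+-identityʳ (B (suc k) (2 + d))))) (g₁₁-formula (suc k) d)

  formula-next : ∀ k d → g₁₁ (suc k * 2 + (2 + d)) (3 + k) + (B (suc k) (2 + d) + 6 * spike d (suc k)) ≡
                 2 ^ (2 + d) * B (suc k) (2 + d) + B (2 + k) d + 2 * (spike₁ d (suc k) + spike₂ d (suc k))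
  formula-next k d = trans (cong (λ n → g₁₁ n (3 + k) + (B (suc k) (2 + d) + 6 * spike d (suc k))) (next-index k d))
    (formula d (s≤s z≤n))

  -- At a tie 4 b₀ = b₁ the first terms drop out and b₂ - 2 b₁ + b₀ decides. The bound 2 b₁ ≤ b₂
  -- settles its sign, and 1 ≤ b₀ makes it strict.
  ascent-arith : ∀ g₀ g₁ b₀ b₁ b₂ i u → 1 ≤ b₀ → 4 * b₀ ≤ b₁ → 2 * b₁ ≤ b₂ →
    g₀ + (b₀ + i + 0) ≡ 2 * (2 * u) * b₀ + b₁ + 0 → g₁ + (b₁ + 0) ≡ u * b₁ + b₂ + 0 → g₀ < g₁
  ascent-arith g₀ g₁ b₀ b₁ b₂ i u 1≤b₀ b₀≤b₁ b₁≤b₂ e₀ e₁ = +-cancelʳ-< b₁ g₀ g₁ (begin-strict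
    g₀ + b₁                       <⟨ m<m+n (g₀ + b₁) 1≤b₀ ⟩
    g₀ + b₁ + b₀                  ≤⟨ m≤m+n _ i ⟩
    g₀ + b₁ + b₀ + i              ≡⟨ gather g₀ b₀ b₁ i ⟩
    g₀ + (b₀ + i + 0) + b₁        ≡⟨ cong (_+ b₁) e₀ ⟩
    2 * (2 * u) * b₀ + b₁ + 0 + b₁  ≡⟨ factor u b₀ b₁ ⟩
    u * (4 * b₀) + 2 * b₁         ≤⟨ +-mono-≤ (*-monoʳ-≤ u b₀≤b₁) b₁≤b₂ ⟩
    u * b₁ + b₂                   ≡⟨ +-identityʳ _ ⟨
    u * b₁ + b₂ + 0               ≡⟨ e₁ ⟨
    g₁ + (b₁ + 0)                 ≡⟨ cong (g₁ +_) (+-identityʳ b₁) ⟩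
    g₁ + b₁                       ∎)
    where
    open ≤-Reasoning
    gather : ∀ g x y i → g + y + x + i ≡ g + (x + i + 0) + y
    gather = ℕ-ring-∀
    factor : ∀ u x y → 2 * (2 * u) * x + y + 0 + y ≡ u * (4 * x) + 2 * y
    factor = ℕ-ring-∀

  -- The hypothesis says 3 k + 1 ≤ n, and both quotients are estimated at its extreme k = 7 + e,
  -- where the first estimate is an equality. The second starts at 6: for d = 5 and k = 6, the tie
  -- at n = 19, b (k + 2) is still below 2 b (k + 1).
  ascent-step : ∀ k e → k ≤ 7 + e →
                g₁₁ (suc k * 2 + (6 + e)) (2 + k) < g₁₁ (suc k * 2 + (6 + e)) (3 + k)
  ascent-step k e k≤ = ascent-arith _ _ (B k (8 + e)) (B (suc k) (6 + e)) (B (2 + k) (4 + e)) (ι k) (2 ^ (6 + e))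
    (1≤B k (8 + e))
    (rise-by 4 k (6 + e) (begin
      4 * (suc k * (k + (7 + e)))              ≤⟨ *-monoʳ-≤ 4 (*-mono-≤ (s≤s k≤) (+-monoˡ-≤ (7 + e) k≤)) ⟩
      4 * ((8 + e) * ((7 + e) + (7 + e)))      ≡⟨ double e ⟩
      8 * ((8 + e) * (7 + e))                  ∎))
    (rise-by 2 (suc k) (4 + e) (begin
      2 * ((2 + k) * (suc k + (5 + e)))        ≤⟨ *-monoʳ-≤ 2 (*-mono-≤ (s≤s (s≤s k≤)) (+-monoˡ-≤ (5 + e) (s≤s k≤))) ⟩
      2 * ((9 + e) * ((8 + e) + (5 + e)))      ≤⟨ m≤m+n _ (6 + 26 * e + 4 * (e * e)) ⟩
      2 * ((9 + e) * ((8 + e) + (5 + e))) + (6 + 26 * e + 4 * (e * e)) ≡⟨ slack e ⟩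
      8 * ((6 + e) * (5 + e))                  ∎))
    (g₁₁-formula k (6 + e)) (formula-next k (4 + e))
    where
    open ≤-Reasoning
    double : ∀ e → 4 * ((8 + e) * ((7 + e) + (7 + e))) ≡ 8 * ((8 + e) * (7 + e))
    double = ℕ-ring-∀
    slack : ∀ e → 2 * ((9 + e) * ((8 + e) + (5 + e))) + (6 + 26 * e + 4 * (e * e)) ≡ 8 * ((6 + e) * (5 + e))
    slack = ℕ-ring-∀

  2*4^<8^ : ∀ j → 2 * 4 ^ (9 + j) < 8 ^ (7 + j)
  2*4^<8^ zero    = ≤ᵇ⇒≤ _ _ _
  2*4^<8^ (suc j) = begin-strict
    2 * (4 * 4 ^ (9 + j))  ≡⟨ swap (4 ^ (9 + j)) ⟩
    4 * (2 * 4 ^ (9 + j))  <⟨ *-monoʳ-< 4 (2*4^<8^ j) ⟩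
    4 * 8 ^ (7 + j)        ≤⟨ *-monoˡ-≤ (8 ^ (7 + j)) {4} {8} (≤ᵇ⇒≤ _ _ _) ⟩
    8 * 8 ^ (7 + j)        ∎
    where
    open ≤-Reasoning
    swap : ∀ x → 2 * (4 * x) ≡ 4 * (2 * x)
    swap = ℕ-ring-∀

  -- Corrections are powers of 4, while `B k d` is at least 8 ^ k. The largest exponent occurring
  -- when genera 2 + k and 3 + k are compared is 2 + k.
  spike-small : ∀ {k} d → 7 ≤ k → 2 * 4 ^ (2 + k) < B k d
  spike-small {k} d 7≤k with m≤n⇒∃[o]m+o≡n 7≤k
  ... | j , refl = <-≤-trans (2*4^<8^ j) (8^≤B k d)

  spike≤ : ∀ d k → spike d k ≤ 4 ^ k
  spike≤ zero    k = ≤-refl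
  spike≤ (suc d) k = z≤n

  descent-arith : ∀ {g₀ g₁ b₀ b₁ c₁ x y} → g₀ + (b₀ + 0) ≡ x → g₁ + (b₁ + c₁) ≡ y → y + b₀ < x + b₁ → g₁ < g₀
  descent-arith {g₀} {g₁} {b₀} {b₁} {c₁} {x} {y} e₀ e₁ y<x = +-cancelʳ-< (b₁ + b₀) g₁ g₀ (begin-strict
    g₁ + (b₁ + b₀)        ≤⟨ m≤m+n _ c₁ ⟩
    g₁ + (b₁ + b₀) + c₁   ≡⟨ gather g₁ b₀ b₁ c₁ ⟩
    g₁ + (b₁ + c₁) + b₀   ≡⟨ cong (_+ b₀) e₁ ⟩
    y + b₀                <⟨ y<x ⟩
    x + b₁                ≡⟨ cong (_+ b₁) e₀ ⟨
    g₀ + (b₀ + 0) + b₁    ≡⟨ regroup g₀ b₀ b₁ ⟩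
    g₀ + (b₁ + b₀)        ∎)
    where
    open ≤-Reasoning
    gather : ∀ g x y z → g + (y + x) + z ≡ g + (y + z) + x
    gather = ℕ-ring-∀
    regroup : ∀ g x y → g + (x + 0) + y ≡ g + (y + x)
    regroup = ℕ-ring-∀

  -- The 10 adds up what the b terms cost: 8 b₀ from b₂ ≤ 2 b₁ + 8 b₀, one b₀ for the power of 4,
  -- and b₀ itself. At e = t = 0, which is n = 18 and k = 6, the inequality fails, 70 against 64.
  power-dominates : ∀ e t → 1 ≤ e + t → 10 * (7 + e + t) ≤ 4 * 2 ^ (4 + e) * (1 + t)
  power-dominates zero    (suc t) _ = ≤-trans (m≤m+n _ (48 + 54 * t)) (≤-reflexive (slack t))
    where
    slack : ∀ t → 10 * (7 + 0 + (1 + t)) + (48 + 54 * t) ≡ 4 * 16 * (1 + (1 + t))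
    slack = ℕ-ring-∀
  power-dominates (suc e) t       _ = begin
    10 * (7 + suc e + t)                ≤⟨ m≤m+n _ (t * (70 + 10 * e)) ⟩
    10 * (7 + suc e + t) + t * (70 + 10 * e)  ≡⟨ factor e t ⟩
    10 * (8 + e) * (1 + t)              ≤⟨ *-monoˡ-≤ (1 + t) (base e) ⟩
    4 * 2 ^ (5 + e) * (1 + t)           ∎
    where
    open ≤-Reasoning
    factor : ∀ e t → 10 * (7 + (1 + e) + t) + t * (70 + 10 * e) ≡ 10 * (8 + e) * (1 + t)
    factor = ℕ-ring-∀
    split : ∀ e → 10 * (8 + e) + 10 * (8 + e) ≡ 10 * (9 + e) + (70 + 10 * e)
    split = ℕ-ring-∀
    twice : ∀ x → 4 * x + 4 * x ≡ 4 * (2 * x)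
    twice = ℕ-ring-∀
    base : ∀ e → 10 * (8 + e) ≤ 4 * 2 ^ (5 + e)
    base zero    = ≤ᵇ⇒≤ _ _ _
    base (suc e) = begin
      10 * (9 + e)                      ≤⟨ m≤m+n _ (70 + 10 * e) ⟩
      10 * (9 + e) + (70 + 10 * e)      ≡⟨ split e ⟨
      10 * (8 + e) + 10 * (8 + e)       ≤⟨ +-mono-≤ (base e) (base e) ⟩
      4 * 2 ^ (5 + e) + 4 * 2 ^ (5 + e) ≡⟨ twice (2 ^ (5 + e)) ⟩
      4 * 2 ^ (6 + e)                   ∎

  -- Multiplied by K = k + 1, with K b₁ ≤ 4 (6 + e) b₀, the inequality reduces to power-dominates.
  far-arith : ∀ {K e t u b₀ b₁ b₂ s} → K * b₁ ≤ 4 * (6 + e) * b₀ → b₂ ≤ 2 * b₁ + 8 * b₀ → 2 * s < b₀ →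
              10 * K ≤ 4 * u * (1 + t) → K ≡ 7 + e + t → .{{_ : NonZero K}} →
              u * b₁ + b₂ + 2 * s + b₀ < 2 * (2 * u) * b₀ + b₁ + 0 + b₁
  far-arith {K} {e} {t} {u} {b₀} {b₁} {b₂} {s} ratio b₂≤ s< dominates K≡ = *-cancelˡ-< K _ _ (begin-strict
    K * (u * b₁ + b₂ + 2 * s + b₀)
      ≡⟨ expand K u b₀ b₁ b₂ s ⟩
    u * (K * b₁) + K * (2 * s + (b₂ + b₀))
      <⟨ +-mono-≤-< (*-monoʳ-≤ u ratio) (*-monoʳ-< K (+-mono-<-≤ s< (+-monoˡ-≤ b₀ b₂≤))) ⟩
    u * (4 * (6 + e) * b₀) + K * (b₀ + (2 * b₁ + 8 * b₀ + b₀))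
      ≡⟨ collect K u e b₀ b₁ ⟩
    (4 * u * (6 + e)) * b₀ + (10 * K) * b₀ + K * (2 * b₁)
      ≤⟨ +-monoˡ-≤ (K * (2 * b₁)) (+-monoʳ-≤ ((4 * u * (6 + e)) * b₀) (*-monoˡ-≤ b₀ dominates)) ⟩
    (4 * u * (6 + e)) * b₀ + (4 * u * (1 + t)) * b₀ + K * (2 * b₁)
      ≡⟨ cong (λ K → (4 * u * (6 + e)) * b₀ + (4 * u * (1 + t)) * b₀ + K * (2 * b₁)) K≡ ⟩
    (4 * u * (6 + e)) * b₀ + (4 * u * (1 + t)) * b₀ + (7 + e + t) * (2 * b₁)
      ≡⟨ factor u e t b₀ b₁ ⟩
    (7 + e + t) * (2 * (2 * u) * b₀ + b₁ + 0 + b₁)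
      ≡⟨ cong (_* (2 * (2 * u) * b₀ + b₁ + 0 + b₁)) K≡ ⟨
    K * (2 * (2 * u) * b₀ + b₁ + 0 + b₁) ∎)
    where
    open ≤-Reasoning
    expand : ∀ k u x y z s → k * (u * y + z + 2 * s + x) ≡ u * (k * y) + k * (2 * s + (z + x))
    expand = ℕ-ring-∀
    collect : ∀ k u e x y → u * (4 * (6 + e) * x) + k * (x + (2 * y + 8 * x + x)) ≡
              (4 * u * (6 + e)) * x + (10 * k) * x + k * (2 * y)
    collect = ℕ-ring-∀
    factor : ∀ u e t x y → (4 * u * (6 + e)) * x + (4 * u * (1 + t)) * x + (7 + e + t) * (2 * y) ≡
             (7 + e + t) * (2 * (2 * u) * x + y + 0 + y)
    factor = ℕ-ring-∀

  fall-by-4 : ∀ k d → 2 + d ≤ suc k → B (suc k) d ≤ 4 * B k (2 + d)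
  fall-by-4 k d d≤k = ≤-trans (≤-reflexive (sym (*-identityˡ _))) (fall-by 4 1 k d (begin
    1 * (8 * ((2 + d) * (1 + d)))            ≡⟨ halves d ⟩
    4 * ((2 + d) * ((1 + d) + (1 + d)))      ≤⟨ *-monoʳ-≤ 4 (*-mono-≤ d≤k (+-monoˡ-≤ (1 + d) (≤-pred d≤k))) ⟩
    4 * (suc k * (k + suc d))                ∎))
    where
    open ≤-Reasoning
    halves : ∀ d → 1 * (8 * ((2 + d) * (1 + d))) ≡ 4 * ((2 + d) * ((1 + d) + (1 + d)))
    halves = ℕ-ring-∀

  -- Here t = 3 k - n. The quotient b₁ / b₀ is at most 4 (6 + e) / (k + 1) with k + 1 = 7 + e + t,
  -- so for u = 2 ^ (4 + e) the first term drops by at least 4 u b₀ (1 + t) / (k + 1). This has to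
  -- exceed the change in the b terms.
  descent-step-far : ∀ k e → 6 + e ≤ k → 7 ≤ k →
                     g₁₁ (suc k * 2 + (4 + e)) (3 + k) < g₁₁ (suc k * 2 + (4 + e)) (2 + k)
  descent-step-far k e e≤k 7≤k = descent-arith (formula (4 + e) (≤-trans (s≤s z≤n) 7≤k)) (formula-next k (2 + e))
    (far-arith {suc k} {e} {t} {2 ^ (4 + e)} {b₀} {b₁} {b₂} {spike e (2 + k)} ratio b₂≤ s-small dominates K≡)
    where
    t = k ∸ (6 + e)
    b₀ = B k (6 + e)
    b₁ = B (suc k) (4 + e)
    b₂ = B (2 + k) (2 + e)

    K≡ : suc k ≡ 7 + e + t
    K≡ = cong suc (sym (m+[n∸m]≡n e≤k))

    s-small : 2 * spike e (2 + k) < b₀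
    s-small = ≤-<-trans (*-monoʳ-≤ 2 (spike≤ e (2 + k))) (spike-small (6 + e) 7≤k)

    dominates : 10 * suc k ≤ 4 * 2 ^ (4 + e) * (1 + t)
    dominates = subst (λ K → 10 * K ≤ 4 * 2 ^ (4 + e) * (1 + t)) (sym K≡)
      (power-dominates e t (+-cancelˡ-≤ 6 1 (e + t) (subst (7 ≤_) (sym (m+[n∸m]≡n e≤k)) 7≤k)))

    ratio : suc k * b₁ ≤ 4 * (6 + e) * b₀
    ratio = fall-by (4 * (6 + e)) (suc k) k (4 + e) (begin
      suc k * (8 * ((6 + e) * (5 + e)))                  ≡⟨ halves (suc k) e ⟩
      4 * (6 + e) * (suc k * ((5 + e) + (5 + e)))        ≤⟨ *-monoʳ-≤ (4 * (6 + e)) (*-monoʳ-≤ (suc k)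
                                                              (+-monoˡ-≤ (5 + e) (≤-trans (n≤1+n _) e≤k))) ⟩
      4 * (6 + e) * (suc k * (k + (5 + e)))              ∎)
      where
      open ≤-Reasoning
      halves : ∀ k e → k * (8 * ((6 + e) * (5 + e))) ≡ 4 * (6 + e) * (k * ((5 + e) + (5 + e)))
      halves = ℕ-ring-∀

    b₂≤ : b₂ ≤ 2 * b₁ + 8 * b₀
    b₂≤ = begin
      b₂                     ≤⟨ fall-by-4 (suc k) (2 + e) (≤-trans (n≤1+n _) (≤-trans (n≤1+n _) (≤-trans e≤k (≤-trans (n≤1+n _) (n≤1+n _))))) ⟩
      -- One half of 4 b₁ is kept, because the inequality in `far-arith` has 2 b₁ on its other side
      -- to absorb it.
      4 * b₁                 ≡⟨ halves b₁ ⟩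
      2 * b₁ + 2 * b₁        ≤⟨ +-monoʳ-≤ (2 * b₁) (*-monoʳ-≤ 2 (fall-by-4 k (4 + e) (≤-trans e≤k (n≤1+n _)))) ⟩
      2 * b₁ + 2 * (4 * b₀)  ≡⟨ cong (2 * b₁ +_) (*-assoc 2 4 b₀) ⟨
      2 * b₁ + 8 * b₀        ∎
      where
      open ≤-Reasoning
      halves : ∀ x → 4 * x ≡ 2 * x + 2 * x
      halves = ℕ-ring-∀

  -- For d = 3, and for d = 2 below, n ≥ 20 forces k ≥ 8, so far beyond the tie that b₁ ≤ 2 b₀;
  -- fixed multiples of b₀ then decide. The numeral in the name is d + 2.
  descent-step-5 : ∀ k → 8 ≤ k → g₁₁ (suc k * 2 + 3) (3 + k) < g₁₁ (suc k * 2 + 3) (2 + k)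
  descent-step-5 k 8≤k = descent-arith (formula 3 (≤-trans (s≤s z≤n) 8≤k)) (formula-next k 1)
    (arith (B k 5) (B (suc k) 3) (B (2 + k) 1) (4 ^ (2 + k)) (spike-small 5 (≤-trans (n≤1+n 7) 8≤k))
      (≤-trans (≤-reflexive (sym (*-identityˡ _))) (fall-by 2 1 k 3
        -- The two sides of the condition of `fall-by` at d = 3 and k = 8: 8 · 5 · 4 and 2 · 9 · 12.
        (≤-trans (≤ᵇ⇒≤ 160 216 _) (*-monoʳ-≤ 2 (*-mono-≤ (s≤s 8≤k) (+-monoˡ-≤ 4 8≤k))))))
      (fall-by-4 (suc k) 1 (≤-trans (≤ᵇ⇒≤ 3 10 _) (s≤s (s≤s 8≤k)))))
    where
    open ≤-Reasoning
    arith : ∀ b₀ b₁ b₂ s → 2 * s < b₀ → b₁ ≤ 2 * b₀ → b₂ ≤ 4 * b₁ →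
            8 * b₁ + b₂ + 2 * (s + 0) + b₀ < 32 * b₀ + b₁ + 0 + b₁
    arith b₀ b₁ b₂ s s< b₁≤ b₂≤ = begin-strict
      8 * b₁ + b₂ + 2 * (s + 0) + b₀               ≡⟨ gather b₀ b₁ b₂ s ⟩
      8 * b₁ + b₂ + b₀ + 2 * s                     <⟨ +-mono-≤-< (+-monoˡ-≤ b₀ (+-monoʳ-≤ (8 * b₁) b₂≤)) s< ⟩
      8 * b₁ + 4 * b₁ + b₀ + b₀                    ≡⟨ split b₀ b₁ ⟩
      10 * b₁ + (2 * b₀ + b₁ + b₁)                 ≤⟨ +-monoˡ-≤ (2 * b₀ + b₁ + b₁) (*-monoʳ-≤ 10 b₁≤) ⟩
      10 * (2 * b₀) + (2 * b₀ + b₁ + b₁)           ≤⟨ m≤m+n _ (10 * b₀) ⟩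
      10 * (2 * b₀) + (2 * b₀ + b₁ + b₁) + 10 * b₀ ≡⟨ collect b₀ b₁ ⟩
      32 * b₀ + b₁ + 0 + b₁                        ∎
      where
      gather : ∀ x y z s → 8 * y + z + 2 * (s + 0) + x ≡ 8 * y + z + x + 2 * s
      gather = ℕ-ring-∀
      split : ∀ x y → 8 * y + 4 * y + x + x ≡ 10 * y + (2 * x + y + y)
      split = ℕ-ring-∀
      collect : ∀ x y → 10 * (2 * x) + (2 * x + y + y) + 10 * x ≡ 32 * x + y + 0 + y
      collect = ℕ-ring-∀

  -- The power of 4 now adds to the value that is to be shown larger, so it needs no bound.
  descent-step-4 : ∀ k → 8 ≤ k → g₁₁ (suc k * 2 + 2) (3 + k) < g₁₁ (suc k * 2 + 2) (2 + k)
  descent-step-4 k 8≤k = descent-arith (formula 2 (≤-trans (s≤s z≤n) 8≤k)) (formula-next k 0)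
    (arith (B k 4) (B (suc k) 2) (B (2 + k) 0) (4 ^ (1 + k)) (1≤B k 4)
      (≤-trans (≤-reflexive (sym (*-identityˡ _))) (fall-by 2 1 k 2
        (≤-trans (≤ᵇ⇒≤ 96 198 _) (*-monoʳ-≤ 2 (*-mono-≤ (s≤s 8≤k) (+-monoˡ-≤ 3 8≤k))))))
      (≤-trans (≤-reflexive (sym (*-identityˡ _))) (≤-trans (fall-by 1 1 (suc k) 0
        (≤-trans (≤ᵇ⇒≤ 16 100 _) (*-monoʳ-≤ 1 {100} (*-mono-≤ {10} (s≤s (s≤s 8≤k)) (+-monoˡ-≤ 1 (s≤s 8≤k))))))
        (≤-reflexive (*-identityˡ _)))))
    where
    open ≤-Reasoning
    arith : ∀ b₀ b₁ b₂ s → 1 ≤ b₀ → b₁ ≤ 2 * b₀ → b₂ ≤ b₁ →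
            4 * b₁ + b₂ + 0 + b₀ < 16 * b₀ + b₁ + 2 * (0 + s) + b₁
    arith b₀ b₁ b₂ s 1≤b₀ b₁≤ b₂≤ = begin-strict
      4 * b₁ + b₂ + 0 + b₀                         ≤⟨ +-monoˡ-≤ b₀ (+-monoˡ-≤ 0 (+-monoʳ-≤ (4 * b₁) b₂≤)) ⟩
      4 * b₁ + b₁ + 0 + b₀                         ≡⟨ split b₀ b₁ ⟩
      3 * b₁ + (b₀ + b₁ + b₁)                      ≤⟨ +-monoˡ-≤ (b₀ + b₁ + b₁) (*-monoʳ-≤ 3 b₁≤) ⟩
      3 * (2 * b₀) + (b₀ + b₁ + b₁)                <⟨ m<m+n _ 1≤b₀ ⟩
      3 * (2 * b₀) + (b₀ + b₁ + b₁) + b₀           ≤⟨ m≤m+n _ (8 * b₀ + 2 * s) ⟩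
      3 * (2 * b₀) + (b₀ + b₁ + b₁) + b₀ + (8 * b₀ + 2 * s) ≡⟨ collect b₀ b₁ s ⟩
      16 * b₀ + b₁ + 2 * (0 + s) + b₁              ∎
      where
      split : ∀ x y → 4 * y + y + 0 + x ≡ 3 * y + (x + y + y)
      split = ℕ-ring-∀
      collect : ∀ x y s → 3 * (2 * x) + (x + y + y) + x + (8 * x + 2 * s) ≡ 16 * x + y + 2 * (0 + s) + y
      collect = ℕ-ring-∀

  -- Here 3 + k is the top genus of an odd n, so its value comes from `g₁₁-last`.
  descent-step-3 : ∀ k → 1 ≤ k → g₁₁ (suc k * 2 + 1) (3 + k) < g₁₁ (suc k * 2 + 1) (2 + k)
  descent-step-3 k 1≤k = descent-arith {b₁ = B (suc k) 1} {c₁ = 0} (formula 1 1≤k)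
    (cong (_+ (B (suc k) 1 + 0)) (trans (cong (λ n → g₁₁ n (3 + k)) (+-comm (suc k * 2) 1)) (g₁₁-last k)))
    (arith (B k 3) (B (suc k) 1) (4 ^ (1 + k)) (1≤B k 3))
    where
    open ≤-Reasoning
    arith : ∀ b₀ b₁ s → 1 ≤ b₀ → b₁ + (b₁ + 0) + b₀ < 8 * b₀ + b₁ + 2 * (s + 0) + b₁
    arith b₀ b₁ s 1≤b₀ = begin-strict
      b₁ + (b₁ + 0) + b₀                           <⟨ m<m+n _ 1≤b₀ ⟩
      b₁ + (b₁ + 0) + b₀ + b₀                      ≤⟨ m≤m+n _ (6 * b₀ + 2 * s) ⟩
      b₁ + (b₁ + 0) + b₀ + b₀ + (6 * b₀ + 2 * s)   ≡⟨ collect b₀ b₁ s ⟩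
      8 * b₀ + b₁ + 2 * (s + 0) + b₁               ∎
      where
      collect : ∀ x y s → y + (y + 0) + x + x + (6 * x + 2 * s) ≡ 8 * x + y + 2 * (s + 0) + y
      collect = ℕ-ring-∀

  at-least : ∀ j d k → suc j * 2 + d < 20 → 20 ≤ suc k * 2 + d → j < k
  at-least j d k small large = ≰⇒> λ k≤j → <⇒≱ (≤-<-trans (+-monoˡ-≤ d (*-monoˡ-≤ 2 (s≤s k≤j))) small) large

  descent-step : ∀ k d → 20 ≤ suc k * 2 + suc d → 3 + d ≤ k →
                 g₁₁ (suc k * 2 + suc d) (3 + k) < g₁₁ (suc k * 2 + suc d) (2 + k)
  descent-step k zero                n≥20 d≤k = descent-step-3 k (≤-trans (s≤s z≤n) d≤k)
  descent-step k (suc zero)          n≥20 d≤k = descent-step-4 k (at-least 7 2 k (≤ᵇ⇒≤ _ _ _) n≥20)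
  descent-step k (suc (suc zero))    n≥20 d≤k = descent-step-5 k (at-least 7 3 k (≤ᵇ⇒≤ _ _ _) n≥20)
  descent-step k (suc (suc (suc e))) n≥20 d≤k = descent-step-far k e d≤k (large e d≤k n≥20)
    where
    large : ∀ e → 6 + e ≤ k → 20 ≤ suc k * 2 + (4 + e) → 7 ≤ k
    large zero    _   n≥20 = at-least 6 4 k (≤ᵇ⇒≤ _ _ _) n≥20
    large (suc e) e≤k _    = ≤-trans (m≤m+n 7 e) e≤k


-- Location of the peak

module Peak where

  open Census
  open ClosedForm
  open Formula
  open Growth
  open import Data.Integer using (ℤ; +_; ∣_∣) renaming (_+_ to _⊕_; _*_ to _⊗_; _-_ to _⊖_)
  open import Data.Nat using (ℕ; zero; suc; _+_; _*_; _^_; _≤_; _<_; z≤n; s≤s; _≤?_; _<?_; pred; _/_; _%_; _≟_; _≤ᵇ_; _∸_)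
  open import Data.Nat.DivMod using (m≡m%n+[m/n]*n; m%n<n; m/n*n≤m)
  open import Data.Nat.Properties
  open import Data.Nat.Tactic.RingSolver using () renaming (solve-∀ to ℕ-ring-∀)
  open import Data.Bool using (true; false; T)
  open import Data.List using (_∷_; filter; length; map)
  open import Data.List.Membership.Propositional using (_∈_)
  open import Data.List.Membership.Propositional.Properties using (∈-map⁺; ∈-map⁻; ∈-filter⁺; ∈-filter⁻; ∈-length)
  open import Data.List.Relation.Unary.Any using (here)
  open import Data.Sum using (_⊎_; inj₁; inj₂)
  open import Data.Product using (_×_; _,_; proj₁; proj₂)
  open import Relation.Binary.PropositionalEquality hiding ([_])
  open import Relation.Nullary using (Dec; yes; no; contradiction)
  open import Relation.Nullary.Decidable using (from-yes; _×-dec_; _→-dec_; map′)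

  -- Strict on both sides, hence stronger than `Shape`, and with every clause bounded by `r`, hence
  -- decidable for a given sequence. The two positivity clauses show that the genera 1 and `r`
  -- occur.
  record Peaked (f : ℕ → ℕ) (r p : ℕ) : Set where
    constructor peaked
    field
      1≤p  : 1 ≤ p
      p≤r  : p ≤ r
      f1>0 : 0 < f 1
      fr>0 : 0 < f r
      up   : ∀ {i} → i < r → 1 ≤ i → i < p → f i < f (suc i)
      down : ∀ {i} → i < r → p ≤ i → f (suc i) < f i

  peaked? : ∀ f r p → Dec (Peaked f r p)
  peaked? f r p = map′
    (λ (s , t , u , v , w , x) → peaked s t u v (λ {i} → w {i}) (λ {i} → x {i}))
    (λ (peaked s t u v w x) → s , t , u , v , (λ {i} → w {i}) , (λ {i} → x {i}))
    (1 ≤? p ×-dec p ≤? r ×-dec 0 <? f 1 ×-dec 0 <? f r ×-dec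
     allUpTo? (λ i → 1 ≤? i →-dec (i <? p →-dec f i <? f (suc i))) r ×-dec
     allUpTo? (λ i → p ≤? i →-dec f (suc i) <? f i) r)

  maximumGenus : ℕ → ℕ
  maximumGenus n = (n + 3) / 2

  coefficient : ℕ → ℕ → ℤ
  coefficient n i =
    (lucas 2 (suc n) ↑ 2) i ⊕ (lucas 1 (suc n) ↑ 1) i ⊖ (lucas 1 (suc n) ↑ 2) i ⊕ (I ↑ 1) i ⊖ (I ↑ 2) i
    ⊕ + 2 ⊗ (spikes n ↑ 1) i ⊕ + 2 ⊗ (delayed spikes n ↑ 1) i ⊖ + 6 ⊗ (delayed spikes n ↑ 2) i

  -- For small n the closed form is evaluated in place of the 4 ^ n surfaces. The absolute value
  -- brings into ℕ an integer that `closed₀` shows to be a count.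
  evaluate : ℕ → ℕ → ℕ
  evaluate n i = ∣ coefficient (pred n) i ∣

  -- The range runs past 17, where `p₁₁` takes its final form, up to the point where the uniform
  -- estimates begin.
  small : ∀ {n} → n < 20 → 2 ≤ n → Peaked (evaluate n) (maximumGenus n) (p₁₁ n)
  small = from-yes (allUpTo? (λ n → 2 ≤? n →-dec peaked? (evaluate n) (maximumGenus n) (p₁₁ n)) 20)

  evaluate-≡ : ∀ n i → g₁₁ (suc n) i ≡ evaluate (suc n) i
  evaluate-≡ n i = cong ∣_∣ (trans (cong +_ (g₁₁≡census (suc n) i)) (closed₀ n i))

  peaked-≗ : ∀ {f g r p} → (∀ i → f i ≡ g i) → Peaked g r p → Peaked f r p
  peaked-≗ {f} {g} f≗g P = peaked 1≤p p≤r
    (subst (0 <_) (sym (f≗g 1)) f1>0) (subst (0 <_) (sym (f≗g _)) fr>0)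
    (λ i<r 1≤i i<p → subst₂ _<_ (sym (f≗g _)) (sym (f≗g _)) (up i<r 1≤i i<p))
    (λ i<r p≤i → subst₂ _<_ (sym (f≗g _)) (sym (f≗g _)) (down i<r p≤i))
    where open Peaked P

  ascent : ∀ n k → 20 ≤ n → 1 + 3 * k ≤ n → g₁₁ n (2 + k) < g₁₁ n (3 + k)
  ascent n k n≥20 k≤ with m≤n⇒∃[o]m+o≡n (enough (k ≤? 6))
    where
    -- `ascent-step` needs d ≥ 6. Up to k = 6 this follows from n ≥ 20 = 2 · 7 + 6, and from k = 7
    -- on it follows from n ≥ 3 k + 1.
    enough : Dec (k ≤ 6) → suc k * 2 + 6 ≤ n
    enough (yes k≤6) = ≤-trans (+-monoˡ-≤ 6 (*-monoˡ-≤ 2 (s≤s k≤6))) n≥20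
    enough (no k≰6)  = ≤-trans (≤-trans (≤-reflexive (shape k)) (+-monoʳ-≤ (1 + 2 * k) (≰⇒> k≰6)))
      (≤-trans (≤-reflexive (shape′ k)) k≤)
      where
      shape : ∀ k → (1 + k) * 2 + 6 ≡ 1 + 2 * k + 7
      shape = ℕ-ring-∀
      shape′ : ∀ k → 1 + 2 * k + k ≡ 1 + 3 * k
      shape′ = ℕ-ring-∀
  ... | e , refl = subst (λ n → g₁₁ n (2 + k) < g₁₁ n (3 + k)) (sym (+-assoc (suc k * 2) 6 e))
    (ascent-step k e (+-cancelˡ-≤ (1 + 2 * k) k (7 + e) (≤-trans (≤-reflexive (left k)) (≤-trans k≤ (≤-reflexive (right k e))))))
    where
    left : ∀ k → 1 + 2 * k + k ≡ 1 + 3 * k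
    left = ℕ-ring-∀
    right : ∀ k e → (1 + k) * 2 + 6 + e ≡ 1 + 2 * k + (7 + e)
    right = ℕ-ring-∀

  descent : ∀ n k → 20 ≤ n → n ≤ 3 * k → 3 + 2 * k ≤ n → g₁₁ n (3 + k) < g₁₁ n (2 + k)
  descent n k n≥20 n≤ k≤ with m≤n⇒∃[o]m+o≡n k≤
  ... | d , refl = subst (λ n → g₁₁ n (3 + k) < g₁₁ n (2 + k)) (sym (index k d))
    (descent-step k d (subst (20 ≤_) (index k d) n≥20)
      (+-cancelˡ-≤ (2 * k) (3 + d) k (≤-trans (≤-reflexive (left k d)) (≤-trans n≤ (≤-reflexive (right k))))))
    where
    index : ∀ k d → 3 + 2 * k + d ≡ (1 + k) * 2 + (1 + d)
    index = ℕ-ring-∀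
    left : ∀ k d → 2 * k + (3 + d) ≡ 3 + 2 * k + d
    left = ℕ-ring-∀
    right : ∀ k → 3 * k ≡ 2 * k + k
    right = ℕ-ring-∀

  -- The quotient is the least q with n ≤ 3 q. So k < q gives 3 k + 1 ≤ n and q ≤ k gives n ≤ 3 k,
  -- as `ascent` and `descent` require.
  third : ∀ n → let q = (n + 2) / 3 in n ≤ 3 * q × 3 * q ≤ n + 2
  third n = +-cancelʳ-≤ 2 n (3 * q) (begin
      n + 2                      ≡⟨ m≡m%n+[m/n]*n (n + 2) 3 ⟩
      (n + 2) % 3 + q * 3        ≤⟨ +-monoˡ-≤ (q * 3) (≤-pred (m%n<n (n + 2) 3)) ⟩
      2 + q * 3                  ≡⟨ swap q ⟩
      3 * q + 2                  ∎)
    , ≤-trans (≤-reflexive (*-comm 3 q)) (m/n*n≤m (n + 2) 3)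
    where
    open ≤-Reasoning
    q = (n + 2) / 3
    swap : ∀ q → 2 + q * 3 ≡ 3 * q + 2
    swap = ℕ-ring-∀

  half : ∀ n → let r = maximumGenus n in n + 2 ≤ 2 * r × 2 * r ≤ n + 3
  half n = +-cancelʳ-≤ 1 (n + 2) (2 * r) (begin
      n + 2 + 1                  ≡⟨ +-assoc n 2 1 ⟩
      n + 3                      ≡⟨ m≡m%n+[m/n]*n (n + 3) 2 ⟩
      (n + 3) % 2 + r * 2        ≤⟨ +-monoˡ-≤ (r * 2) (≤-pred (m%n<n (n + 3) 2)) ⟩
      1 + r * 2                  ≡⟨ swap r ⟩
      2 * r + 1                  ∎)
    , ≤-trans (≤-reflexive (*-comm 2 r)) (m/n*n≤m (n + 3) 2)
    where
    open ≤-Reasoning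
    r = maximumGenus n
    swap : ∀ r → 1 + r * 2 ≡ 2 * r + 1
    swap = ℕ-ring-∀

  -- The two parities of n with maximum genus 2 + k. For even n the value is 3 b k + b (k + 1) - 6 ·
  -- 4 ^ k, and 6 · 4 ^ k is below b k.
  last-positive : ∀ n k → 20 ≤ n → n ≡ 1 + k * 2 ⊎ n ≡ 2 + k * 2 → 0 < g₁₁ n (2 + k)
  last-positive n zero    (s≤s ()) (inj₁ refl)
  last-positive n (suc k) n≥20 (inj₁ refl) = subst (0 <_) (sym (g₁₁-last k)) (1≤B (suc k) 1)
  last-positive n k       n≥20 (inj₂ refl) = +-cancelʳ-< (B k 2 + 6 * 4 ^ k) 0 _ (begin-strict
    B k 2 + 6 * 4 ^ k                    <⟨ +-monoʳ-< (B k 2) (≤-<-trans six (spike-small 2 7≤k)) ⟩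
    B k 2 + B k 2                        ≤⟨ m≤m+n _ (2 * B k 2 + B (suc k) 0) ⟩
    B k 2 + B k 2 + (2 * B k 2 + B (suc k) 0) ≡⟨ collect (B k 2) (B (suc k) 0) ⟩
    2 ^ 2 * B k 2 + B (suc k) 0 + 2 * (0 + 0) ≡⟨ formula 0 (≤-trans (s≤s z≤n) 7≤k) ⟨
    g₁₁ (suc k * 2 + 0) (2 + k) + (B k 2 + 6 * 4 ^ k)
      ≡⟨ cong (λ n → g₁₁ n (2 + k) + (B k 2 + 6 * 4 ^ k)) (+-identityʳ (suc k * 2)) ⟩
    g₁₁ (suc k * 2) (2 + k) + (B k 2 + 6 * 4 ^ k) ∎)
    where
    open ≤-Reasoning
    7≤k : 7 ≤ k
    7≤k = at-least 6 0 k (≤ᵇ⇒≤ _ _ _) (≤-trans n≥20 (≤-reflexive (sym (+-identityʳ (suc k * 2)))))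

    six : 6 * 4 ^ k ≤ 2 * 4 ^ (2 + k)
    six = ≤-trans (*-monoˡ-≤ (4 ^ k) {6} {32} (≤ᵇ⇒≤ _ _ _)) (≤-reflexive (shape (4 ^ k)))
      where
      shape : ∀ x → 32 * x ≡ 2 * (4 * (4 * x))
      shape = ℕ-ring-∀

    collect : ∀ x y → x + x + (2 * x + y) ≡ 2 ^ 2 * x + y + 2 * (0 + 0)
    collect = ℕ-ring-∀

  -- The step from genus 1 lies outside `ascent`, which starts at genus 2; here the constant value 2
  -- meets a term 2 ^ n.
  first-ascent : ∀ d → g₁₁ (3 + d) 1 < g₁₁ (3 + d) 2
  first-ascent d = subst (_< g₁₁ (3 + d) 2) (sym (g₁₁-one d))
    (+-cancelʳ-< (1 + 1 + 0) 2 _ (begin-strict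
      4                          <⟨ ≤ᵇ⇒≤ 5 8 _ ⟩
      8                          ≤⟨ *-monoʳ-≤ 8 (m^n>0 2 d) ⟩
      8 * 2 ^ d                  ≤⟨ m≤m+n _ (B 1 (1 + d) + 2 * (spike₁ (1 + d) 0 + spike₂ (1 + d) 0)) ⟩
      8 * 2 ^ d + (B 1 (1 + d) + 2 * (spike₁ (1 + d) 0 + spike₂ (1 + d) 0))
        ≡⟨ shape (2 ^ d) (B 1 (1 + d)) (2 * (spike₁ (1 + d) 0 + spike₂ (1 + d) 0)) ⟩
      2 ^ (3 + d) * 1 + B 1 (1 + d) + 2 * (spike₁ (1 + d) 0 + spike₂ (1 + d) 0)
        ≡⟨ g₁₁-formula 0 (1 + d) ⟨
      g₁₁ (3 + d) 2 + (1 + 1 + 0) ∎))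
    where
    open ≤-Reasoning
    shape : ∀ x y z → 8 * x + (y + z) ≡ 2 * (2 * (2 * x)) * 1 + y + z
    shape = ℕ-ring-∀

  <⇒≰ᵇ : ∀ {m n} → m < n → (n ≤ᵇ m) ≡ false
  <⇒≰ᵇ {m} {n} m<n with n ≤ᵇ m in eq
  ... | false = refl
  ... | true  = contradiction (≤ᵇ⇒≤ n m (subst T (sym eq) _)) (<⇒≱ m<n)

  p₁₁-large : ∀ n → 20 ≤ n → p₁₁ n ≡ (n + 2) / 3 + 2
  p₁₁-large n n≥20 rewrite <⇒≰ᵇ (≤-trans (m≤m+n 6 14) n≥20) | <⇒≰ᵇ (≤-trans (m≤m+n 17 3) n≥20) = refl

  large : ∀ n → 20 ≤ n → Peaked (g₁₁ n) (maximumGenus n) (p₁₁ n)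
  large n n≥20 = subst (Peaked (g₁₁ n) r) (sym (trans (p₁₁-large n n≥20) (+-comm q 2))) (peaked
    (s≤s z≤n) 2+q≤r one (positive r refl) up down)
    where
    q = (n + 2) / 3
    r = maximumGenus n

    3≤n : 3 ≤ n
    3≤n = ≤-trans (m≤m+n 3 17) n≥20

    n≤3q : n ≤ 3 * q
    n≤3q = third n .proj₁

    3q≤ : 3 * q ≤ n + 2
    3q≤ = third n .proj₂

    2+q≤r : 2 + q ≤ r
    -- q is at most (n + 2) / 3 and r at least (n + 2) / 2, so they are compared after
    -- multiplication by 6.
    2+q≤r = *-cancelˡ-≤ 6 (begin
      6 * (2 + q)                ≡⟨ left q ⟩
      2 * (3 * q) + 12           ≤⟨ +-monoˡ-≤ 12 (*-monoʳ-≤ 2 3q≤) ⟩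
      2 * (n + 2) + 12           ≡⟨ middle n ⟩
      2 * n + 6 + 10             ≤⟨ +-monoʳ-≤ (2 * n + 6) (≤-trans (m≤m+n 10 10) n≥20) ⟩
      2 * n + 6 + n              ≡⟨ right n ⟩
      3 * (n + 2)                ≤⟨ *-monoʳ-≤ 3 (half n .proj₁) ⟩
      3 * (2 * r)                ≡⟨ *-assoc 3 2 r ⟨
      6 * r                      ∎)
      where
      open ≤-Reasoning
      left : ∀ q → 6 * (2 + q) ≡ 2 * (3 * q) + 12
      left = ℕ-ring-∀
      middle : ∀ n → 2 * (n + 2) + 12 ≡ 2 * n + 6 + 10
      middle = ℕ-ring-∀
      right : ∀ n → 2 * n + 6 + n ≡ 3 * (n + 2)
      right = ℕ-ring-∀

    one : 0 < g₁₁ n 1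
    one = subst (λ n → 0 < g₁₁ n 1) (m+[n∸m]≡n 3≤n) (subst (0 <_) (sym (g₁₁-one (n ∸ 3))) (s≤s z≤n))

    positive : ∀ s → s ≡ r → 0 < g₁₁ n s
    positive zero          s≡r = contradiction (subst (2 + q ≤_) (sym s≡r) 2+q≤r) λ ()
    positive (suc zero)    s≡r = contradiction (subst (2 + q ≤_) (sym s≡r) 2+q≤r) λ { (s≤s ()) }
    positive (suc (suc k)) s≡r = last-positive n k n≥20 (parity (m≤n⇒m<n∨m≡n upper))
      where
      upper : n ≤ 2 + k * 2
      upper = +-cancelʳ-≤ 2 n (2 + k * 2) (≤-trans (half n .proj₁)
        (≤-reflexive (trans (cong (2 *_) (sym s≡r)) (shape k))))
        where
        shape : ∀ k → 2 * (2 + k) ≡ 2 + k * 2 + 2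
        shape = ℕ-ring-∀

      lower : 1 + k * 2 ≤ n
      lower = +-cancelʳ-≤ 3 (1 + k * 2) n (≤-trans (≤-reflexive (trans (shape k) (cong (2 *_) s≡r))) (half n .proj₂))
        where
        shape : ∀ k → 1 + k * 2 + 3 ≡ 2 * (2 + k)
        shape = ℕ-ring-∀

      parity : n < 2 + k * 2 ⊎ n ≡ 2 + k * 2 → n ≡ 1 + k * 2 ⊎ n ≡ 2 + k * 2
      parity (inj₁ n<) = inj₁ (≤-antisym (≤-pred n<) lower)
      parity (inj₂ n≡) = inj₂ n≡

    start : g₁₁ n 1 < g₁₁ n 2
    start = subst (λ n → g₁₁ n 1 < g₁₁ n 2) (m+[n∸m]≡n 3≤n) (first-ascent (n ∸ 3))

    up : ∀ {i} → i < r → 1 ≤ i → i < 2 + q → g₁₁ n i < g₁₁ n (suc i)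
    up {suc zero}    _ _ _                = start
    up {suc (suc k)} _ _ (s≤s (s≤s k<q))  = ascent n k n≥20 (+-cancelʳ-≤ 2 (1 + 3 * k) n (begin
      1 + 3 * k + 2              ≡⟨ shape k ⟩
      3 * suc k                  ≤⟨ *-monoʳ-≤ 3 k<q ⟩
      3 * q                      ≤⟨ 3q≤ ⟩
      n + 2                      ∎))
      where
      open ≤-Reasoning
      shape : ∀ k → 1 + 3 * k + 2 ≡ 3 * (1 + k)
      shape = ℕ-ring-∀

    down : ∀ {i} → i < r → 2 + q ≤ i → g₁₁ n (suc i) < g₁₁ n i
    down {suc (suc k)} k<r (s≤s (s≤s q≤k)) = descent n k n≥20 (≤-trans n≤3q (*-monoʳ-≤ 3 q≤k))
      (+-cancelʳ-≤ 3 (3 + 2 * k) n (begin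
        3 + 2 * k + 3            ≡⟨ shape k ⟩
        2 * (3 + k)              ≤⟨ *-monoʳ-≤ 2 k<r ⟩
        2 * r                    ≤⟨ half n .proj₂ ⟩
        n + 3                    ∎))
      where
      open ≤-Reasoning
      shape : ∀ k → 3 + 2 * k + 3 ≡ 2 * (3 + k)
      shape = ℕ-ring-∀

  peak : ∀ n → 2 ≤ n → Peaked (g₁₁ n) (maximumGenus n) (p₁₁ n)
  peak (suc n) 2≤n with suc n <? 20
  ... | yes n<20 = peaked-≗ (evaluate-≡ n) (small n<20 2≤n)
  ... | no  n≮20 = large (suc n) (≮⇒≥ n≮20)

  attained : ∀ {n i} → 0 < g₁₁ n i → i ∈ map genus (𝒮₁₁ n)
  attained {n} {i} 0<g = member (filter (λ w → genus w ≟ i) (𝒮₁₁ n)) refl 0<g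
    where
    member : ∀ ws → ws ≡ filter (λ w → genus w ≟ i) (𝒮₁₁ n) → 0 < length ws → i ∈ map genus (𝒮₁₁ n)
    member (w ∷ ws) eq _ = let w∈ , g≡i = ∈-filter⁻ (λ w → genus w ≟ i) (subst (w ∈_) eq (here refl)) in
      subst (_∈ map genus (𝒮₁₁ n)) g≡i (∈-map⁺ genus w∈)

  occurs : ∀ {n i} → i ∈ map genus (𝒮₁₁ n) → g₁₁ n i ≢ 0
  occurs {n} {i} i∈ g≡0 with ∈-map⁻ genus i∈
  ... | w , w∈ , refl = <⇒≢ (∈-length (∈-filter⁺ (λ v → genus v ≟ genus w) w∈ refl)) (sym g≡0)

  beyond : ∀ n i → 2 ≤ n → maximumGenus n < i → g₁₁ n i ≡ 0
  beyond (suc n) zero          _   ()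
  beyond (suc n) (suc zero)    2≤n (s≤s r<1) = contradiction
    (≤-trans (≤-trans (s≤s z≤n) (half (suc n) .proj₁)) (*-monoʳ-≤ 2 r<1)) λ ()
  beyond (suc n) (suc (suc k)) 2≤n (s≤s r<i) = g₁₁-vanish n k
    (+-cancelʳ-≤ 2 (suc n) (k * 2) (≤-trans (half (suc n) .proj₁) (≤-trans (*-monoʳ-≤ 2 r<i) (≤-reflexive (shape k)))))
    where
    shape : ∀ k → 2 * (1 + k) ≡ k * 2 + 2
    shape = ℕ-ring-∀

  peaked-shape : ∀ {f r p} → Peaked f r p → Shape f 1 r p p
  peaked-shape {f} {r} {p} P = record
    { q≤l     = 1≤p
    ; l≤m     = ≤-refl
    ; m≤r     = p≤r
    ; ascent  = λ i 1≤i i<p → <⇒≤ (up (<-≤-trans (<⇒≤ i<p) p≤r) 1≤i (<⇒≤ i<p))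
    ; rise    = λ { i 1≤i refl → up p≤r 1≤i ≤-refl }
    ; plateau = λ i p≤i i<p → contradiction p≤i (<⇒≱ i<p)
    ; fall    = λ p<r → down p<r ≤-refl
    ; descent = λ i p<i i<r → <⇒≤ (down i<r (<⇒≤ p<i))
    }
    where open Peaked P

  minimum : ∀ n → 2 ≤ n → IsMinimumGenus (𝒮₁₁ n) 1
  minimum (suc n) 2≤n = record
    { attained = attained {suc n} (Peaked.f1>0 (peak (suc n) 2≤n))
    ; minimal  = λ { zero    i∈ → contradiction (g₁₁-zero n) (occurs {suc n} i∈)
                   ; (suc i) _  → s≤s z≤n }
    }

  maximum : ∀ n → 2 ≤ n → IsMaximumGenus (𝒮₁₁ n) (maximumGenus n)
  maximum n 2≤n = record
    { attained = attained {n} (Peaked.fr>0 (peak n 2≤n))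
    ; maximal  = λ i i∈ → ≮⇒≥ λ r<i → occurs {n} i∈ (beyond n i 2≤n r<i)
    }


open import Data.Nat using (ℕ; _≤_)
open import Data.Product using (_×_; _,_; ∃₂)
open Peak using (maximumGenus; peak; peaked-shape; minimum; maximum)

corollary3p17 : ∀ (n : ℕ) → 2 ≤ n →
    ∃₂ λ q r →
    IsMinimumGenus (𝒮₁₁ n) q × IsMaximumGenus (𝒮₁₁ n) r ×
    Unimodal (g₁₁ n) q r × IsPeak (g₁₁ n) q r (p₁₁ n)
corollary3p17 n 2≤n =
  1 , maximumGenus n , minimum n 2≤n , maximum n 2≤n , (p₁₁ n , p₁₁ n , shape) , shape
  where
  shape : Shape (g₁₁ n) 1 (maximumGenus n) (p₁₁ n) (p₁₁ n)
  shape = peaked-shape (peak n 2≤n)
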